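{- Let $\Gamma$ be a distance-regular graph with classical parameters $(D,b,\alpha,\beta)$ such that $b\ge 2$ and $D\ge 3$, and let $r=[D]$. If $\beta \geq \frac{1}{3}(8\alpha b + 8b + 5\alpha)r$, then $\Gamma$ has the SPLS$(\lfloor \frac{4r}{3}\rfloor)$ property. In particular, in this case $\alpha$ is an integer with $0\le \alpha\le b$.
   Context: Distance-regular graph with intersection numbers $b_i,c_i$, valency $k=b_0$, $a_i = k-b_i-c_i$. For integer $b\ne 1$, $[j]=\frac{b^j-1}{b-1}$. Classical parameters $(D,b,\alpha,\beta)$ means diameter $D$, $b_i=([D]-[i])(\beta-\alpha[i])$ ($0\le i\le D-1$), $c_i=[i](1+\alpha[i-1])$ ($1\le i\le D$). A partial linear space is an incidence structure of points and lines in which any two distinct points lie on at most one common line; its point graph has the points as vertices, two distinct points adjacent iff they lie on a common line. For a partial linear space $X$, $\tau(X)$ is the maximum, over pairs of a point $x$ and a line $\ell$ not through $x$, of the number of points of $\ell$ collinear with $x$. For integers $c\ge 1$, $s\ge 2$, a distance-regular graph $\Gamma$ has the SPLS$(c,s)$ property if: $\Gamma$ is the point graph of a partial linear space $X=(V(\Gamma),\mathcal L,\in)$ where $\mathcal L$ is the set of all maximal cliques of $\Gamma$ with at least $a_1+2-(c-1)(s-1)$ vertices; $a_1\ge (2s-1)(c-1)$; each vertex lies on at most $s$ lines; and $\tau(X)\le c$. SPLS$(s)$ means SPLS$(c_2,s)$. -}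

module Defs where

open import Data.Nat using (ℕ; zero; suc; _∸_; _<_)
open import Data.Nat.Properties using (allUpTo?)
open import Data.Integer using (ℤ; +_; 0ℤ; 1ℤ)
import Data.Nat as Nat
import Data.Integer as Int
import Data.Integer.GCD as ℤG
import Data.Integer.Properties as ℤₚ
open import Data.Rational using (ℚ; 0ℚ; 1ℚ; _/_)
import Data.Rational as Rat
import Data.Rational.Properties as ℚₚ
open import Data.Fin using (Fin)
import Data.Fin.Properties as Finₚ
open import Data.Fin.Subset using (Subset; inside; outside; _∈_; _⊂_; ∣_∣)
open import Data.Fin.Subset.Properties using (_∈?_; _⊂?_; anySubset?)
open import Data.List using (List; []; _∷_; _++_; map; filter; length; lookup; allFin; cartesianProduct)
open import Data.List.Extrema.Nat using (max)
import Data.Vec as Vec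
open import Data.Product using (_×_; _,_; ∃; ∃₂)
open import Function using (_⇔_)
open import Relation.Nullary using (¬_; Dec; ¬?; _×-dec_; _→-dec_)
open import Relation.Nullary.Decidable using (map′)
open import Relation.Unary using (Pred; Decidable)
open import Relation.Binary.PropositionalEquality using (_≡_; _≢_; refl; sym; trans; cong; ≢-sym)
open import Level using (0ℓ)

#[_] : ∀ {n} {P : Pred (Fin n) 0ℓ} → Decidable P → ℕ
#[_] {n} P? = Vec.count P? (Vec.allFin n)

-- Every subset occurs exactly once.
allSubsets : ∀ n → List (Subset n)
allSubsets zero    = Vec.[] ∷ []
allSubsets (suc n) = map (inside Vec.∷_) (allSubsets n) ++ map (outside Vec.∷_) (allSubsets n)

record Graph (n : ℕ) : Set₁ where
  field
    Adj        : Fin n → Fin n → Set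
    Adj?       : ∀ x y → Dec (Adj x y)
    Adj-sym    : ∀ {x y} → Adj x y → Adj y x
    Adj-irrefl : ∀ {x} → ¬ Adj x x

module _ {n : ℕ} (Γ : Graph n) where
  open Graph Γ

  data Walk : ℕ → Fin n → Fin n → Set where
    here : ∀ {x} → Walk 0 x x
    step : ∀ {i x y z} → Adj x y → Walk i y z → Walk (suc i) x z

  Walk? : ∀ i x y → Dec (Walk i x y)
  Walk? zero x y = map′ (λ { refl → here }) (λ { here → refl }) (x Finₚ.≟ y)
  Walk? (suc i) x y =
    map′ (λ { (_ , a , w) → step a w }) (λ { (step a w) → _ , a , w })
         (Finₚ.any? (λ z → Adj? x z ×-dec Walk? i z y))

  Distance : ℕ → Fin n → Fin n → Set
  Distance i x y = Walk i x y × (∀ {j} → j < i → ¬ Walk j x y)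

  Distance? : ∀ i x y → Dec (Distance i x y)
  Distance? i x y = Walk? i x y ×-dec allUpTo? (λ j → ¬? (Walk? j x y)) i

  IsClique : Subset n → Set
  IsClique S = ∀ x → x ∈ S → ∀ y → y ∈ S → x ≢ y → Adj x y

  IsClique? : Decidable IsClique
  IsClique? S = Finₚ.all? λ x → (x ∈? S) →-dec Finₚ.all? λ y →
                (y ∈? S) →-dec (¬? (x Finₚ.≟ y) →-dec Adj? x y)

  IsMaximalClique : Subset n → Set
  IsMaximalClique S = IsClique S × ¬ (∃ λ T → IsClique T × S ⊂ T)

  IsMaximalClique? : Decidable IsMaximalClique
  IsMaximalClique? S =
    IsClique? S ×-dec ¬? (anySubset? λ T → IsClique? T ×-dec (S ⊂? T))

-- Only the values of intb at 0, …, diameter and of intc at 1, …, diameter are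
-- constrained (intb vanishes at the diameter); the others are arbitrary, so a₁ and c₂ are
-- meaningful once the diameter is at least 2.
record DistanceRegularGraph (n : ℕ) : Set₁ where
  field
    graph             : Graph n
    diameter          : ℕ
    connected         : ∀ x y → ∃ λ i → i Nat.≤ diameter × Distance graph i x y
    diameter-attained : ∃₂ λ x y → Distance graph diameter x y
    intb intc         : ℕ → ℕ
  open Graph graph public
  field
    intb-count : ∀ i x y → Distance graph i x y →
                 #[ (λ z → Adj? y z ×-dec Distance? graph (suc i) x z) ] ≡ intb i
    intc-count : ∀ i x y → Distance graph (suc i) x y →
                 #[ (λ z → Adj? y z ×-dec Distance? graph i x z) ] ≡ intc (suc i)

  valency : ℕ
  valency = intb 0

  inta : ℕ → ℤ
  inta i = + valency Int.- + intb i Int.- + intc i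

fromℤ : ℤ → ℚ
fromℤ i = i / 1

fromℕ : ℕ → ℚ
fromℕ m = fromℤ (+ m)

fromℤ≡0⇒≡0 : ∀ i → fromℤ i ≡ 0ℚ → i ≡ 0ℤ
fromℤ≡0⇒≡0 i eq =
  trans (sym (ℚₚ.↥-/ i 1)) (cong (λ p → Rat.ℚ.numerator p Int.* ℤG.gcd i (+ 1)) eq)

b-1-nonZero : ∀ b → b ≢ 1ℤ → Rat.NonZero (fromℤ (b Int.- 1ℤ))
b-1-nonZero b b≢1 =
  Rat.≢-nonZero λ eq → b≢1 (ℤₚ.i-j≡0⇒i≡j b 1ℤ (fromℤ≡0⇒≡0 (b Int.- 1ℤ) eq))

bracket : (b : ℤ) → b ≢ 1ℤ → ℕ → ℚ
bracket b b≢1 j =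
  Rat._÷_ (fromℤ (b Int.^ j Int.- 1ℤ)) (fromℤ (b Int.- 1ℤ)) {{b-1-nonZero b b≢1}}

record HasClassicalParameters {n : ℕ} (Γ : DistanceRegularGraph n)
         (D : ℕ) (b : ℤ) (b≢1 : b ≢ 1ℤ) (α β : ℚ) : Set where
  open DistanceRegularGraph Γ
  open Rat using (_+_; _-_; _*_)
  [_] : ℕ → ℚ
  [_] = bracket b b≢1
  field
    diameter≡ : diameter ≡ D
    intb≡     : ∀ i → i < D → fromℕ (intb i) ≡ ([ D ] - [ i ]) * (β - α * [ i ])
    intc≡     : ∀ i → 1 Nat.≤ i → i Nat.≤ D → fromℕ (intc i) ≡ [ i ] * (1ℚ + α * [ i ∸ 1 ])

-- p points, q lines
record IncidenceStructure (p q : ℕ) : Set₁ where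
  field
    _on_  : Fin p → Fin q → Set
    _on?_ : ∀ x l → Dec (x on l)

module _ {p q : ℕ} (X : IncidenceStructure p q) where
  open IncidenceStructure X

  IsPartialLinearSpace : Set
  IsPartialLinearSpace =
    ∀ x y l m → x ≢ y → x on l → y on l → x on m → y on m → l ≡ m

  pointGraph : Graph p
  pointGraph = record
    { Adj        = λ x y → x ≢ y × ∃ λ l → x on l × y on l
    ; Adj?       = λ x y → ¬? (x Finₚ.≟ y) ×-dec Finₚ.any? (λ l → (x on? l) ×-dec (y on? l))
    ; Adj-sym    = λ { (x≢y , l , xl , yl) → ≢-sym x≢y , l , yl , xl }
    ; Adj-irrefl = λ { (x≢x , _) → x≢x refl }
    }

  linesThrough : Fin p → ℕ
  linesThrough x = #[ (λ l → x on? l) ]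

  collinearPoints : Fin p → Fin q → ℕ
  collinearPoints x l = #[ (λ y → (y on? l) ×-dec Graph.Adj? pointGraph x y) ]

  -- The maximum is 0 if every point is on every line.
  τ : ℕ
  τ = max 0 (map (λ (x , l) → collinearPoints x l)
                 (filter (λ (x , l) → ¬? (x on? l))
                         (cartesianProduct (allFin p) (allFin q))))

module _ {n : ℕ} (Γ : DistanceRegularGraph n) where
  open DistanceRegularGraph Γ
  open Int using (_+_; _-_; _*_; _≤_; _≥_)

  module _ (c s : ℤ) where

    IsLine : Subset n → Set
    IsLine S = IsMaximalClique graph S ×
               + ∣ S ∣ ≥ inta 1 + + 2 - (c - 1ℤ) * (s - 1ℤ)

    IsLine? : Decidable IsLine
    IsLine? S = IsMaximalClique? graph S ×-dec (_ ℤₚ.≤? + ∣ S ∣)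

    lines : List (Subset n)
    lines = filter IsLine? (allSubsets n)

    cliqueSpace : IncidenceStructure n (length lines)
    cliqueSpace = record
      { _on_  = λ x l → x ∈ lookup lines l
      ; _on?_ = λ x l → x ∈? lookup lines l
      }

    record HasSPLSWith : Set where
      field
        c≥1           : c ≥ 1ℤ
        s≥2           : s ≥ + 2
        partialLinear : IsPartialLinearSpace cliqueSpace
        isPointGraph  : ∀ x y → Adj x y ⇔ Graph.Adj (pointGraph cliqueSpace) x y
        a₁-bound      : inta 1 ≥ (+ 2 * s - 1ℤ) * (c - 1ℤ)
        lines≤s       : ∀ x → + linesThrough cliqueSpace x ≤ s
        τ≤c           : + τ cliqueSpace ≤ c

  HasSPLS : ℤ → Set
  HasSPLS s = HasSPLSWith (+ intc 2) s

{-# OPTIONS --safe #-}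
module Submission where

-- Metsch's argument: no vertex is the centre of a claw with s + 1 leaves, since two leaves have only
-- c₂ common neighbours, so that the centre would have too many neighbours. Replacing leaves by large
-- cliques one at a time then shows that adjacent vertices lie on a common line.
--
-- For the integrality of α, consider the eigenvalue -r. The sums of an eigenvector over the spheres
-- around x are fixed multiples of its value at x, so the matrix F of the standard sequence of -r is
-- a multiple of the projection onto the eigenspace. Its trace shows that -r has multiplicity at least
-- n / 2, which exceeds the number of lines. Hence some eigenvector u ≠ 0 sums to zero on every line.
-- With N the incidence matrix and A the adjacency matrix, N Nᵀ is A plus the diagonal matrix of the
-- numbers of lines through the vertices, so exactly r lines pass through x when u x ≠ 0. The sizes
-- of these lines average 1 + β, so each of them attains Delsarte's bound, and every vertex off such a
-- line with a neighbour on it has exactly φ = 1 + α neighbours there. So α is an integer. Counting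
-- the common neighbours of two suitable vertices at distance 2 gives φ² ≤ c₂ = (1 + b) (1 + α), that
-- is, α ≤ b.

-- The number s = ⌊4r/3⌋ balances two demands. A line has to keep a point that is nonadjacent to all
-- leaves of a claw with at most s leaves, which costs a₁ ≥ (2s - 1)(c₂ - 1); here c₂ - 1 = αb + b +
-- α and 2s ≤ 8r/3, whence the size of the lower bound for β. On the other hand a claw with s + 1
-- leaves has to be impossible. By inclusion and exclusion its leaves account on average for at
-- least a₁ + 1 - s(c₂ - 1)/2 neighbours of the centre; under the same bound this is at least 3β/4,
-- so that s + 1 > 4r/3 leaves overrun the valency rβ. All of this is computed in ℤ, with α and β
-- over a common denominator t, so that inequalities become ring identities with visible slack. The
-- spectral part uses no bases and no real numbers: the dimension of an eigenspace is a trace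
-- divided by a scale, and imposing one linear condition lowers this quotient by at most 1. Summing
-- an eigenvector over balls turns the three-term recursion for its sphere sums into one of first
-- order.

module Sums where

  open import Defs
  open import Data.Bool using (true; false; if_then_else_)
  open import Data.Nat using (ℕ; zero; suc)
  open import Data.Integer using (ℤ; +_; 0ℤ; 1ℤ; _+_; _-_; _*_; -_; _≤_; _<_; +≤+; +<+; positive; nonNegative)
  import Data.Integer as ℤ
  open import Data.Integer.Properties
  open import Data.Fin using (Fin; zero; suc)
  import Data.Fin.Properties as Fin
  open import Data.Fin.Subset using (Subset; ∣_∣)
  open import Data.Fin.Subset.Properties using (_∈?_)
  open import Data.Vec using ([]; _∷_; here; there)
  import Data.Vec as Vec
  open import Data.Product using (_,_; ∃)
  open import Data.Sum using (_⊎_; inj₁; inj₂)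
  open import Function using (_∘_)
  open import Relation.Nullary using (¬_; Dec; yes; no; does; _×-dec_; _⊎-dec_; contradiction)
  open import Relation.Unary using (Decidable; Pred)
  open import Relation.Binary.PropositionalEquality
  open import Data.Integer.Tactic.RingSolver using (solve-∀)
  open import Level using (0ℓ)
  open import Algebra.Properties.Semiring.Sum +-*-semiring public
    using (sum; sum-cong-≗; ∑-distrib-+; ∑-comm; *-distribˡ-sum; *-distribʳ-sum; sum-replicate-zero)

  -- Polynomial inequalities a ≤ b are reduced to ring identities by exhibiting b - a as an
  -- expression e that is built from nonnegative pieces.
  ≤-by : ∀ {a b} e → 0ℤ ≤ e → b ≡ a + e → a ≤ b
  ≤-by {a} e 0≤e refl = subst (_≤ a + e) (+-identityʳ a) (+-monoʳ-≤ a 0≤e)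

  0≤+ : ∀ {a b} → 0ℤ ≤ a → 0ℤ ≤ b → 0ℤ ≤ a + b
  0≤+ = +-mono-≤

  0≤* : ∀ {a b} → 0ℤ ≤ a → 0ℤ ≤ b → 0ℤ ≤ a * b
  0≤* {a} {b} 0≤a 0≤b = subst (_≤ a * b) (*-zeroʳ a) (*-monoˡ-≤-nonNeg a {{nonNegative 0≤a}} 0≤b)

  0≤- : ∀ {a b} → a ≤ b → 0ℤ ≤ b - a
  0≤- = i≤j⇒0≤j-i

  0≤square : ∀ a → 0ℤ ≤ a * a
  0≤square (+ n) = 0≤* {+ n} {+ n} (+≤+ Data.Nat.z≤n) (+≤+ Data.Nat.z≤n)
  0≤square ℤ.-[1+ n ] = +≤+ Data.Nat.z≤n

  *-cancelˡ-≤ : ∀ {a b c} → 0ℤ < c → c * a ≤ c * b → a ≤ b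
  *-cancelˡ-≤ {a} {b} {c} 0<c = *-cancelˡ-≤-pos a b c {{positive 0<c}}

  ≢-cancelˡ : ∀ {a b c} → c ≢ 0ℤ → c * a ≡ c * b → a ≡ b
  ≢-cancelˡ {a} {b} {c} c≢0 = *-cancelˡ-≡ c a b {{ℤ.≢-nonZero c≢0}}

  <-cancelˡ : ∀ {a b c} → 0ℤ < c → c * a ≡ c * b → a ≡ b
  <-cancelˡ 0<c = ≢-cancelˡ (≢-sym (<⇒≢ 0<c))

  1≤⇒≰0 : ∀ {a} → 1ℤ ≤ a → ¬ a ≤ 0ℤ
  1≤⇒≰0 1≤a a≤0 = contradiction (≤-trans 1≤a a≤0) λ { (+≤+ ()) }

  0<* : ∀ {a b} → 0ℤ < a → 0ℤ < b → 0ℤ < a * b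
  0<* {a} {b} 0<a 0<b = subst (_< a * b) (*-zeroʳ a) (*-monoˡ-<-pos a {{positive 0<a}} 0<b)

  -- Integer indicators, finite sums and cardinalities.

  private variable
    n m : ℕ
    P Q : Set

  𝟙 : Dec P → ℤ
  𝟙 d = if does d then 1ℤ else 0ℤ

  𝟙-yes : (d : Dec P) → P → 𝟙 d ≡ 1ℤ
  𝟙-yes (yes _) _ = refl
  𝟙-yes (no ¬p) p = contradiction p ¬p

  𝟙-no : (d : Dec P) → ¬ P → 𝟙 d ≡ 0ℤ
  𝟙-no (yes p) ¬p = contradiction p ¬p
  𝟙-no (no _) _ = refl

  0≤𝟙 : (d : Dec P) → 0ℤ ≤ 𝟙 d
  0≤𝟙 (yes _) = +≤+ Data.Nat.z≤n
  0≤𝟙 (no _) = +≤+ Data.Nat.z≤n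

  𝟙-mono : (d : Dec P) (e : Dec Q) → (P → Q) → 𝟙 d ≤ 𝟙 e
  𝟙-mono (yes p) e f = ≤-reflexive (sym (𝟙-yes e (f p)))
  𝟙-mono (no _) e f = 0≤𝟙 e

  𝟙-cong : (d : Dec P) (e : Dec Q) → (P → Q) → (Q → P) → 𝟙 d ≡ 𝟙 e
  𝟙-cong d e f g = ≤-antisym (𝟙-mono d e f) (𝟙-mono e d g)

  𝟙-× : (d : Dec P) (e : Dec Q) → 𝟙 (d ×-dec e) ≡ 𝟙 d * 𝟙 e
  𝟙-× (yes _) (yes _) = refl
  𝟙-× (yes _) (no _) = refl
  𝟙-× (no _) (yes _) = refl
  𝟙-× (no _) (no _) = refl

  sum-mono : ∀ {f g : Fin n → ℤ} → (∀ i → f i ≤ g i) → sum f ≤ sum g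
  sum-mono {zero} _ = ≤-refl
  sum-mono {suc n} f≤g = +-mono-≤ (f≤g zero) (sum-mono (f≤g ∘ suc))

  sum-zero : ∀ {f : Fin n → ℤ} → (∀ i → f i ≡ 0ℤ) → sum f ≡ 0ℤ
  sum-zero {n} f≡0 = trans (sum-cong-≗ f≡0) (sum-replicate-zero n)

  0≤sum : ∀ {f : Fin n → ℤ} → (∀ i → 0ℤ ≤ f i) → 0ℤ ≤ sum f
  0≤sum {zero} _ = ≤-refl
  0≤sum {suc n} 0≤f = 0≤+ (0≤f zero) (0≤sum (0≤f ∘ suc))

  term≤sum : ∀ {f : Fin n → ℤ} → (∀ i → 0ℤ ≤ f i) → ∀ i → f i ≤ sum f
  term≤sum {f = f} 0≤f zero = ≤-by _ (0≤sum (0≤f ∘ suc)) refl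
  term≤sum {f = f} 0≤f (suc i) =
    ≤-trans (term≤sum (0≤f ∘ suc) i) (≤-by _ (0≤f zero) (+-comm (f zero) _))

  sum≤0⇒≡0 : ∀ {f : Fin n → ℤ} → (∀ i → 0ℤ ≤ f i) → sum f ≤ 0ℤ → ∀ i → f i ≡ 0ℤ
  sum≤0⇒≡0 0≤f s≤0 i = ≤-antisym (≤-trans (term≤sum 0≤f i) s≤0) (0≤f i)

  sum>0⇒∃>0 : ∀ (f : Fin n → ℤ) → 0ℤ < sum f → ∃ λ i → 0ℤ < f i
  sum>0⇒∃>0 {zero} f (+<+ ())
  sum>0⇒∃>0 {suc n} f 0<s with 0ℤ ℤ.<? f zero
  ... | yes 0<f0 = zero , 0<f0
  ... | no 0≮f0 with sum>0⇒∃>0 (f ∘ suc) (<-≤-trans 0<s (≤-by _ (0≤- (≮⇒≥ 0≮f0)) (lemma (f zero) _)))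
    where
    lemma : ∀ a b → b ≡ a + b + (0ℤ - a)
    lemma = solve-∀
  ... | i , 0<fi = suc i , 0<fi

  sum-+₃ : ∀ (f g h : Fin n → ℤ) → sum (λ i → f i + g i + h i) ≡ sum f + sum g + sum h
  sum-+₃ f g h = trans (∑-distrib-+ (λ i → f i + g i) h) (cong (λ u → u + sum h) (∑-distrib-+ f g))

  sum-const : ∀ n c → sum {n} (λ _ → c) ≡ + n * c
  sum-const zero c = sym (*-zeroˡ c)
  sum-const (suc n) c = trans (cong (ℤ._+_ c) (sum-const n c)) (sym (suc-* (+ n) c))

  sum-δ : ∀ (x : Fin n) (f : Fin n → ℤ) → sum (λ y → 𝟙 (x Fin.≟ y) * f y) ≡ f x
  sum-δ {suc n} zero f = trans (cong₂ _+_ (*-identityˡ (f zero)) (sum-zero λ i → *-zeroˡ (f (suc i)))) (+-identityʳ (f zero))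
  sum-δ {suc n} (suc x) f = trans (cong₂ _+_ (*-zeroˡ (f zero)) (trans (sum-cong-≗ lemma) (sum-δ x (f ∘ suc)))) (+-identityˡ _)
    where
    lemma : ∀ y → 𝟙 (suc x Fin.≟ suc y) * f (suc y) ≡ 𝟙 (x Fin.≟ y) * f (suc y)
    lemma y = cong (_* f (suc y)) (𝟙-cong (suc x Fin.≟ suc y) (x Fin.≟ y) Fin.suc-injective (cong suc))

  -- Counting by sums in ℤ turns double counting into `∑-comm` and lets the ring solver check bounds
  -- that contain subtractions; `+#≡card` and `+∣∣≡card` connect it with the counts in the
  -- definitions.
  card : {P : Pred (Fin n) 0ℓ} → Decidable P → ℤ
  card P? = sum λ i → 𝟙 (P? i)

  module _ {P Q : Pred (Fin n) 0ℓ} (P? : Decidable P) (Q? : Decidable Q) where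

    card-mono : (∀ {i} → P i → Q i) → card P? ≤ card Q?
    card-mono P⊆Q = sum-mono λ i → 𝟙-mono (P? i) (Q? i) P⊆Q

    card-cong : (∀ {i} → P i → Q i) → (∀ {i} → Q i → P i) → card P? ≡ card Q?
    card-cong P⊆Q Q⊆P = sum-cong-≗ λ i → 𝟙-cong (P? i) (Q? i) P⊆Q Q⊆P

  module _ {P : Pred (Fin n) 0ℓ} (P? : Decidable P) where

    0≤card : 0ℤ ≤ card P?
    0≤card = 0≤sum λ i → 0≤𝟙 (P? i)

    1≤card : ∀ {i} → P i → 1ℤ ≤ card P?
    1≤card {i} Pi = ≤-trans (≤-reflexive (sym (𝟙-yes (P? i) Pi))) (term≤sum (λ j → 0≤𝟙 (P? j)) i)

    card-zero : (∀ i → ¬ P i) → card P? ≡ 0ℤ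
    card-zero ¬P = sum-zero λ i → 𝟙-no (P? i) (¬P i)

    card>0⇒∃ : 0ℤ < card P? → ∃ P
    card>0⇒∃ 0<c with sum>0⇒∃>0 _ 0<c
    ... | i , 0<𝟙 with P? i
    ...   | yes Pi = i , Pi
    ...   | no _ = contradiction 0<𝟙 λ { (+<+ ()) }

  +count-tabulate : ∀ {A : Set} {P : Pred A 0ℓ} (P? : Decidable P) (f : Fin n → A) →
    + Vec.count P? (Vec.tabulate f) ≡ sum (λ i → 𝟙 (P? (f i)))
  +count-tabulate {zero} P? f = refl
  +count-tabulate {suc n} P? f with does (P? (f zero))
  ... | true = cong (ℤ._+_ 1ℤ) (+count-tabulate P? (f ∘ suc))
  ... | false = trans (+count-tabulate P? (f ∘ suc)) (sym (+-identityˡ _))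

  +#≡card : {P : Pred (Fin n) 0ℓ} (P? : Decidable P) → + #[ P? ] ≡ card P?
  +#≡card P? = +count-tabulate P? (λ i → i)

  +∣∣≡card : (S : Subset n) → + ∣ S ∣ ≡ card (_∈? S)
  +∣∣≡card [] = refl
  +∣∣≡card {suc n} (s ∷ S) = trans (lemma s) (cong₂ _+_ (lemma₀ s) (trans (+∣∣≡card S) (sum-cong-≗ λ i →
      𝟙-cong (i ∈? S) (suc i ∈? (s ∷ S)) there λ { (there p) → p })))
    where
    bit : Data.Bool.Bool → ℤ
    bit b = if b then 1ℤ else 0ℤ
    lemma : ∀ s → + ∣ s ∷ S ∣ ≡ bit s + + ∣ S ∣
    lemma true = refl
    lemma false = sym (+-identityˡ _)
    lemma₀ : ∀ s → bit s ≡ 𝟙 (zero ∈? (s ∷ S))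
    lemma₀ true = sym (𝟙-yes (zero ∈? (true ∷ S)) here)
    lemma₀ false = sym (𝟙-no (zero ∈? (false ∷ S)) λ ())

  module _ {P Q R : Pred (Fin n) 0ℓ} (P? : Decidable P) (Q? : Decidable Q) (R? : Decidable R) where

    card-∪-≤ : (∀ {i} → P i → Q i ⊎ R i) → card P? ≤ card Q? + card R?
    card-∪-≤ P⊆Q∪R = ≤-trans (sum-mono pointwise) (≤-reflexive (∑-distrib-+ (λ i → 𝟙 (Q? i)) (λ i → 𝟙 (R? i))))
      where
      pointwise : ∀ i → 𝟙 (P? i) ≤ 𝟙 (Q? i) + 𝟙 (R? i)
      pointwise i with P? i
      ... | no _ = 0≤+ (0≤𝟙 (Q? i)) (0≤𝟙 (R? i))
      ... | yes Pi with P⊆Q∪R Pi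
      ...   | inj₁ Qi rewrite 𝟙-yes (Q? i) Qi = ≤-by _ (0≤𝟙 (R? i)) refl
      ...   | inj₂ Ri rewrite 𝟙-yes (R? i) Ri = ≤-by _ (0≤𝟙 (Q? i)) (+-comm (𝟙 (Q? i)) 1ℤ)

    card-⊎-≤ : (∀ {i} → Q i → P i) → (∀ {i} → R i → P i) → (∀ {i} → Q i → ¬ R i) → card Q? + card R? ≤ card P?
    card-⊎-≤ Q⊆P R⊆P disjoint = ≤-trans (≤-reflexive (sym (∑-distrib-+ (λ i → 𝟙 (Q? i)) (λ i → 𝟙 (R? i))))) (sum-mono pointwise)
      where
      pointwise : ∀ i → 𝟙 (Q? i) + 𝟙 (R? i) ≤ 𝟙 (P? i)
      pointwise i with Q? i
      ... | no _ = ≤-trans (≤-reflexive (+-identityˡ _)) (𝟙-mono (R? i) (P? i) R⊆P)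
      ... | yes Qi rewrite 𝟙-yes (P? i) (Q⊆P Qi) | 𝟙-no (R? i) (disjoint Qi) = ≤-refl

  card-≡ : (x : Fin n) → card (x Fin.≟_) ≡ 1ℤ
  card-≡ x = trans (sum-cong-≗ λ y → sym (*-identityʳ (𝟙 (x Fin.≟ y)))) (sum-δ x λ _ → 1ℤ)

  card-∪-∩ : ∀ {P Q : Pred (Fin n) 0ℓ} (P? : Decidable P) (Q? : Decidable Q) →
    card P? + card Q? ≡ card (λ i → P? i ⊎-dec Q? i) + card (λ i → P? i ×-dec Q? i)
  card-∪-∩ P? Q? = trans (sym (∑-distrib-+ (λ i → 𝟙 (P? i)) (λ i → 𝟙 (Q? i))))
    (trans (sum-cong-≗ pointwise) (∑-distrib-+ (λ i → 𝟙 (P? i ⊎-dec Q? i)) (λ i → 𝟙 (P? i ×-dec Q? i))))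
    where
    pointwise : ∀ i → 𝟙 (P? i) + 𝟙 (Q? i) ≡ 𝟙 (P? i ⊎-dec Q? i) + 𝟙 (P? i ×-dec Q? i)
    pointwise i with P? i | Q? i
    ... | yes _ | yes _ = refl
    ... | yes _ | no _ = refl
    ... | no _ | yes _ = refl
    ... | no _ | no _ = refl

-- Maximal cliques, claws and lines: Metsch's construction.

module Metsch where

  open import Defs
  open Sums
  open import Data.Nat using (ℕ; zero; suc; z≤n; s≤s)
  import Data.Nat as ℕ
  import Data.Nat.Properties as ℕ
  open import Data.Integer using (ℤ; +_; 0ℤ; 1ℤ; _+_; _-_; _*_; _≤_; +≤+)
  import Data.Integer as ℤ
  open import Data.Integer.Properties hiding (_≟_)
  open import Data.Integer.Tactic.RingSolver using (solve-∀)
  open import Data.Fin using (Fin; zero; suc)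
  open import Data.Fin.Properties using (_≟_; any?)
  open import Data.Fin.Subset using (Subset; _∈_; _∉_; _⊆_; ∣_∣; _∪_; ⁅_⁆)
  open import Data.Fin.Subset.Properties
    using (_∈?_; _⊂?_; anySubset?; ⊆-antisym; p⊆p∪q; x∈p∪q⁻; x∈p∪q⁺; x∈⁅x⁆; x∈⁅y⁆⇒x≡y)
  open import Data.Fin.Subset.Induction using (⊃-wellFounded)
  open import Induction.WellFounded using (Acc; acc)
  open import Data.Empty using (⊥; ⊥-elim)
  open import Data.List using (List; []; _∷_; _++_; length; take)
  open import Data.List.Properties using (length-++; ++-assoc; ++-identityʳ; length-take)
  open import Data.List.Relation.Unary.All using (All; []; _∷_)
  import Data.List.Relation.Unary.All as All
  import Data.List.Relation.Unary.All.Properties as All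
  open import Data.List.Relation.Unary.Any using (Any; here; there)
  import Data.List.Relation.Unary.Any as Any
  open import Data.List.Relation.Unary.AllPairs using (AllPairs; []; _∷_)
  import Data.List.Relation.Unary.AllPairs as AllPairs
  import Data.List.Relation.Unary.AllPairs.Properties as AllPairs
  open import Data.Product using (_×_; _,_; ∃; proj₁; proj₂)
  open import Data.Sum using (_⊎_; inj₁; inj₂)
  import Data.Vec as Vec
  import Data.Vec.Properties as Vec
  open import Function using (_∘_)
  open import Level using (0ℓ)
  open import Relation.Nullary using (¬_; Dec; yes; no; ¬?; does; _×-dec_; _⊎-dec_; contradiction)
  open import Relation.Nullary.Decidable using (dec-true; decidable-stable)
  open import Relation.Unary using (Decidable; Pred)
  open import Relation.Binary.PropositionalEquality hiding (J)

  private variable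
    n : ℕ

  -- Union bound: each member of K rules out at most m of the points with P. All free points below
  -- are found this way: on lines, among neighbours, and among common neighbours.
  sieve : ∀ {P : Pred (Fin n) 0ℓ} {R : Fin n → Fin n → Set} (P? : Decidable P) (R? : ∀ y w → Dec (R y w)) {m} K →
    All (λ y → card (λ w → P? w ×-dec R? y w) ≤ m) K →
    card P? - + length K * m ≤ card (λ w → P? w ×-dec All.all? (λ y → ¬? (R? y w)) K)
  sieve P? R? {m} [] [] = ≤-trans (≤-reflexive (lemma (card P?) m)) (card-mono P? (λ w → P? w ×-dec All.all? (λ y → ¬? (R? y w)) []) (_, []))
    where
    lemma : ∀ a m → a - 0ℤ * m ≡ a
    lemma = solve-∀
  sieve P? R? {m} (y ∷ K) (y≤m ∷ K≤m) =
    ≤-by _ (0≤+ (0≤- (≤-trans (sieve P? R? K K≤m) split)) (0≤- y≤m)) (lemma (card P?) (+ length K) m _ _)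
    where
    split = card-∪-≤ (λ w → P? w ×-dec All.all? (λ y → ¬? (R? y w)) K)
                     (λ w → P? w ×-dec All.all? (λ y → ¬? (R? y w)) (y ∷ K))
                     (λ w → P? w ×-dec R? y w)
      (λ {w} (Pw , none) → case w Pw none (R? y w))
      where
      case : ∀ w → _ → _ → Dec _ → _
      case w Pw none (yes r) = inj₂ (Pw , r)
      case w Pw none (no ¬r) = inj₁ (Pw , ¬r ∷ none)
    lemma : ∀ p l m q r → q ≡ p - (1ℤ + l) * m + (q + r - (p - l * m) + (m - r))
    lemma = solve-∀

  toSubset : {P : Pred (Fin n) 0ℓ} → Decidable P → Subset n
  toSubset P? = Vec.tabulate (does ∘ P?)

  module _ {P : Pred (Fin n) 0ℓ} (P? : Decidable P) where

    ∈-toSubset⁺ : ∀ {x} → P x → x ∈ toSubset P?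
    ∈-toSubset⁺ {x} Px = Vec.lookup⇒[]= x _ (trans (Vec.lookup∘tabulate _ x) (dec-true (P? x) Px))

    ∈-toSubset⁻ : ∀ {x} → x ∈ toSubset P? → P x
    ∈-toSubset⁻ {x} x∈ with P? x | trans (sym (Vec.lookup∘tabulate (does ∘ P?) x)) (Vec.[]=⇒lookup x∈)
    ... | yes Px | _ = Px
    ... | no _ | ()

  module _ (Γ : Graph n) where
    open Graph Γ

    extend-clique : ∀ S → IsClique Γ S → ∃ λ T → IsMaximalClique Γ T × S ⊆ T
    extend-clique S clique = go S clique (⊃-wellFounded S)
      where
      go : ∀ S → IsClique Γ S → Acc _ S → ∃ λ T → IsMaximalClique Γ T × S ⊆ T
      go S clique (acc rec) with anySubset? (λ T → IsClique? Γ T ×-dec (S ⊂? T))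
      ... | no maximal = S , (clique , maximal) , λ x∈S → x∈S
      ... | yes (T , T-clique , S⊂T) with go T T-clique (rec S⊂T)
      ...   | M , M-max , T⊆M = M , M-max , T⊆M ∘ proj₁ S⊂T

    nonneighbour-in-maximal : ∀ {S x} → IsMaximalClique Γ S → x ∉ S → ∃ λ y → y ∈ S × ¬ Adj x y
    nonneighbour-in-maximal {S} {x} (clique , maximal) x∉S with any? (λ y → (y ∈? S) ×-dec ¬? (Adj? x y))
    ... | yes found = found
    ... | no none = ⊥-elim (maximal (S ∪ ⁅ x ⁆ , bigger , p⊆p∪q ⁅ x ⁆ , x , x∈p∪q⁺ (inj₂ (x∈⁅x⁆ x)) , x∉S))
      where
      adj : ∀ {y} → y ∈ S → Adj x y
      adj {y} y∈S = decidable-stable (Adj? x y) λ ¬a → none (y , y∈S , ¬a)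
      bigger : IsClique Γ (S ∪ ⁅ x ⁆)
      bigger y y∈ z z∈ y≢z with x∈p∪q⁻ S ⁅ x ⁆ y∈ | x∈p∪q⁻ S ⁅ x ⁆ z∈
      ... | inj₁ y∈S | inj₁ z∈S = clique y y∈S z z∈S y≢z
      ... | inj₁ y∈S | inj₂ z∈x with refl ← x∈⁅y⁆⇒x≡y x z∈x = Adj-sym (adj y∈S)
      ... | inj₂ y∈x | inj₁ z∈S with refl ← x∈⁅y⁆⇒x≡y x y∈x = adj z∈S
      ... | inj₂ y∈x | inj₂ z∈x = contradiction (trans (x∈⁅y⁆⇒x≡y x y∈x) (sym (x∈⁅y⁆⇒x≡y x z∈x))) y≢z

    module Claws (a c : ℤ) (s : ℕ)
      (adj-count : ∀ {x y} → Adj x y → card (λ z → Adj? x z ×-dec Adj? y z) ≡ a)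
      (nonadj-count : ∀ {x y z} → x ≢ y → ¬ Adj x y → Adj x z → Adj y z →
                      card (λ z → Adj? x z ×-dec Adj? y z) ≡ c)
      (1≤c : 1ℤ ≤ c)
      (a-large : (+ 2 * + s - 1ℤ) * (c - 1ℤ) ≤ a)
      where

      Line : Subset n → Set
      Line S = IsMaximalClique Γ S × a + + 2 - (c - 1ℤ) * (+ s - 1ℤ) ≤ + ∣ S ∣

      clique-adj : ∀ {S x y} → Line S → x ∈ S → y ∈ S → x ≢ y → Adj x y
      clique-adj ((clique , _) , _) x∈S y∈S x≢y = clique _ x∈S _ y∈S x≢y

      adj⇒≢ : ∀ {x y} → Adj x y → x ≢ y
      adj⇒≢ adj refl = Adj-irrefl adj

      -- P lies inside the c common neighbours of x and y, and w is one of these that P misses.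
      nonadj-count-except : ∀ {x y w} {P : Pred (Fin n) 0ℓ} (P? : Decidable P) → x ≢ y → ¬ Adj x y → Adj x w → Adj y w →
        (∀ {z} → P z → Adj x z × Adj y z × w ≢ z) → card P? ≤ c - 1ℤ
      nonadj-count-except {x} {y} {w} P? x≢y ¬xy xw yw P⊆ = ≤-by _ (0≤- bound) (lemma (card P?) c)
        where
        bound : 1ℤ + card P? ≤ c
        bound = begin
          1ℤ + card P?            ≡⟨ cong (ℤ._+ card P?) (card-≡ w) ⟨
          card (w ≟_) + card P?   ≤⟨ card-⊎-≤ (λ z → Adj? x z ×-dec Adj? y z) (w ≟_) P?
                                       (λ { refl → xw , yw }) (λ Pz → proj₁ (P⊆ Pz) , proj₁ (proj₂ (P⊆ Pz)))
                                       (λ { refl Pz → proj₂ (proj₂ (P⊆ Pz)) refl }) ⟩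
          card (λ z → Adj? x z ×-dec Adj? y z) ≡⟨ nonadj-count x≢y ¬xy xw yw ⟩
          c                       ∎
          where open ≤-Reasoning
        lemma : ∀ p c → c - 1ℤ ≡ p + (c - (1ℤ + p))
        lemma = solve-∀

      -- By maximality S contains a nonneighbour y of x. Every neighbour of x in S is also adjacent
      -- to y, so as soon as there is one, x and y have exactly c common neighbours.
      neighbours-on-line : ∀ {S x} → Line S → x ∉ S → card (λ y → (y ∈? S) ×-dec Adj? x y) ≤ c
      neighbours-on-line {S} {x} L x∉S with nonneighbour-in-maximal (proj₁ L) x∉S
      ... | y , y∈S , ¬xy with 0ℤ ℤ.<? card (λ y → (y ∈? S) ×-dec Adj? x y)
      ...   | no none = ≤-trans (≮⇒≥ none) (≤-trans (+≤+ z≤n) 1≤c)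
      ...   | yes some with card>0⇒∃ (λ y → (y ∈? S) ×-dec Adj? x y) some
      ...     | w , w∈S , xw = ≤-trans
          (card-mono (λ z → (z ∈? S) ×-dec Adj? x z) (λ z → Adj? x z ×-dec Adj? y z) λ { (z∈S , xz) → xz , clique-adj L y∈S z∈S λ { refl → ¬xy xz } })
          (≤-reflexive (nonadj-count (λ { refl → x∉S y∈S }) ¬xy xw (clique-adj L y∈S w∈S λ { refl → ¬xy xw })))

      neighbours-on-line-except : ∀ {S x w} → Line S → x ∉ S → w ∈ S → Adj x w →
        card (λ y → ((y ∈? S) ×-dec ¬? (w ≟ y)) ×-dec Adj? x y) ≤ c - 1ℤ
      neighbours-on-line-except {S} {x} {w} L x∉S w∈S xw with nonneighbour-in-maximal (proj₁ L) x∉S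
      ... | y , y∈S , ¬xy = nonadj-count-except (λ y → ((y ∈? S) ×-dec ¬? (w ≟ y)) ×-dec Adj? x y) (λ { refl → x∉S y∈S }) ¬xy xw
        (clique-adj L y∈S w∈S λ { refl → ¬xy xw })
        λ { ((z∈S , w≢z) , xz) → xz , clique-adj L y∈S z∈S (λ { refl → ¬xy xz }) , w≢z }

      -- If u ∈ S ∖ T, then u is nonadjacent to some v ∈ T; S ∩ T lies in the common neighbourhood of
      -- u and v, while S ∪ T lies in that of x and y (together with x and y themselves).
      line-⊆ : ∀ {S T x y} → Line S → Line T → x ≢ y → x ∈ S → y ∈ S → x ∈ T → y ∈ T → S ⊆ T
      line-⊆ {S} {T} {x} {y} L M x≢y xS yS xT yT {u} u∈S = decidable-stable (u ∈? T) λ u∉T → impossible u∉T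
        where
        impossible : u ∉ T → ⊥
        impossible u∉T with nonneighbour-in-maximal (proj₁ M) u∉T
        -- Two sizes of at least a + 2 - (c - 1)(s - 1) with sum at most a + 2 + c would force a + 1
        -- ≤ (2s - 1)(c - 1), against `a-large`.
        ... | v , v∈T , ¬uv = 1≤⇒≰0 (≤-refl {1ℤ}) (≤-trans
                (≤-by _ (0≤+ (0≤+ (0≤+ (0≤- (proj₂ L)) (0≤- (proj₂ M))) (0≤- both)) (0≤- a-large)) (lemma (+ ∣ S ∣) (+ ∣ T ∣) a c (+ s))) ≤-refl)
          where
          u≢v : u ≢ v
          u≢v refl = u∉T v∈T
          meet : card (λ z → (z ∈? S) ×-dec (z ∈? T)) ≤ c
          meet = ≤-trans (card-mono (λ z → (z ∈? S) ×-dec (z ∈? T)) (λ z → Adj? u z ×-dec Adj? v z) λ (zS , zT) → uAdj zS zT , vAdj zS zT)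
                         (≤-reflexive (nonadj-count u≢v ¬uv (uAdj xS xT) (vAdj xS xT)))
            where
            uAdj : ∀ {z} → z ∈ S → z ∈ T → Adj u z
            uAdj zS zT = clique-adj L u∈S zS λ { refl → u∉T zT }
            vAdj : ∀ {z} → z ∈ S → z ∈ T → Adj v z
            vAdj zS zT = clique-adj M v∈T zT λ { refl → ¬uv (clique-adj L u∈S zS u≢v) }
          xy : Adj x y
          xy = clique-adj L xS yS x≢y
          join : card (λ z → (z ∈? S) ⊎-dec (z ∈? T)) ≤ a + + 2
          join = begin
            card (λ z → (z ∈? S) ⊎-dec (z ∈? T))
              ≤⟨ card-∪-≤ (λ z → (z ∈? S) ⊎-dec (z ∈? T)) (λ z → Adj? x z ×-dec Adj? y z) (λ z → (x ≟ z) ⊎-dec (y ≟ z)) cover ⟩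
            card (λ z → Adj? x z ×-dec Adj? y z) + card (λ z → (x ≟ z) ⊎-dec (y ≟ z))
              ≤⟨ +-mono-≤ (≤-reflexive (adj-count xy)) (card-∪-≤ (λ z → (x ≟ z) ⊎-dec (y ≟ z)) (x ≟_) (y ≟_) λ z → z) ⟩
            a + (card (x ≟_) + card (y ≟_))
              ≡⟨ cong (ℤ._+_ a) (cong₂ _+_ (card-≡ x) (card-≡ y)) ⟩
            a + + 2 ∎
            where
            open ≤-Reasoning
            cover : ∀ {z} → z ∈ S ⊎ z ∈ T → (Adj x z × Adj y z) ⊎ (x ≡ z ⊎ y ≡ z)
            cover {z} z∈ with x ≟ z | y ≟ z
            ... | yes x≡z | _ = inj₂ (inj₁ x≡z)
            ... | no _ | yes y≡z = inj₂ (inj₂ y≡z)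
            cover (inj₁ zS) | no x≢z | no y≢z = inj₁ (clique-adj L xS zS x≢z , clique-adj L yS zS y≢z)
            cover (inj₂ zT) | no x≢z | no y≢z = inj₁ (clique-adj M xT zT x≢z , clique-adj M yT zT y≢z)
          both : + ∣ S ∣ + + ∣ T ∣ ≤ a + + 2 + c
          both = begin
            + ∣ S ∣ + + ∣ T ∣ ≡⟨ cong₂ _+_ (+∣∣≡card S) (+∣∣≡card T) ⟩
            card (_∈? S) + card (_∈? T) ≡⟨ card-∪-∩ (_∈? S) (_∈? T) ⟩
            card (λ z → (z ∈? S) ⊎-dec (z ∈? T)) + card (λ z → (z ∈? S) ×-dec (z ∈? T)) ≤⟨ +-mono-≤ join meet ⟩
            a + + 2 + c ∎
            where open ≤-Reasoning
          lemma : ∀ p q a c s → 0ℤ ≡ 1ℤ + (p - (a + + 2 - (c - 1ℤ) * (s - 1ℤ)) + (q - (a + + 2 - (c - 1ℤ) * (s - 1ℤ)))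
                    + (a + + 2 + c - (p + q)) + (a - (+ 2 * s - 1ℤ) * (c - 1ℤ)))
          lemma = solve-∀

      line-≡ : ∀ {S T x y} → Line S → Line T → x ≢ y → x ∈ S → y ∈ S → x ∈ T → y ∈ T → S ≡ T
      line-≡ L M x≢y xS yS xT yT = ⊆-antisym (line-⊆ L M x≢y xS yS xT yT) (line-⊆ M L x≢y xT yT xS yS)

      NonAdjacent : Fin n → Fin n → Set
      NonAdjacent y z = y ≢ z × ¬ Adj y z

      Claw : Fin n → List (Fin n) → Set
      Claw x K = All (Adj x) K × AllPairs NonAdjacent K

      -- An intermediate stage of the exchange argument: some leaves of a claw have already been
      -- traded for lines through its centre. The field `avoids` is what allows these lines to be
      -- turned back into leaves by `extend-by-lines`.
      record Pencil (x : Fin n) (K : List (Fin n)) (Ls : List (Subset n)) : Set where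
        constructor pencil
        field
          claw     : Claw x K
          through  : All (λ L → Line L × x ∈ L) Ls
          distinct : AllPairs _≢_ Ls
          avoids   : All (λ L → All (_∉ L) K) Ls

      -- Each leaf is adjacent to x and hence to at most c - 1 further points of L. At least |L| - 1
      -- - s (c - 1) ≥ a + 1 - (2s - 1)(c - 1) ≥ 1 points remain, which explains the factor 2s - 1
      -- in `a-large`.
      nonneighbour-on-line : ∀ {x L} K → Claw x K → Line L → x ∈ L → All (_∉ L) K → length K ℕ.≤ s →
        ∃ λ w → w ∈ L × x ≢ w × All (λ y → ¬ Adj y w) K
      nonneighbour-on-line {x} {L} K (x~K , _) line x∈L K∉L K≤s =
        let w , (w∈L , x≢w) , K≁w = card>0⇒∃ (λ w → on w ×-dec All.all? (λ y → ¬? (Adj? y w)) K) (suc[i]≤j⇒i<j positive-count)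
        in w , w∈L , x≢w , K≁w
        where
        on : Decidable λ w → w ∈ L × x ≢ w
        on w = (w ∈? L) ×-dec ¬? (x ≟ w)
        on-count : + ∣ L ∣ ≤ card on + 1ℤ
        on-count = begin
          + ∣ L ∣ ≡⟨ +∣∣≡card L ⟩
          card (_∈? L) ≤⟨ card-∪-≤ (_∈? L) on (x ≟_) (λ {w} w∈L → case w∈L (x ≟ w)) ⟩
          card on + card (x ≟_) ≡⟨ cong (ℤ._+_ (card on)) (card-≡ x) ⟩
          card on + 1ℤ ∎
          where
          open ≤-Reasoning
          case : ∀ {w} → w ∈ L → Dec (x ≡ w) → (w ∈ L × x ≢ w) ⊎ x ≡ w
          case w∈L (yes x≡w) = inj₂ x≡w
          case w∈L (no x≢w) = inj₁ (w∈L , x≢w)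
        each : All (λ y → card (λ w → on w ×-dec Adj? y w) ≤ c - 1ℤ) K
        each = All.zipWith (λ (x~y , y∉L) → neighbours-on-line-except line y∉L x∈L (Adj-sym x~y)) (x~K , K∉L)
        positive-count : 1ℤ ≤ card (λ w → on w ×-dec All.all? (λ y → ¬? (Adj? y w)) K)
        positive-count = ≤-trans
          (≤-by _ (0≤+ (0≤+ (0≤+ (0≤- (proj₂ line)) (0≤- on-count)) (0≤- a-large))
                       (0≤* (0≤- 1≤c) (0≤- (+≤+ K≤s)))) (lemma (card on) (+ length K) (+ ∣ L ∣) a c (+ s)))
          (sieve on Adj? K each)
          where
          lemma : ∀ p k l a c s → p - k * (c - 1ℤ) ≡ 1ℤ + (l - (a + + 2 - (c - 1ℤ) * (s - 1ℤ)) + (p + 1ℤ - l)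
                    + (a - (+ 2 * s - 1ℤ) * (c - 1ℤ)) + (c - 1ℤ) * (s - k))
          lemma = solve-∀

      -- Greedy choice of one leaf per line. A chosen point lies on no later line, since distinct
      -- lines through x meet only there. The total may reach s + 1 because only the claw before
      -- each choice needs at most s leaves.
      extend-by-lines : ∀ {x} K Ls → Pencil x K Ls → length K ℕ.+ length Ls ℕ.≤ suc s →
        ∃ λ Z → Claw x (K ++ Z) × length Z ≡ length Ls
      extend-by-lines {x} K [] (pencil claw _ _ _) _ = [] , subst (Claw x) (sym (++-identityʳ K)) claw , refl
      extend-by-lines {x} K (L ∷ Ls) (pencil claw ((line , x∈L) ∷ through) (L≢ ∷ distinct) (K∉L ∷ avoids)) size =
        let Z , claw″ , Z≡Ls = extend-by-lines (K ++ w ∷ []) Ls (pencil claw′ through distinct avoids′)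
                                 (subst (ℕ._≤ suc s) (sym size-≡) size)
        in w ∷ Z , subst (Claw x) (++-assoc K (w ∷ []) Z) claw″ , cong suc Z≡Ls
        where
        found : ∃ λ w → w ∈ L × x ≢ w × All (λ y → ¬ Adj y w) K
        found = nonneighbour-on-line K claw line x∈L K∉L
          (ℕ.≤-trans (ℕ.m≤m+n _ (length Ls)) (ℕ.s≤s⁻¹ (subst (ℕ._≤ suc s) (ℕ.+-suc (length K) (length Ls)) size)))
        w = proj₁ found
        w∈L = proj₁ (proj₂ found)
        x≢w = proj₁ (proj₂ (proj₂ found))
        K≁w = proj₂ (proj₂ (proj₂ found))
        claw′ : Claw x (K ++ w ∷ [])
        claw′ = All.++⁺ (proj₁ claw) (clique-adj line x∈L w∈L x≢w ∷ [])
              , AllPairs.++⁺ (proj₂ claw) ([] ∷ [])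
                  (All.zipWith (λ (y∉L , y≁w) → ((λ { refl → y∉L w∈L }) , y≁w) ∷ []) (K∉L , K≁w))
        avoids′ : All (λ M → All (_∉ M) (K ++ w ∷ [])) Ls
        avoids′ = All.zipWith (λ ((K∉M , (line′ , x∈M)) , L≢M) → All.++⁺ K∉M ((λ w∈M → L≢M (line-≡ line line′ x≢w x∈L w∈L x∈M w∈M)) ∷ []))
                    (All.zip (avoids , through) , L≢)
        size-≡ : length (K ++ w ∷ []) ℕ.+ length Ls ≡ length K ℕ.+ suc (length Ls)
        size-≡ = trans (cong (ℕ._+ length Ls) (length-++ K)) (ℕ.+-assoc (length K) 1 (length Ls))

      module Degree (κ : ℤ)
        (degree : ∀ x → card (Adj? x) ≡ κ)
        (κ-small : + 2 * κ + 1ℤ ≤ (+ s + 1ℤ) * (+ 2 * (a + 1ℤ) - + s * (c - 1ℤ)))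
        where

        module _ (x : Fin n) where

          meets? : ∀ y w → Dec (y ≡ w ⊎ Adj y w)
          meets? y w = (y ≟ w) ⊎-dec Adj? y w

          ball? : ∀ y w → Dec (Adj x w × (y ≡ w ⊎ Adj y w))
          ball? y w = Adj? x w ×-dec meets? y w

          covered? : ∀ K w → Dec (Adj x w × Any (λ y → y ≡ w ⊎ Adj y w) K)
          covered? K w = Adj? x w ×-dec Any.any? (λ y → meets? y w) K

          ball-count : ∀ {v} → Adj x v → a + 1ℤ ≤ card (ball? v)
          ball-count {v} xv = begin
            a + 1ℤ ≡⟨ cong₂ _+_ (adj-count xv) (card-≡ v) ⟨
            card (λ z → Adj? x z ×-dec Adj? v z) + card (v ≟_)
              ≤⟨ card-⊎-≤ (ball? v) (λ z → Adj? x z ×-dec Adj? v z) (v ≟_)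
                   (λ (xz , vz) → xz , inj₂ vz) (λ { refl → xv , inj₁ refl }) (λ { (_ , vv) refl → Adj-irrefl vv }) ⟩
            card (ball? v) ∎
            where open ≤-Reasoning

          -- The overlap consists of common neighbours of v and y; x is another one, and it is not
          -- adjacent to itself.
          ball-overlap : ∀ {v y} → Adj x v → Adj x y → NonAdjacent v y → card (λ w → ball? v w ×-dec meets? y w) ≤ c - 1ℤ
          ball-overlap {v} {y} xv xy (v≢y , ¬vy) =
            nonadj-count-except (λ w → ball? v w ×-dec meets? y w) v≢y ¬vy (Adj-sym xv) (Adj-sym xy)
            λ { ((_ , inj₁ refl) , inj₁ refl) → ⊥-elim (v≢y refl)
              ; ((_ , inj₁ refl) , inj₂ yv) → ⊥-elim (¬vy (Adj-sym yv))
              ; ((_ , inj₂ vy) , inj₁ refl) → ⊥-elim (¬vy vy)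
              ; ((xz , inj₂ vz) , inj₂ yz) → vz , yz , λ { refl → Adj-irrefl xz } }

          -- Bonferroni's inequality, doubled to avoid a binomial coefficient: k leaves cover at
          -- least k (a + 1) - k (k - 1)(c - 1) / 2 neighbours of x. The hypothesis `κ-small` says
          -- that for k = s + 1 this exceeds κ.
          covered-count : ∀ K → Claw x K →
            + length K * (+ 2 * (a + 1ℤ) - (+ length K - 1ℤ) * (c - 1ℤ)) ≤ + 2 * card (covered? K)
          covered-count [] _ = 0≤* {+ 2} (+≤+ z≤n) (0≤card (covered? []))
          covered-count (v ∷ K) (xv ∷ xK , vK ∷ claw) =
            ≤-by _ (0≤+ (0≤- (covered-count K (xK , claw)))
                        (0≤* {+ 2} (+≤+ z≤n) (0≤+ (0≤+ (0≤- new) (0≤- union)) (0≤- (ball-count xv)))))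
              (lemma (+ length K) a c (card (covered? K)) (card fresh?) (card (covered? (v ∷ K))) (card (ball? v)))
            where
            fresh? : Decidable λ w → (Adj x w × (v ≡ w ⊎ Adj v w)) × All (λ y → ¬ (y ≡ w ⊎ Adj y w)) K
            fresh? w = ball? v w ×-dec All.all? (λ y → ¬? (meets? y w)) K
            new : card (ball? v) - + length K * (c - 1ℤ) ≤ card fresh?
            new = sieve (ball? v) meets? K (All.zipWith (λ (xy , vy) → ball-overlap xv xy vy) (xK , vK))
            union : card (covered? K) + card fresh? ≤ card (covered? (v ∷ K))
            union = card-⊎-≤ (covered? (v ∷ K)) (covered? K) fresh?
              (λ (xw , K∋w) → xw , there K∋w) (λ ((xw , vw) , _) → xw , here vw)
              (λ (_ , K∋w) (_ , K∌w) → All.All¬⇒¬Any K∌w K∋w)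
            lemma : ∀ k a c p f q b → + 2 * q ≡ (1ℤ + k) * (+ 2 * (a + 1ℤ) - (1ℤ + k - 1ℤ) * (c - 1ℤ))
              + (+ 2 * p - k * (+ 2 * (a + 1ℤ) - (k - 1ℤ) * (c - 1ℤ))
                 + + 2 * (f - (b - k * (c - 1ℤ)) + (q - (p + f)) + (b - (a + 1ℤ))))
            lemma = solve-∀

          claw-length-≢ : ∀ K → Claw x K → length K ≢ suc s
          claw-length-≢ K claw K≡s+1 = 1≤⇒≰0 (≤-refl {1ℤ}) (≤-by _
            (0≤+ (0≤+ (0≤- κ-small) (0≤- (subst (λ k → + k * (+ 2 * (a + 1ℤ) - (+ k - 1ℤ) * (c - 1ℤ)) ≤ + 2 * card (covered? K)) K≡s+1 (covered-count K claw))))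
                 (0≤* {+ 2} (+≤+ z≤n) (0≤- (≤-trans (card-mono (covered? K) (Adj? x) proj₁) (≤-reflexive (degree x))))))
            (lemma κ a c (+ s) (card (covered? K))))
            where
            lemma : ∀ κ a c s p → 0ℤ ≡ 1ℤ + ((s + 1ℤ) * (+ 2 * (a + 1ℤ) - s * (c - 1ℤ)) - (+ 2 * κ + 1ℤ)
              + (+ 2 * p - (1ℤ + s) * (+ 2 * (a + 1ℤ) - (1ℤ + s - 1ℤ) * (c - 1ℤ))) + + 2 * (κ - p))
            lemma = solve-∀

          -- From the empty claw, s + 1 lines would produce a claw with s + 1 leaves.
          lines-through-≤ : ∀ Ls → All (λ L → Line L × x ∈ L) Ls → AllPairs _≢_ Ls → length Ls ℕ.≤ s
          lines-through-≤ Ls through distinct = ℕ.≮⇒≥ λ s<Ls →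
            let taken≡ = trans (length-take (suc s) Ls) (ℕ.m≤n⇒m⊓n≡m s<Ls)
                Z , claw , Z≡ = extend-by-lines [] (take (suc s) Ls)
                  (pencil ([] , []) (All.take⁺ (suc s) through) (AllPairs.take⁺ (suc s) distinct) (All.universal (λ _ → []) _))
                  (ℕ.≤-reflexive taken≡)
            in claw-length-≢ Z claw (trans Z≡ taken≡)

        -- Starting from a claw, its members v are replaced one by one by lines through x and v; this
        -- only fails if some v can be replaced by two vertices, and then the claw has grown. Once only
        -- lines are left, y together with points of these lines is a larger claw.
        module _ {x y : Fin n} (xy : Adj x y) (no-line : ∀ {L} → Line L → x ∈ L → y ∉ L) where

          grow : ∀ K Ls → Pencil x K Ls → length K ℕ.+ length Ls ℕ.≤ s →
            ∃ λ K′ → Claw x K′ × length K′ ≡ suc (length K ℕ.+ length Ls)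
          grow [] Ls (pencil _ through distinct _) size =
            let Z , claw , Z≡ = extend-by-lines (y ∷ []) Ls
                  (pencil (xy ∷ [] , [] ∷ []) through distinct (All.map (λ (line , x∈L) → no-line line x∈L ∷ []) through))
                  (s≤s size)
            in y ∷ Z , claw , cong suc Z≡
          grow (v ∷ K) Ls (pencil claw@(xv ∷ xK , vK ∷ K-claw) through distinct avoids) size = replace (IsClique? Γ C)
            where
            -- The lines are turned into leaves for the moment, so that J stands for all leaves
            -- other than v.
            extended = extend-by-lines (v ∷ K) Ls (pencil claw through distinct avoids) (ℕ.m≤n⇒m≤1+n size)
            Z = proj₁ extended
            J = K ++ Z
            J-adj : All (Adj x) J
            J-adj = All.tail (proj₁ (proj₁ (proj₂ extended)))
            J-claw : AllPairs NonAdjacent J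
            J-claw = AllPairs.tail (proj₂ (proj₁ (proj₂ extended)))
            vJ : All (NonAdjacent v) J
            vJ = AllPairs.head (proj₂ (proj₁ (proj₂ extended)))
            J-length : length J ≡ length K ℕ.+ length Ls
            J-length = trans (length-++ K) (cong (length K ℕ.+_) (proj₂ (proj₂ extended)))
            common? : Decidable λ w → Adj x w × Adj v w
            common? w = Adj? x w ×-dec Adj? v w
            free? : Decidable λ w → (Adj x w × Adj v w) × All (λ j → ¬ Adj j w) J
            free? w = common? w ×-dec All.all? (λ j → ¬? (Adj? j w)) J
            -- The candidates for replacing v: the vertices that see x and v but no other leaf,
            -- together with x and v. If they form a clique, it is large enough for any maximal
            -- clique around it to be a line, as J has fewer than s members; if not, a nonadjacent
            -- pair in it takes the place of v.
            C? : Decidable λ w → ((Adj x w × Adj v w) × All (λ j → ¬ Adj j w) J) ⊎ (x ≡ w ⊎ v ≡ w)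
            C? w = free? w ⊎-dec ((x ≟ w) ⊎-dec (v ≟ w))
            C = toSubset C?
            C-size : a + + 2 - + length J * (c - 1ℤ) ≤ card C?
            C-size = ≤-by _ (0≤+ (0≤- (subst (λ p → p - + length J * (c - 1ℤ) ≤ card free?) (adj-count xv) (sieve common? Adj? J each)))
                                 (0≤- split)) (lemma a c (+ length J) (card free?) (card C?))
              where
              each : All (λ j → card (λ w → common? w ×-dec Adj? j w) ≤ c - 1ℤ) J
              each = All.zipWith (λ (xj , v≢j , ¬vj) → nonadj-count-except (λ w → common? w ×-dec Adj? _ w)
                       v≢j ¬vj (Adj-sym xv) (Adj-sym xj) λ ((xz , vz) , jz) → vz , jz , λ { refl → Adj-irrefl xz }) (J-adj , vJ)
              split : card free? + (1ℤ + 1ℤ) ≤ card C?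
              split = begin
                card free? + (1ℤ + 1ℤ) ≡⟨ cong (ℤ._+_ (card free?)) (cong₂ _+_ (card-≡ x) (card-≡ v)) ⟨
                card free? + (card (x ≟_) + card (v ≟_))
                  ≤⟨ +-monoʳ-≤ (card free?) (card-⊎-≤ (λ w → (x ≟ w) ⊎-dec (v ≟ w)) (x ≟_) (v ≟_) inj₁ inj₂ λ { refl refl → Adj-irrefl xv }) ⟩
                card free? + card (λ w → (x ≟ w) ⊎-dec (v ≟ w))
                  ≤⟨ card-⊎-≤ C? free? (λ w → (x ≟ w) ⊎-dec (v ≟ w)) inj₁ inj₂
                       (λ { ((xx , _) , _) (inj₁ refl) → Adj-irrefl xx ; ((_ , vv) , _) (inj₂ refl) → Adj-irrefl vv }) ⟩
                card C? ∎
                where open ≤-Reasoning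
              lemma : ∀ a c j f q → q ≡ a + + 2 - j * (c - 1ℤ) + (f - (a - j * (c - 1ℤ)) + (q - (f + (1ℤ + 1ℤ))))
              lemma = solve-∀

            replace : Dec (IsClique Γ C) → ∃ λ K′ → Claw x K′ × length K′ ≡ suc (suc (length K ℕ.+ length Ls))
            replace (yes clique) =
              -- Trading v for L preserves the total of leaves and lines while K becomes shorter.
              let K′ , claw′ , K′≡ = grow K (L ∷ Ls)
                    (pencil (xK , K-claw) ((line , x∈L) ∷ through)
                      (All.map (λ { (v∉M ∷ _) refl → v∉M v∈L }) avoids ∷ distinct)
                      (All.map (λ (v≢k , ¬vk) k∈L → ¬vk (clique-adj line v∈L k∈L v≢k)) vK ∷ All.map All.tail avoids))
                    (subst (ℕ._≤ s) (sym (ℕ.+-suc (length K) (length Ls))) size)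
              in K′ , claw′ , trans K′≡ (cong suc (ℕ.+-suc (length K) (length Ls)))
              where
              extension = extend-clique C clique
              L = proj₁ extension
              x∈L : x ∈ L
              x∈L = proj₂ (proj₂ extension) (∈-toSubset⁺ C? (inj₂ (inj₁ refl)))
              v∈L : v ∈ L
              v∈L = proj₂ (proj₂ extension) (∈-toSubset⁺ C? (inj₂ (inj₂ refl)))
              line : Line L
              line = proj₁ (proj₂ extension) , (begin
                a + + 2 - (c - 1ℤ) * (+ s - 1ℤ) ≤⟨ ≤-by _ (0≤* (0≤- 1≤c) (0≤- (+≤+ J<s))) (lemma a c (+ s) (+ length J)) ⟩
                a + + 2 - + length J * (c - 1ℤ) ≤⟨ C-size ⟩
                card C? ≤⟨ card-mono C? (_∈? L) (λ Cw → proj₂ (proj₂ extension) (∈-toSubset⁺ C? Cw)) ⟩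
                card (_∈? L) ≡⟨ +∣∣≡card L ⟨
                + ∣ L ∣ ∎)
                where
                open ≤-Reasoning
                J<s : suc (length J) ℕ.≤ s
                J<s = subst (λ j → suc j ℕ.≤ s) (sym J-length) size
                lemma : ∀ a c s j → a + + 2 - j * (c - 1ℤ) ≡ a + + 2 - (c - 1ℤ) * (s - 1ℤ) + (c - 1ℤ) * (s - (1ℤ + j))
                lemma = solve-∀
            replace (no ¬clique) with any? (λ w → any? (λ w′ → (C? w ×-dec C? w′) ×-dec (¬? (w ≟ w′) ×-dec ¬? (Adj? w w′))))
            ... | no none = ⊥-elim (¬clique λ w w∈ w′ w′∈ w≢w′ → decidable-stable (Adj? w w′) λ ¬ww′ →
                    none (w , w′ , (∈-toSubset⁻ C? w∈ , ∈-toSubset⁻ C? w′∈) , w≢w′ , ¬ww′))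
            ... | yes (w , w′ , (Cw , Cw′) , w≢w′ , ¬ww′) =
              w ∷ w′ ∷ J , (proj₁ (proj₁ free) ∷ proj₁ (proj₁ free′) ∷ J-adj
                           , ((w≢w′ , ¬ww′) ∷ apart free) ∷ apart free′ ∷ J-claw)
                         , cong (λ j → suc (suc j)) J-length
              where
              Free : Fin n → Set
              Free w = (Adj x w × Adj v w) × All (λ j → ¬ Adj j w) J
              -- Both x and v are adjacent to everything else in C, so neither occurs in a
              -- nonadjacent pair.
              proper : ∀ {w w′} → w ≢ w′ → ¬ Adj w w′ → Free w ⊎ (x ≡ w ⊎ v ≡ w) → Free w′ ⊎ (x ≡ w′ ⊎ v ≡ w′) → Free w
              proper _ _ (inj₁ f) _ = f
              proper _ ¬a (inj₂ (inj₁ refl)) (inj₁ ((xw′ , _) , _)) = ⊥-elim (¬a xw′)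
              proper w≢ _ (inj₂ (inj₁ refl)) (inj₂ (inj₁ refl)) = ⊥-elim (w≢ refl)
              proper _ ¬a (inj₂ (inj₁ refl)) (inj₂ (inj₂ refl)) = ⊥-elim (¬a xv)
              proper _ ¬a (inj₂ (inj₂ refl)) (inj₁ ((_ , vw′) , _)) = ⊥-elim (¬a vw′)
              proper _ ¬a (inj₂ (inj₂ refl)) (inj₂ (inj₁ refl)) = ⊥-elim (¬a (Adj-sym xv))
              proper w≢ _ (inj₂ (inj₂ refl)) (inj₂ (inj₂ refl)) = ⊥-elim (w≢ refl)
              free : Free w
              free = proper w≢w′ ¬ww′ Cw Cw′
              free′ : Free w′
              free′ = proper (≢-sym w≢w′) (¬ww′ ∘ Adj-sym) Cw′ Cw
              apart : ∀ {w} → Free w → All (NonAdjacent w) J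
              apart ((_ , vw) , ¬Jw) = All.zipWith (λ ((_ , ¬vj) , ¬jw) → (λ { refl → ¬vj vw }) , ¬jw ∘ Adj-sym) (vJ , ¬Jw)

          -- Repeated growth from the empty claw; the length s + 1 then contradicts `claw-length-≢`.
          claw-of-length : ∀ m → m ℕ.≤ suc s → ∃ λ K → Claw x K × length K ≡ m
          claw-of-length zero _ = [] , ([] , []) , refl
          claw-of-length (suc m) (s≤s m≤s) =
            let K , claw , K≡m = claw-of-length m (ℕ.m≤n⇒m≤1+n m≤s)
                K+0≡m = trans (ℕ.+-identityʳ (length K)) K≡m
                K′ , claw′ , K′≡ = grow K [] (pencil claw [] [] []) (subst (ℕ._≤ s) (sym K+0≡m) m≤s)
            in K′ , claw′ , trans K′≡ (cong suc K+0≡m)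

          absurd : ⊥
          absurd = let K , claw , K≡ = claw-of-length (suc s) ℕ.≤-refl in claw-length-≢ x K claw K≡

        Line? : Decidable Line
        Line? S = IsMaximalClique? Γ S ×-dec (_ ℤ.≤? _)

        line-through : ∀ {x y} → Adj x y → ∃ λ L → Line L × x ∈ L × y ∈ L
        line-through {x} {y} xy with anySubset? (λ L → Line? L ×-dec ((x ∈? L) ×-dec (y ∈? L)))
        ... | yes found = found
        ... | no none = ⊥-elim (absurd xy λ {L} line x∈L y∈L → none (L , line , x∈L , y∈L))

-- Distances and intersection numbers.

module Distance where

  open import Defs
  open Sums
  open import Data.Nat using (ℕ; zero; suc; pred)
  import Data.Nat as ℕ
  import Data.Nat.Properties as ℕ
  open import Data.Integer using (ℤ; +_; 0ℤ; 1ℤ; _+_; _-_; _*_; _≤_)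
  open import Data.Integer.Properties hiding (_≟_)
  open import Data.Integer.Tactic.RingSolver using (solve-∀)
  open import Data.Fin using (Fin; zero; suc)
  open import Data.Product using (_×_; _,_; ∃; proj₁; proj₂)
  open import Function using (_∘_)
  open import Level using (0ℓ)
  open import Relation.Nullary using (¬_; Dec; yes; no; _×-dec_)
  open import Relation.Unary using (Decidable; Pred)
  open import Relation.Binary.PropositionalEquality

  module _ {n : ℕ} (Γ : Graph n) where
    open Graph Γ

    walk-snoc : ∀ {i x y z} → Walk Γ i x y → Adj y z → Walk Γ (suc i) x z
    walk-snoc here a = step a here
    walk-snoc (step b w) a = step b (walk-snoc w a)

    walk-reverse : ∀ {i x y} → Walk Γ i x y → Walk Γ i y x
    walk-reverse here = here
    walk-reverse (step a w) = walk-snoc (walk-reverse w) (Adj-sym a)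

  module DistanceFunction {n : ℕ} (Γ : DistanceRegularGraph n) where
    open DistanceRegularGraph Γ

    d : Fin n → Fin n → ℕ
    d x y = proj₁ (connected x y)

    d≤diameter : ∀ x y → d x y ℕ.≤ diameter
    d≤diameter x y = proj₁ (proj₂ (connected x y))

    d-distance : ∀ x y → Distance graph (d x y) x y
    d-distance x y = proj₂ (proj₂ (connected x y))

    d-walk : ∀ x y → Walk graph (d x y) x y
    d-walk x y = proj₁ (d-distance x y)

    walk⇒d≤ : ∀ {i x y} → Walk graph i x y → d x y ℕ.≤ i
    walk⇒d≤ {i} {x} {y} w = ℕ.≮⇒≥ λ i<d → proj₂ (d-distance x y) i<d w

    distance⇒d≡ : ∀ {i x y} → Distance graph i x y → d x y ≡ i
    distance⇒d≡ {i} {x} {y} (w , shortest) = ℕ.≤-antisym (walk⇒d≤ w) (ℕ.≮⇒≥ λ d<i → shortest d<i (d-walk x y))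

    d≡⇒distance : ∀ {i x y} → d x y ≡ i → Distance graph i x y
    d≡⇒distance refl = d-distance _ _

    d-sym : ∀ x y → d x y ≡ d y x
    d-sym x y = ℕ.≤-antisym (walk⇒d≤ (walk-reverse graph (d-walk y x))) (walk⇒d≤ (walk-reverse graph (d-walk x y)))

    d-refl : ∀ x → d x x ≡ 0
    d-refl x = ℕ.n≤0⇒n≡0 (walk⇒d≤ here)

    d≡0⇒≡ : ∀ {x y} → d x y ≡ 0 → x ≡ y
    d≡0⇒≡ {x} {y} d≡0 with here ← subst (λ i → Walk graph i x y) d≡0 (d-walk x y) = refl

    d≡1⇒adj : ∀ {x y} → d x y ≡ 1 → Adj x y
    d≡1⇒adj {x} {y} d≡1 with step a here ← subst (λ i → Walk graph i x y) d≡1 (d-walk x y) = a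

    adj⇒d≡1 : ∀ {x y} → Adj x y → d x y ≡ 1
    adj⇒d≡1 {x} {y} a = ℕ.≤-antisym (walk⇒d≤ (step a here)) (ℕ.n≢0⇒n>0 λ d≡0 → Adj-irrefl (subst (Adj x) (sym (d≡0⇒≡ d≡0)) a))

    d-triangle : ∀ x {y z} → Adj y z → d x z ℕ.≤ suc (d x y)
    d-triangle x a = walk⇒d≤ (walk-snoc graph (d-walk x _) a)

    d≡2 : ∀ {x y z} → x ≢ y → ¬ Adj x y → Adj x z → Adj y z → d x y ≡ 2
    d≡2 {x} {y} x≢y ¬xy xz yz = ℕ.≤-antisym (walk⇒d≤ (step xz (step (Adj-sym yz) here)))
      (ℕ.≤∧≢⇒< (ℕ.n≢0⇒n>0 (x≢y ∘ d≡0⇒≡)) (¬xy ∘ d≡1⇒adj ∘ sym))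

    predecessor : ∀ {x z i} → d x z ≡ suc i → ∃ λ y → Adj z y × d x y ≡ i
    predecessor {x} {z} {i} d≡ with step {y = y} a w ← subst (λ j → Walk graph j z x) (trans (d-sym z x) d≡) (d-walk z x) =
      y , a , ℕ.≤-antisym (walk⇒d≤ (walk-reverse graph w))
                          (ℕ.s≤s⁻¹ (subst (ℕ._≤ suc (d x y)) d≡ (d-triangle x (Adj-sym a))))

    closer? : ∀ x z → Decidable λ y → Adj z y × suc (d x y) ≡ d x z
    closer? x z y = Adj? z y ×-dec (suc (d x y) ℕ.≟ d x z)

    farther? : ∀ x z → Decidable λ y → Adj z y × d x y ≡ suc (d x z)
    farther? x z y = Adj? z y ×-dec (d x y ℕ.≟ suc (d x z))

    -- Unlike intc, this has a prescribed value at 0.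
    c : ℕ → ℕ
    c zero = 0
    c (suc i) = intc (suc i)

    closer-count : ∀ x z → card (closer? x z) ≡ + c (d x z)
    closer-count x z with d x z in d≡
    ... | zero = card-zero (λ y → Adj? z y ×-dec (suc (d x y) ℕ.≟ 0)) λ { _ (_ , ()) }
    ... | suc i = begin
      card (λ y → Adj? z y ×-dec (suc (d x y) ℕ.≟ suc i))
        ≡⟨ card-cong (λ y → Adj? z y ×-dec (suc (d x y) ℕ.≟ suc i)) (λ y → Adj? z y ×-dec Distance? graph i x y)
             (λ (a , e) → a , d≡⇒distance (ℕ.suc-injective e)) (λ (a , e) → a , cong suc (distance⇒d≡ e)) ⟩
      card (λ y → Adj? z y ×-dec Distance? graph i x y) ≡⟨ +#≡card (λ y → Adj? z y ×-dec Distance? graph i x y) ⟨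
      + #[ (λ y → Adj? z y ×-dec Distance? graph i x y) ] ≡⟨ cong +_ (intc-count i x z (d≡⇒distance d≡)) ⟩
      + intc (suc i) ∎
      where open ≡-Reasoning

    farther-count : ∀ x z → card (farther? x z) ≡ + intb (d x z)
    farther-count x z = begin
      card (farther? x z)
        ≡⟨ card-cong (farther? x z) (λ y → Adj? z y ×-dec Distance? graph (suc (d x z)) x y)
             (λ (a , e) → a , d≡⇒distance e) (λ (a , e) → a , distance⇒d≡ e) ⟩
      card (λ y → Adj? z y ×-dec Distance? graph (suc (d x z)) x y)
        ≡⟨ +#≡card (λ y → Adj? z y ×-dec Distance? graph (suc (d x z)) x y) ⟨
      + #[ (λ y → Adj? z y ×-dec Distance? graph (suc (d x z)) x y) ]
        ≡⟨ cong +_ (intb-count (d x z) x z (d-distance x z)) ⟩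
      + intb (d x z) ∎
      where open ≡-Reasoning

    degree : ∀ x → card (Adj? x) ≡ + valency
    degree x = begin
      card (Adj? x) ≡⟨ card-cong (Adj? x) (farther? x x)
        (λ a → a , trans (adj⇒d≡1 a) (cong suc (sym (d-refl x)))) proj₁ ⟩
      card (farther? x x) ≡⟨ farther-count x x ⟩
      + intb (d x x) ≡⟨ cong (λ i → + intb i) (d-refl x) ⟩
      + valency ∎
      where open ≡-Reasoning

    -- The distances from x to z and to a neighbour of z differ by at most one. Writing the sum
    -- through differences from `g (d x z)` involves only the valency and the numbers b and c; at
    -- distance 0 the term with `pred` vanishes because `c` is 0 there.
    neighbour-sum : ∀ (g : ℕ → ℤ) x z → sum (λ y → 𝟙 (Adj? z y) * g (d x y)) ≡
      + valency * g (d x z) + + c (d x z) * (g (pred (d x z)) - g (d x z)) + + intb (d x z) * (g (suc (d x z)) - g (d x z))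
    neighbour-sum g x z = begin
      sum (λ y → 𝟙 (Adj? z y) * g (d x y))
        ≡⟨ sum-cong-≗ pointwise ⟩
      sum (λ y → 𝟙 (Adj? z y) * gj + 𝟙 (closer? x z y) * (g (pred j) - gj) + 𝟙 (farther? x z y) * (g (suc j) - gj))
        ≡⟨ sum-+₃ (λ y → 𝟙 (Adj? z y) * gj) (λ y → 𝟙 (closer? x z y) * (g (pred j) - gj)) (λ y → 𝟙 (farther? x z y) * (g (suc j) - gj)) ⟩
      sum (λ y → 𝟙 (Adj? z y) * gj) + sum (λ y → 𝟙 (closer? x z y) * (g (pred j) - gj)) + sum (λ y → 𝟙 (farther? x z y) * (g (suc j) - gj))
        ≡⟨ cong₂ _+_ (cong₂ _+_ (count (Adj? z) gj (degree z)) (count (closer? x z) (g (pred j) - gj) (closer-count x z)))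
                     (count (farther? x z) (g (suc j) - gj) (farther-count x z)) ⟩
      + valency * gj + + c j * (g (pred j) - gj) + + intb j * (g (suc j) - gj) ∎
      where
      open ≡-Reasoning
      j = d x z
      gj = g j
      count : ∀ {P : Pred (Fin n) 0ℓ} (P? : Decidable P) v {m} → card P? ≡ m → sum (λ y → 𝟙 (P? y) * v) ≡ m * v
      count P? v refl = sym (*-distribʳ-sum v (λ y → 𝟙 (P? y)))
      step-value : ∀ i k (p : Dec (suc i ≡ k)) (q : Dec (i ≡ suc k)) → k ℕ.≤ suc i → i ℕ.≤ suc k →
        1ℤ * g i ≡ 1ℤ * g k + 𝟙 p * (g (pred k) - g k) + 𝟙 q * (g (suc k) - g k)
      step-value i k (yes refl) (yes ()) _ _
      step-value i k (yes refl) (no _) _ _ = lemma (g i) (g (suc i)) (g (suc (suc i)) - g (suc i))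
        where
        lemma : ∀ u v w → 1ℤ * u ≡ 1ℤ * v + 1ℤ * (u - v) + 0ℤ * w
        lemma = solve-∀
      step-value i k (no _) (yes refl) _ _ = lemma (g (suc k)) (g k) (g (pred k) - g k)
        where
        lemma : ∀ u v w → 1ℤ * u ≡ 1ℤ * v + 0ℤ * w + 1ℤ * (u - v)
        lemma = solve-∀
      step-value i k (no p) (no q) k≤1+i i≤1+k
        with refl ← ℕ.≤-antisym (ℕ.s≤s⁻¹ (ℕ.≤∧≢⇒< i≤1+k q)) (ℕ.s≤s⁻¹ (ℕ.≤∧≢⇒< k≤1+i (p ∘ sym))) = lemma (g i) (g (pred i) - g i) (g (suc i) - g i)
        where
        lemma : ∀ u v w → 1ℤ * u ≡ 1ℤ * u + 0ℤ * v + 0ℤ * w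
        lemma = solve-∀
      pointwise : ∀ y → 𝟙 (Adj? z y) * g (d x y) ≡
        𝟙 (Adj? z y) * gj + 𝟙 (closer? x z y) * (g (pred j) - gj) + 𝟙 (farther? x z y) * (g (suc j) - gj)
      pointwise y with Adj? z y
      ... | no _ = refl
      ... | yes a = step-value (d x y) j (suc (d x y) ℕ.≟ j) (d x y ℕ.≟ suc j) (d-triangle x (Adj-sym a)) (d-triangle x a)

    at-distance : ∀ {i} → i ℕ.≤ diameter → ∃ λ z → d (proj₁ diameter-attained) z ≡ i
    at-distance {i} i≤D = go (diameter ℕ.∸ i) i (ℕ.m+[n∸m]≡n i≤D)
      where
      go : ∀ m j → j ℕ.+ m ≡ diameter → ∃ λ z → d (proj₁ diameter-attained) z ≡ j
      go zero j j≡D = proj₁ (proj₂ diameter-attained) ,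
        trans (distance⇒d≡ (proj₂ (proj₂ diameter-attained))) (trans (sym j≡D) (ℕ.+-identityʳ j))
      go (suc m) j j≡D with go m (suc j) (trans (sym (ℕ.+-suc j m)) j≡D)
      ... | z , d≡ with predecessor d≡
      ...   | y , _ , d≡j = y , d≡j

    0<intc : ∀ {i} → i ℕ.< diameter → 1 ℕ.≤ intc (suc i)
    0<intc {i} i<D =
      let z , d≡ = at-distance i<D
          y , a , d≡i = predecessor d≡
      in drop‿+≤+ (subst (1ℤ ≤_) (trans (closer-count x z) (cong (λ i → + c i) d≡))
           (1≤card (closer? x z) (a , trans (cong suc d≡i) (sym d≡))))
      where x = proj₁ diameter-attained

    0<intb : ∀ {i} → i ℕ.< diameter → 1 ℕ.≤ intb i
    0<intb {i} i<D =
      let z , d≡ = at-distance i<D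
          y , a , d≡i = predecessor d≡
      in drop‿+≤+ (subst (1ℤ ≤_) (trans (farther-count x y) (cong (λ i → + intb i) d≡i))
           (1≤card (farther? x y) (Adj-sym a , trans d≡ (cong suc (sym d≡i)))))
      where x = proj₁ diameter-attained

    common? : ∀ x y → Decidable λ z → Adj x z × Adj y z
    common? x y z = Adj? x z ×-dec Adj? y z

    nonadj-count : ∀ {x y z} → x ≢ y → ¬ Adj x y → Adj x z → Adj y z → card (common? x y) ≡ + intc 2
    nonadj-count {x} {y} x≢y ¬xy xz yz = trans
      (card-cong (common? x y) (closer? x y) (λ (xw , yw) → yw , trans (cong suc (adj⇒d≡1 xw)) (sym xy≡2))
         (λ (yw , e) → d≡1⇒adj (ℕ.suc-injective (trans e xy≡2)) , yw))
      (trans (closer-count x y) (cong (λ i → + c i) xy≡2))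
      where
      xy≡2 : d x y ≡ 2
      xy≡2 = d≡2 x≢y ¬xy xz yz

    -- Apply `neighbour-sum` to the indicator of distance 1: from the valency it subtracts the
    -- neighbours of y that are closer to x or farther from it.
    adj-count : ∀ {x y} → Adj x y → card (common? x y) ≡ inta 1
    adj-count {x} {y} xy = begin
      card (common? x y)
        ≡⟨ sum-cong-≗ (λ z → trans (𝟙-cong (common? x y z) (Adj? y z ×-dec (d x z ℕ.≟ 1))
                                      (λ (xz , yz) → yz , adj⇒d≡1 xz) (λ (yz , e) → d≡1⇒adj e , yz))
                                    (𝟙-× (Adj? y z) (d x z ℕ.≟ 1))) ⟩
      sum (λ z → 𝟙 (Adj? y z) * 𝟙 (d x z ℕ.≟ 1))
        ≡⟨ neighbour-sum (λ i → 𝟙 (i ℕ.≟ 1)) x y ⟩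
      + valency * 𝟙 (d x y ℕ.≟ 1) + + c (d x y) * (𝟙 (pred (d x y) ℕ.≟ 1) - 𝟙 (d x y ℕ.≟ 1))
        + + intb (d x y) * (𝟙 (suc (d x y) ℕ.≟ 1) - 𝟙 (d x y ℕ.≟ 1))
        ≡⟨ cong (λ i → + valency * 𝟙 (i ℕ.≟ 1) + + c i * (𝟙 (pred i ℕ.≟ 1) - 𝟙 (i ℕ.≟ 1))
                  + + intb i * (𝟙 (suc i ℕ.≟ 1) - 𝟙 (i ℕ.≟ 1))) (adj⇒d≡1 xy) ⟩
      + valency * 1ℤ + + intc 1 * (0ℤ - 1ℤ) + + intb 1 * (0ℤ - 1ℤ)
        ≡⟨ lemma (+ valency) (+ intc 1) (+ intb 1) ⟩
      + valency - + intb 1 - + intc 1 ∎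
      where
      open ≡-Reasoning
      lemma : ∀ k c b → k * 1ℤ + c * (0ℤ - 1ℤ) + b * (0ℤ - 1ℤ) ≡ k - b - c
      lemma = solve-∀

    intb-diameter : intb diameter ≡ 0
    intb-diameter with diameter-attained
    ... | x , z , distance = +-injective (trans (cong (λ i → + intb i) (sym d≡))
            (trans (sym (farther-count x z)) (card-zero (farther? x z) λ y (_ , e) →
              ℕ.<⇒≱ (ℕ.≤-reflexive (trans (cong suc (sym d≡)) (sym e))) (d≤diameter x y))))
      where
      d≡ : d x z ≡ diameter
      d≡ = distance⇒d≡ distance

-- The eigenvalue -r: standard sequence, projection onto the eigenspace, Delsarte cliques.

module Spectral where

  open import Defs
  open Sums
  open Distance
  open import Data.Nat using (ℕ; zero; suc; z≤n; s≤s; pred)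
  import Data.Nat as ℕ
  import Data.Nat.Properties as ℕ
  open import Data.Integer using (ℤ; +_; 0ℤ; 1ℤ; _+_; _-_; _*_; -_; _≤_; _<_; +<+)
  open import Data.Integer.Properties hiding (_≟_)
  open import Data.Integer.Tactic.RingSolver using (solve-∀)
  open import Data.Fin using (Fin; zero; suc; toℕ; fromℕ<)
  open import Data.Fin.Properties using (_≟_; toℕ-fromℕ<; toℕ-injective; toℕ<n)
  open import Data.Fin.Subset using (Subset; _∈_; _∉_)
  open import Data.Fin.Subset.Properties using (_∈?_)
  open import Data.Empty using (⊥-elim)
  open import Data.Product using (_×_)
  open import Data.Sum using (inj₁; inj₂)
  open import Function using (_∘_)
  open import Relation.Nullary using (Dec; yes; no; _×-dec_)
  open import Relation.Binary.PropositionalEquality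
  open import Relation.Binary.Definitions using (tri<; tri≈; tri>)

  -- Comparison with the geometric series of ratio 1/2.
  halving-sum : ∀ m (T : ℕ → ℤ) → (∀ i → i ℕ.≤ m → 0ℤ ≤ T i) → (∀ i → i ℕ.< m → + 2 * T (suc i) ≤ T i) →
    sum {suc m} (T ∘ toℕ) ≤ + 2 * T 0
  halving-sum zero T 0≤T _ = ≤-by _ (0≤T 0 z≤n) (lemma (T 0))
    where
    lemma : ∀ a → + 2 * a ≡ a + 0ℤ + a
    lemma = solve-∀
  halving-sum (suc m) T 0≤T halve = ≤-trans
    (+-monoʳ-≤ (T 0) (≤-trans (halving-sum m (T ∘ suc) (λ i i≤m → 0≤T (suc i) (s≤s i≤m)) (λ i i<m → halve (suc i) (s≤s i<m)))
                              (halve 0 (s≤s z≤n))))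
    (≤-reflexive (lemma (T 0)))
    where
    lemma : ∀ a → a + a ≡ + 2 * a
    lemma = solve-∀

  -- In the notation of the paper, α = A / t, β = B / t and br j = [j].
  module Eigenspace {n : ℕ} (Γ : DistanceRegularGraph n) (t A B : ℤ) (br : ℕ → ℤ) where
    open DistanceRegularGraph Γ
    open DistanceFunction Γ

    r : ℤ
    r = br diameter

    -- These are t (1 + α[i]) and t (β - α[i]), the second factors of t c_{i+1} and t b_i. Their sum
    -- B + t does not depend on i, which is what makes -r an eigenvalue.
    p q : ℕ → ℤ
    p i = t + A * br i
    q i = B - A * br i

    record Parameters : Set where
      field
        0<t     : 0ℤ < t
        br-zero : br 0 ≡ 0ℤ
        br-one  : br 1 ≡ 1ℤ
        0<br    : ∀ i → 0ℤ < br (suc i)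
        0<p     : ∀ i → 0ℤ < p i
        0<q     : ∀ i → i ℕ.< diameter → 0ℤ < q i
        t*intc  : ∀ i → i ℕ.< diameter → t * + intc (suc i) ≡ br (suc i) * p i
        t*intb  : ∀ i → i ℕ.< diameter → t * + intb i ≡ (r - br i) * q i
        0<diameter : 0 ℕ.< diameter

    module Theory (parameters : Parameters) where
      open Parameters parameters

      t*valency : t * + valency ≡ r * B
      t*valency = trans (t*intb 0 0<diameter) (trans (cong (λ v → (r - v) * (B - A * v)) br-zero) (lemma r A B))
        where
        lemma : ∀ r A B → (r - 0ℤ) * (B - A * 0ℤ) ≡ r * B
        lemma = solve-∀

      prod : ℕ → ℕ → ℤ
      prod i zero = 1ℤ
      prod i (suc m) = q i * prod (suc i) m

      prodp : ℕ → ℤ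
      prodp zero = 1ℤ
      prodp (suc i) = prodp i * - p i

      -- The standard sequence of the eigenvalue -r, scaled to be integral.
      f : ℕ → ℤ
      f i = prodp i * prod i (diameter ℕ.∸ i)

      -- The quotients of the standard sequence are -p_i / q_i; the factors q of all later indices
      -- serve to clear the denominators.
      f-suc : ∀ i → i ℕ.< diameter → q i * f (suc i) ≡ - (p i * f i)
      f-suc i i<D = trans (lemma (q i) (prodp i) (p i) (prod (suc i) (diameter ℕ.∸ suc i)))
        (cong (λ m → - (p i * (prodp i * prod i m))) (sym (ℕ.+-∸-assoc 1 i<D)))
        where
        lemma : ∀ q π p ρ → q * (π * - p * ρ) ≡ - (p * (π * (q * ρ)))
        lemma = solve-∀

      0<f₀ : 0ℤ < f 0
      0<f₀ = subst (0ℤ <_) (sym (*-identityˡ _)) (go diameter 0 (ℕ.≤-reflexive refl))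
        where
        go : ∀ m i → i ℕ.+ m ℕ.≤ diameter → 0ℤ < prod i m
        go zero i _ = +<+ (s≤s z≤n)
        go (suc m) i i+m≤D = 0<* (0<q i (ℕ.≤-trans (s≤s (ℕ.m≤m+n i m)) i+1+m≤D)) (go m (suc i) i+1+m≤D)
          where
          i+1+m≤D = subst (ℕ._≤ diameter) (ℕ.+-suc i m) i+m≤D

      -- No entry of `F` vanishes, which permits the cancellations in `M-constant` and `balance`.
      f≢0 : ∀ i → i ℕ.≤ diameter → f i ≢ 0ℤ
      f≢0 zero _ f≡0 = <⇒≢ 0<f₀ (sym f≡0)
      f≢0 (suc i) i<D f≡0 = f≢0 i (ℕ.<⇒≤ i<D) (≢-cancelˡ (≢-sym (<⇒≢ (0<p i))) (trans
        (trans (sym (neg-involutive _)) (cong -_ (trans (sym (f-suc i i<D)) (trans (cong (q i *_) f≡0) (*-zeroʳ (q i))))))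
        (sym (*-zeroʳ (p i)))))

      F : Fin n → Fin n → ℤ
      F x y = f (d x y)

      F-sym : ∀ x y → F x y ≡ F y x
      F-sym x y = cong f (d-sym x y)

      F-diag : ∀ x → F x x ≡ f 0
      F-diag x = cong f (d-refl x)

      Eigenvector : (Fin n → ℤ) → Set
      Eigenvector w = ∀ z → sum (λ y → 𝟙 (Adj? z y) * w y) ≡ - (r * w z)

      -- Since p_i f_i = -q_i f_{i+1} and p_i + q_i = B + t, this term is a multiple of f_j alone,
      -- and so is `farther-term`. Together they shift the valency rβ to the eigenvalue rβ - r(β +
      -- 1) = -r.
      closer-term : ∀ j → j ℕ.≤ diameter → t * (+ c j * (f (pred j) - f j)) ≡ - (br j * (B + t) * f j)
      closer-term zero _ = trans (lemma t (f 0)) (trans (lemma′ (B + t) (f 0)) (cong (λ v → - (v * (B + t) * f 0)) (sym br-zero)))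
        where
        lemma : ∀ t u → t * (0ℤ * (u - u)) ≡ 0ℤ
        lemma = solve-∀
        lemma′ : ∀ u v → 0ℤ ≡ - (0ℤ * u * v)
        lemma′ = solve-∀
      closer-term (suc i) i<D = begin
        t * (+ intc (suc i) * (f i - f (suc i))) ≡⟨ *-assoc t (+ intc (suc i)) _ ⟨
        t * + intc (suc i) * (f i - f (suc i)) ≡⟨ cong (_* (f i - f (suc i))) (t*intc i i<D) ⟩
        br (suc i) * p i * (f i - f (suc i)) ≡⟨ lemma (br (suc i)) (p i) (f i) (f (suc i)) ⟩
        br (suc i) * (- - (p i * f i) - p i * f (suc i)) ≡⟨ cong (λ u → br (suc i) * (- u - p i * f (suc i))) (f-suc i i<D) ⟨
        br (suc i) * (- (q i * f (suc i)) - p i * f (suc i)) ≡⟨ lemma′ (br (suc i)) t A B (br i) (f (suc i)) ⟩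
        - (br (suc i) * (B + t) * f (suc i)) ∎
        where
        open ≡-Reasoning
        lemma : ∀ b p u v → b * p * (u - v) ≡ b * (- - (p * u) - p * v)
        lemma = solve-∀
        lemma′ : ∀ b t A B v u → b * (- ((B - A * v) * u) - (t + A * v) * u) ≡ - (b * (B + t) * u)
        lemma′ = solve-∀

      farther-term : ∀ j → j ℕ.≤ diameter → t * (+ intb j * (f (suc j) - f j)) ≡ - ((r - br j) * (B + t) * f j)
      farther-term j j≤D with ℕ.m≤n⇒m<n∨m≡n j≤D
      ... | inj₂ refl = trans (cong (λ m → t * (+ m * (f (suc j) - f j))) intb-diameter) (lemma t (br j) (B + t) (f (suc j)) (f j))
        where
        lemma : ∀ t r s u v → t * (0ℤ * (u - v)) ≡ - ((r - r) * s * v)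
        lemma = solve-∀
      ... | inj₁ j<D = begin
        t * (+ intb j * (f (suc j) - f j)) ≡⟨ *-assoc t (+ intb j) _ ⟨
        t * + intb j * (f (suc j) - f j) ≡⟨ cong (_* (f (suc j) - f j)) (t*intb j j<D) ⟩
        (r - br j) * q j * (f (suc j) - f j) ≡⟨ lemma (r - br j) (q j) (f (suc j)) (f j) ⟩
        (r - br j) * (q j * f (suc j) - q j * f j) ≡⟨ cong (λ u → (r - br j) * (u - q j * f j)) (f-suc j j<D) ⟩
        (r - br j) * (- (p j * f j) - q j * f j) ≡⟨ lemma′ (r - br j) t A B (br j) (f j) ⟩
        - ((r - br j) * (B + t) * f j) ∎
        where
        open ≡-Reasoning
        lemma : ∀ b q u v → b * q * (u - v) ≡ b * (q * u - q * v)
        lemma = solve-∀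
        lemma′ : ∀ b t A B v u → b * (- ((t + A * v) * u) - (B - A * v) * u) ≡ - (b * (B + t) * u)
        lemma′ = solve-∀

      F-eigenvector : ∀ x → Eigenvector (F x)
      F-eigenvector x z = <-cancelˡ 0<t (begin
        t * sum (λ y → 𝟙 (Adj? z y) * f (d x y)) ≡⟨ cong (t *_) (neighbour-sum f x z) ⟩
        t * (+ valency * f j + + c j * (f (pred j) - f j) + + intb j * (f (suc j) - f j))
          ≡⟨ lemma t (+ valency) (f j) (+ c j * (f (pred j) - f j)) (+ intb j * (f (suc j) - f j)) ⟩
        t * + valency * f j + t * (+ c j * (f (pred j) - f j)) + t * (+ intb j * (f (suc j) - f j))
          ≡⟨ cong₂ _+_ (cong₂ _+_ (cong (_* f j) t*valency) (closer-term j (d≤diameter x z))) (farther-term j (d≤diameter x z)) ⟩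
        r * B * f j + - (br j * (B + t) * f j) + - ((r - br j) * (B + t) * f j) ≡⟨ lemma′ r B (f j) (br j) t ⟩
        t * - (r * f j) ∎)
        where
        open ≡-Reasoning
        j = d x z
        lemma : ∀ t k v a b → t * (k * v + a + b) ≡ t * k * v + t * a + t * b
        lemma = solve-∀
        lemma′ : ∀ r B v b t → r * B * v + - (b * (B + t) * v) + - ((r - b) * (B + t) * v) ≡ t * - (r * v)
        lemma′ = solve-∀

      sphere ball : (Fin n → ℤ) → Fin n → ℕ → ℤ
      sphere w x i = sum λ y → 𝟙 (d x y ℕ.≟ i) * w y
      ball w x i = sum λ y → 𝟙 (d x y ℕ.≤? i) * w y

      sphere-zero : ∀ w x → sphere w x 0 ≡ w x
      sphere-zero w x = trans
        (sum-cong-≗ λ y → cong (_* w y) (𝟙-cong (d x y ℕ.≟ 0) (x ≟ y) d≡0⇒≡ λ { refl → d-refl x })) (sum-δ x w)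

      ball-zero : ∀ w x → ball w x 0 ≡ sphere w x 0
      ball-zero w x = sum-cong-≗ λ y → cong (_* w y) (𝟙-cong (d x y ℕ.≤? 0) (d x y ℕ.≟ 0) ℕ.n≤0⇒n≡0 ℕ.≤-reflexive)

      ball-suc : ∀ w x i → ball w x (suc i) ≡ ball w x i + sphere w x (suc i)
      ball-suc w x i = trans (sum-cong-≗ λ y → trans (cong (_* w y) (split (d x y) (d x y ℕ.≤? i) (d x y ℕ.≟ suc i))) (*-distribʳ-+ (w y) (𝟙 (d x y ℕ.≤? i)) _))
        (∑-distrib-+ (λ y → 𝟙 (d x y ℕ.≤? i) * w y) (λ y → 𝟙 (d x y ℕ.≟ suc i) * w y))
        where
        split : ∀ j (p : Dec (j ℕ.≤ i)) (q : Dec (j ≡ suc i)) → 𝟙 (j ℕ.≤? suc i) ≡ 𝟙 p + 𝟙 q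
        split j (yes j≤i) (yes refl) = ⊥-elim (ℕ.<-irrefl refl j≤i)
        split j (yes j≤i) (no _) = 𝟙-yes (j ℕ.≤? suc i) (ℕ.m≤n⇒m≤1+n j≤i)
        split j (no _) (yes refl) = 𝟙-yes (j ℕ.≤? suc i) ℕ.≤-refl
        split j (no j≰i) (no j≢) = 𝟙-no (j ℕ.≤? suc i) λ j≤ → j≰i (ℕ.s≤s⁻¹ (ℕ.≤∧≢⇒< j≤ j≢))

      -- Only the spheres of radius i and i + 1 see the boundary of the ball of radius i.
      ball-neighbours : ∀ i j → + c j * (𝟙 (pred j ℕ.≤? i) - 𝟙 (j ℕ.≤? i)) + + intb j * (𝟙 (suc j ℕ.≤? i) - 𝟙 (j ℕ.≤? i))
        ≡ 𝟙 (j ℕ.≟ suc i) * + intc (suc i) - 𝟙 (j ℕ.≟ i) * + intb i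
      ball-neighbours i j with ℕ.<-cmp j i
      ... | tri< j<i j≢i _ = trans
        (cong₂ (λ u v → + c j * u + + intb j * v)
          (cong₂ _-_ (𝟙-yes (pred j ℕ.≤? i) (ℕ.≤-trans ℕ.pred[n]≤n (ℕ.<⇒≤ j<i))) (𝟙-yes (j ℕ.≤? i) (ℕ.<⇒≤ j<i)))
          (cong₂ _-_ (𝟙-yes (suc j ℕ.≤? i) j<i) (𝟙-yes (j ℕ.≤? i) (ℕ.<⇒≤ j<i))))
        (trans (lemma (+ c j) (+ intb j) (+ intc (suc i)) (+ intb i))
          (sym (cong₂ (λ u v → u * + intc (suc i) - v * + intb i)
            (𝟙-no (j ℕ.≟ suc i) (ℕ.<⇒≢ (ℕ.m≤n⇒m≤1+n j<i))) (𝟙-no (j ℕ.≟ i) j≢i))))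
        where
        lemma : ∀ a b a′ b′ → a * (1ℤ - 1ℤ) + b * (1ℤ - 1ℤ) ≡ 0ℤ * a′ - 0ℤ * b′
        lemma = solve-∀
      ... | tri≈ _ refl _ = trans
        (cong₂ (λ u v → + c j * u + + intb j * v)
          (cong₂ _-_ (𝟙-yes (pred j ℕ.≤? j) ℕ.pred[n]≤n) (𝟙-yes (j ℕ.≤? j) ℕ.≤-refl))
          (cong₂ _-_ (𝟙-no (suc j ℕ.≤? j) ℕ.1+n≰n) (𝟙-yes (j ℕ.≤? j) ℕ.≤-refl)))
        (trans (lemma (+ c j) (+ intc (suc j)) (+ intb j))
          (sym (cong₂ (λ u v → u * + intc (suc j) - v * + intb j)
            (𝟙-no (j ℕ.≟ suc j) (ℕ.<⇒≢ ℕ.≤-refl)) (𝟙-yes (j ℕ.≟ j) refl))))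
        where
        lemma : ∀ a a′ b → a * (1ℤ - 1ℤ) + b * (0ℤ - 1ℤ) ≡ 0ℤ * a′ - 1ℤ * b
        lemma = solve-∀
      ... | tri> _ j≢i i<j with ℕ.m≤n⇒m<n∨m≡n i<j
      ...   | inj₂ refl = trans
        (cong₂ (λ u v → + intc (suc i) * u + + intb j * v)
          (cong₂ _-_ (𝟙-yes (i ℕ.≤? i) ℕ.≤-refl) (𝟙-no (j ℕ.≤? i) ℕ.1+n≰n))
          (cong₂ _-_ (𝟙-no (suc j ℕ.≤? i) (ℕ.1+n≰n ∘ ℕ.<⇒≤)) (𝟙-no (j ℕ.≤? i) ℕ.1+n≰n)))
        (trans (lemma (+ intc (suc i)) (+ intb j) (+ intb i))
          (sym (cong₂ (λ u v → u * + intc (suc i) - v * + intb i)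
            (𝟙-yes (j ℕ.≟ j) refl) (𝟙-no (j ℕ.≟ i) j≢i))))
        where
        lemma : ∀ a b b′ → a * (1ℤ - 0ℤ) + b * (0ℤ - 0ℤ) ≡ 1ℤ * a - 0ℤ * b′
        lemma = solve-∀
      ...   | inj₁ 1+i<j = trans
        (cong₂ (λ u v → + c j * u + + intb j * v)
          (cong₂ _-_ (𝟙-no (pred j ℕ.≤? i) (ℕ.<⇒≱ (ℕ.pred-mono-≤ 1+i<j))) (𝟙-no (j ℕ.≤? i) (ℕ.<⇒≱ i<j)))
          (cong₂ _-_ (𝟙-no (suc j ℕ.≤? i) (ℕ.<⇒≱ (ℕ.m≤n⇒m≤1+n i<j))) (𝟙-no (j ℕ.≤? i) (ℕ.<⇒≱ i<j))))
        (trans (lemma (+ c j) (+ intb j) (+ intc (suc i)) (+ intb i))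
          (sym (cong₂ (λ u v → u * + intc (suc i) - v * + intb i)
            (𝟙-no (j ℕ.≟ suc i) (≢-sym (ℕ.<⇒≢ 1+i<j))) (𝟙-no (j ℕ.≟ i) j≢i))))
        where
        lemma : ∀ a b a′ b′ → a * (0ℤ - 0ℤ) + b * (0ℤ - 0ℤ) ≡ 0ℤ * a′ - 0ℤ * b′
        lemma = solve-∀

      module _ (w : Fin n → ℤ) (eigenvector : Eigenvector w) (x : Fin n) where

        -- The eigenvalue equation summed over the ball of radius i. After exchanging the sums each
        -- w z is weighted by the number of neighbours of z in the ball, which is the valency
        -- inside, with corrections at radii i and i + 1.
        boundary : ∀ i → - (r * ball w x i) ≡ + valency * ball w x i + (+ intc (suc i) * sphere w x (suc i) - + intb i * sphere w x i)
        boundary i = begin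
          - (r * ball w x i) ≡⟨ lemma₀ r (ball w x i) ⟩
          - r * ball w x i ≡⟨ *-distribˡ-sum (- r) (λ y → in-ball y * w y) ⟩
          sum (λ y → - r * (in-ball y * w y))
            ≡⟨ sum-cong-≗ (λ y → trans (lemma₁ r (in-ball y) (w y)) (cong (in-ball y *_) (sym (eigenvector y)))) ⟩
          sum (λ y → in-ball y * sum (λ z → 𝟙 (Adj? y z) * w z))
            ≡⟨ sum-cong-≗ (λ y → *-distribˡ-sum (in-ball y) (λ z → 𝟙 (Adj? y z) * w z)) ⟩
          sum (λ y → sum (λ z → in-ball y * (𝟙 (Adj? y z) * w z)))
            ≡⟨ ∑-comm (λ y z → in-ball y * (𝟙 (Adj? y z) * w z)) ⟩
          sum (λ z → sum (λ y → in-ball y * (𝟙 (Adj? y z) * w z)))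
            ≡⟨ sum-cong-≗ (λ z → trans (sum-cong-≗ (λ y → trans (lemma₂ (in-ball y) (𝟙 (Adj? y z)) (w z))
                  (cong (λ a → a * in-ball y * w z) (𝟙-cong (Adj? y z) (Adj? z y) Adj-sym Adj-sym))))
                (sym (*-distribʳ-sum (w z) (λ y → 𝟙 (Adj? z y) * in-ball y)))) ⟩
          sum (λ z → sum (λ y → 𝟙 (Adj? z y) * in-ball y) * w z)
            ≡⟨ sum-cong-≗ (λ z → trans (cong (_* w z) (trans (neighbour-sum (λ j → 𝟙 (j ℕ.≤? i)) x z)
                  (trans (+-assoc (+ valency * in-ball z) _ _) (cong (λ u → + valency * in-ball z + u) (ball-neighbours i (d x z))))))
                (lemma₃ (+ valency) (in-ball z) (𝟙 (d x z ℕ.≟ suc i)) (+ intc (suc i)) (𝟙 (d x z ℕ.≟ i)) (+ intb i) (w z))) ⟩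
          sum (λ z → + valency * (in-ball z * w z) + + intc (suc i) * (𝟙 (d x z ℕ.≟ suc i) * w z) + - + intb i * (𝟙 (d x z ℕ.≟ i) * w z))
            ≡⟨ sum-+₃ (λ z → + valency * (in-ball z * w z)) (λ z → + intc (suc i) * (𝟙 (d x z ℕ.≟ suc i) * w z))
                      (λ z → - + intb i * (𝟙 (d x z ℕ.≟ i) * w z)) ⟩
          sum (λ z → + valency * (in-ball z * w z)) + sum (λ z → + intc (suc i) * (𝟙 (d x z ℕ.≟ suc i) * w z))
            + sum (λ z → - + intb i * (𝟙 (d x z ℕ.≟ i) * w z))
            ≡⟨ cong₂ _+_ (cong₂ _+_ (*-distribˡ-sum (+ valency) (λ z → in-ball z * w z))
                                    (*-distribˡ-sum (+ intc (suc i)) (λ z → 𝟙 (d x z ℕ.≟ suc i) * w z)))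
                         (*-distribˡ-sum (- + intb i) (λ z → 𝟙 (d x z ℕ.≟ i) * w z)) ⟨
          + valency * ball w x i + + intc (suc i) * sphere w x (suc i) + - + intb i * sphere w x i
            ≡⟨ lemma₄ (+ valency * ball w x i) (+ intc (suc i) * sphere w x (suc i)) (+ intb i) (sphere w x i) ⟩
          + valency * ball w x i + (+ intc (suc i) * sphere w x (suc i) - + intb i * sphere w x i) ∎
          where
          open ≡-Reasoning
          in-ball : Fin n → ℤ
          in-ball y = 𝟙 (d x y ℕ.≤? i)
          lemma₀ : ∀ r u → - (r * u) ≡ - r * u
          lemma₀ = solve-∀
          lemma₁ : ∀ r u v → - r * (u * v) ≡ u * - (r * v)
          lemma₁ = solve-∀
          lemma₂ : ∀ u a v → u * (a * v) ≡ a * u * v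
          lemma₂ = solve-∀
          lemma₃ : ∀ k u s c s′ b v → (k * u + (s * c - s′ * b)) * v ≡ k * (u * v) + c * (s * v) + - b * (s′ * v)
          lemma₃ = solve-∀
          lemma₄ : ∀ k c b s → k + c + - b * s ≡ k + (c - b * s)
          lemma₄ = solve-∀

        -- In `boundary` the ball sum occurs with the factor valency + r = r (B + t) / t, so the
        -- assumption turns it into a sphere sum. The coefficient q_i - (B + t) = -p_i that results
        -- cancels against the p_i in c_{i+1}.
        sphere-recursion′ : ∀ i → i ℕ.< diameter → r * ball w x i ≡ (r - br i) * sphere w x i →
          br (suc i) * sphere w x (suc i) ≡ - ((r - br i) * sphere w x i)
        sphere-recursion′ i i<D ball≡ = <-cancelˡ (0<p i) (begin
          p i * (br (suc i) * S′) ≡⟨ lemma₁ (p i) (br (suc i)) S′ ⟩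
          br (suc i) * p i * S′ ≡⟨ cong (_* S′) (t*intc i i<D) ⟨
          t * + intc (suc i) * S′
            ≡⟨ lemma₂ t (+ intc (suc i)) S′ (+ valency) b (+ intb i) S ⟩
          t * (+ valency * b + (+ intc (suc i) * S′ - + intb i * S)) - t * + valency * b + t * + intb i * S
            ≡⟨ cong (λ u → t * u - t * + valency * b + t * + intb i * S) (boundary i) ⟨
          t * - (r * b) - t * + valency * b + t * + intb i * S
            ≡⟨ cong₂ (λ u v → t * - (r * b) - u * b + v * S) t*valency (t*intb i i<D) ⟩
          t * - (r * b) - r * B * b + (r - br i) * q i * S ≡⟨ lemma₃ t r b B ((r - br i) * q i * S) ⟩
          (r - br i) * q i * S - (t + B) * (r * b) ≡⟨ cong (λ u → (r - br i) * q i * S - (t + B) * u) ball≡ ⟩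
          (r - br i) * q i * S - (t + B) * ((r - br i) * S) ≡⟨ lemma₄ (r - br i) B A (br i) S t ⟩
          p i * - ((r - br i) * S) ∎)
          where
          open ≡-Reasoning
          S = sphere w x i
          S′ = sphere w x (suc i)
          b = ball w x i
          lemma₁ : ∀ p b s → p * (b * s) ≡ b * p * s
          lemma₁ = solve-∀
          lemma₂ : ∀ t c s k b e u → t * c * s ≡ t * (k * b + (c * s - e * u)) - t * k * b + t * e * u
          lemma₂ = solve-∀
          lemma₃ : ∀ t r b B e → t * - (r * b) - r * B * b + e ≡ e - (t + B) * (r * b)
          lemma₃ = solve-∀
          lemma₄ : ∀ v B A e s t → v * (B - A * e) * s - (t + B) * (v * s) ≡ (t + A * e) * - (v * s)
          lemma₄ = solve-∀

        -- Induction together with the recursion: adding the next sphere, the term (r - [i]) times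
        -- the old sphere sum is replaced by -[i+1] times the new one.
        ball-sphere : ∀ i → i ℕ.≤ diameter → r * ball w x i ≡ (r - br i) * sphere w x i
        ball-sphere zero _ = trans (cong (r *_) (ball-zero w x))
          (trans (lemma r (sphere w x 0)) (cong (λ v → (r - v) * sphere w x 0) (sym br-zero)))
          where
          lemma : ∀ r s → r * s ≡ (r - 0ℤ) * s
          lemma = solve-∀
        ball-sphere (suc i) i<D = begin
          r * ball w x (suc i) ≡⟨ cong (r *_) (ball-suc w x i) ⟩
          r * (ball w x i + sphere w x (suc i)) ≡⟨ *-distribˡ-+ r (ball w x i) (sphere w x (suc i)) ⟩
          r * ball w x i + r * sphere w x (suc i)
            ≡⟨ cong (_+ r * sphere w x (suc i)) (trans ball≡ (sym (neg-involutive _))) ⟩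
          - - ((r - br i) * sphere w x i) + r * sphere w x (suc i)
            ≡⟨ cong (λ u → - u + r * sphere w x (suc i)) (sphere-recursion′ i i<D ball≡) ⟨
          - (br (suc i) * sphere w x (suc i)) + r * sphere w x (suc i) ≡⟨ lemma (br (suc i)) r (sphere w x (suc i)) ⟩
          (r - br (suc i)) * sphere w x (suc i) ∎
          where
          open ≡-Reasoning
          ball≡ = ball-sphere i (ℕ.<⇒≤ i<D)
          lemma : ∀ b r s → - (b * s) + r * s ≡ (r - b) * s
          lemma = solve-∀

        sphere-recursion : ∀ i → i ℕ.< diameter → br (suc i) * sphere w x (suc i) ≡ - ((r - br i) * sphere w x i)
        sphere-recursion i i<D = sphere-recursion′ i i<D (ball-sphere i (ℕ.<⇒≤ i<D))

      -- By the recursion, the sphere sums of an eigenvector around x depend on it only through its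
      -- value at x.
      sphere-proportional : ∀ v w → Eigenvector v → Eigenvector w → ∀ x i → i ℕ.≤ diameter →
        v x * sphere w x i ≡ w x * sphere v x i
      sphere-proportional v w ev ew x zero _ = trans (cong (v x *_) (sphere-zero w x))
        (trans (*-comm (v x) (w x)) (cong (w x *_) (sym (sphere-zero v x))))
      sphere-proportional v w ev ew x (suc i) i<D = <-cancelˡ (0<br i) (begin
        br (suc i) * (v x * sphere w x (suc i)) ≡⟨ lemma₁ (br (suc i)) (v x) (sphere w x (suc i)) ⟩
        v x * (br (suc i) * sphere w x (suc i)) ≡⟨ cong (v x *_) (sphere-recursion w ew x i i<D) ⟩
        v x * - ((r - br i) * sphere w x i) ≡⟨ lemma₂ (v x) (r - br i) (sphere w x i) ⟩
        - ((r - br i) * (v x * sphere w x i)) ≡⟨ cong (λ u → - ((r - br i) * u)) (sphere-proportional v w ev ew x i (ℕ.<⇒≤ i<D)) ⟩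
        - ((r - br i) * (w x * sphere v x i)) ≡⟨ lemma₂ (w x) (r - br i) (sphere v x i) ⟨
        w x * - ((r - br i) * sphere v x i) ≡⟨ cong (w x *_) (sphere-recursion v ev x i i<D) ⟨
        w x * (br (suc i) * sphere v x (suc i)) ≡⟨ lemma₁ (br (suc i)) (w x) (sphere v x (suc i)) ⟨
        br (suc i) * (w x * sphere v x (suc i)) ∎)
        where
        open ≡-Reasoning
        lemma₁ : ∀ b v s → b * (v * s) ≡ v * (b * s)
        lemma₁ = solve-∀
        lemma₂ : ∀ v b s → v * - (b * s) ≡ - (b * (v * s))
        lemma₂ = solve-∀

      by-spheres : ∀ (g : ℕ → ℤ) w x → sum (λ y → g (d x y) * w y) ≡ sum {suc diameter} (λ i → g (toℕ i) * sphere w x (toℕ i))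
      by-spheres g w x = sym (begin
        sum {suc diameter} (λ i → g (toℕ i) * sphere w x (toℕ i))
          ≡⟨ sum-cong-≗ {suc diameter} (λ i → *-distribˡ-sum (g (toℕ i)) (λ y → 𝟙 (d x y ℕ.≟ toℕ i) * w y)) ⟩
        sum {suc diameter} (λ i → sum (λ y → g (toℕ i) * (𝟙 (d x y ℕ.≟ toℕ i) * w y)))
          ≡⟨ ∑-comm {suc diameter} (λ i y → g (toℕ i) * (𝟙 (d x y ℕ.≟ toℕ i) * w y)) ⟩
        sum (λ y → sum {suc diameter} (λ i → g (toℕ i) * (𝟙 (d x y ℕ.≟ toℕ i) * w y)))
          ≡⟨ sum-cong-≗ (λ y → trans (sum-cong-≗ {suc diameter} (pointwise y)) (sum-δ (level y) (λ i → g (toℕ i) * w y))) ⟩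
        sum (λ y → g (toℕ (level y)) * w y)
          ≡⟨ sum-cong-≗ (λ y → cong (λ i → g i * w y) (toℕ-fromℕ< (s≤s (d≤diameter x y)))) ⟩
        sum (λ y → g (d x y) * w y) ∎)
        where
        open ≡-Reasoning
        level : Fin n → Fin (suc diameter)
        level y = fromℕ< (s≤s (d≤diameter x y))
        lemma : ∀ a b c → a * (b * c) ≡ b * (a * c)
        lemma = solve-∀
        pointwise : ∀ y i → g (toℕ i) * (𝟙 (d x y ℕ.≟ toℕ i) * w y) ≡ 𝟙 (level y ≟ i) * (g (toℕ i) * w y)
        pointwise y i = trans (lemma (g (toℕ i)) (𝟙 (d x y ℕ.≟ toℕ i)) (w y))
          (cong (_* (g (toℕ i) * w y)) (𝟙-cong (d x y ℕ.≟ toℕ i) (level y ≟ i)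
            (λ e → toℕ-injective (trans (toℕ-fromℕ< _) e)) (λ { refl → sym (toℕ-fromℕ< _) })))

      M : Fin n → ℤ
      M x = sum λ y → F x y * F x y

      -- Grouped by spheres, the left side depends only on the sphere sums of w around x. These are
      -- w x / f 0 times those of `F x`, an eigenvector with value f 0 at x.
      F-scales : ∀ w → Eigenvector w → ∀ x → f 0 * sum (λ y → F x y * w y) ≡ M x * w x
      F-scales w ew x = begin
        f 0 * sum (λ y → F x y * w y) ≡⟨ cong (f 0 *_) (by-spheres f w x) ⟩
        f 0 * sum {suc diameter} (λ i → f (toℕ i) * sphere w x (toℕ i))
          ≡⟨ *-distribˡ-sum {suc diameter} (f 0) (λ i → f (toℕ i) * sphere w x (toℕ i)) ⟩
        sum {suc diameter} (λ i → f 0 * (f (toℕ i) * sphere w x (toℕ i)))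
          ≡⟨ sum-cong-≗ {suc diameter} (λ i → trans (lemma (f 0) (f (toℕ i)) (sphere w x (toℕ i)))
               (trans (cong (f (toℕ i) *_) (proportional i)) (lemma′ (f (toℕ i)) (sphere (F x) x (toℕ i)) (w x)))) ⟩
        sum {suc diameter} (λ i → f (toℕ i) * sphere (F x) x (toℕ i) * w x)
          ≡⟨ *-distribʳ-sum {suc diameter} (w x) (λ i → f (toℕ i) * sphere (F x) x (toℕ i)) ⟨
        sum {suc diameter} (λ i → f (toℕ i) * sphere (F x) x (toℕ i)) * w x ≡⟨ cong (_* w x) (by-spheres f (F x) x) ⟨
        M x * w x ∎
        where
        open ≡-Reasoning
        lemma : ∀ a b c → a * (b * c) ≡ b * (a * c)
        lemma = solve-∀
        lemma′ : ∀ a b c → a * (c * b) ≡ a * b * c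
        lemma′ = solve-∀
        proportional : ∀ i → f 0 * sphere w x (toℕ i) ≡ w x * sphere (F x) x (toℕ i)
        proportional i = trans (cong (_* sphere w x (toℕ i)) (sym (F-diag x)))
          (sphere-proportional (F x) w (F-eigenvector x) ew x (toℕ i) (ℕ.s≤s⁻¹ (toℕ<n i)))

      -- Evaluating the inner product of `F x` and `F z` by `F-scales` at x and at z gives two
      -- expressions, from which the nonzero entry `F x z` cancels.
      M-constant : ∀ x z → M x ≡ M z
      M-constant x z = ≢-cancelˡ (f≢0 (d x z) (d≤diameter x z)) (begin
        F x z * M x ≡⟨ *-comm (F x z) (M x) ⟩
        M x * F x z ≡⟨ cong (M x *_) (F-sym x z) ⟩
        M x * F z x ≡⟨ F-scales (F z) (F-eigenvector z) x ⟨
        f 0 * sum (λ y → F x y * F z y) ≡⟨ cong (f 0 *_) (sum-cong-≗ (λ y → *-comm (F x y) (F z y))) ⟩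
        f 0 * sum (λ y → F z y * F x y) ≡⟨ F-scales (F x) (F-eigenvector x) z ⟩
        M z * F x z ≡⟨ *-comm (M z) (F x z) ⟩
        F x z * M z ∎)
        where open ≡-Reasoning

      0<M : ∀ x → 0ℤ < M x
      0<M x = <-≤-trans (0<* 0<f₀ 0<f₀)
        (subst (λ u → u * u ≤ M x) (F-diag x) (term≤sum (λ y → 0≤square (F x y)) x))

      -- The eigenspace of -r has dimension n f(0)² / M.
      M≤2f₀² : (∀ i → i ℕ.< diameter → + 2 * (p i * (r - br i)) ≤ q i * br (suc i)) → ∀ x → M x ≤ + 2 * (f 0 * f 0)
      M≤2f₀² halving x = begin
        M x ≡⟨ by-spheres f (F x) x ⟩
        sum {suc diameter} (T ∘ toℕ) ≤⟨ halving-sum diameter T (λ i _ → 0≤T i) halve ⟩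
        + 2 * T 0 ≡⟨ cong (λ u → + 2 * (f 0 * u)) (trans (sphere-zero (F x) x) (F-diag x)) ⟩
        + 2 * (f 0 * f 0) ∎
        where
        open ≤-Reasoning
        T : ℕ → ℤ
        T i = f i * sphere (F x) x i
        0≤T : ∀ i → 0ℤ ≤ T i
        0≤T i = subst (0ℤ ≤_) (sym (*-distribˡ-sum (f i) (λ y → 𝟙 (d x y ℕ.≟ i) * F x y))) (0≤sum λ y → term y (d x y ℕ.≟ i))
          where
          term : ∀ y (e : Dec (d x y ≡ i)) → 0ℤ ≤ f i * (𝟙 e * F x y)
          term y (yes refl) = subst (λ u → 0ℤ ≤ f i * u) (sym (*-identityˡ (f i))) (0≤square (f i))
          term y (no _) = ≤-reflexive (sym (*-zeroʳ (f i)))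
        -- By `f-suc` and `sphere-recursion` consecutive terms have the quotient p_i (r - [i]) /
        -- (q_i [i+1]); the two minus signs cancel.
        halve : ∀ i → i ℕ.< diameter → + 2 * T (suc i) ≤ T i
        halve i i<D = *-cancelˡ-≤ (0<* (0<q i i<D) (0<br i)) (≤-by _
          (0≤* (0≤- (halving i i<D)) (0≤T i))
          (trans (lemma₁ (q i) (br (suc i)) (T i)) (cong₂ _+_ (sym scaled) refl)))
          where
          scaled : q i * br (suc i) * (+ 2 * T (suc i)) ≡ + 2 * (p i * (r - br i)) * T i
          scaled = trans (lemma₂ (q i) (br (suc i)) (f (suc i)) (sphere (F x) x (suc i)))
            (trans (cong₂ (λ u v → + 2 * (u * v)) (f-suc i i<D) (sphere-recursion (F x) (F-eigenvector x) x i i<D))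
              (lemma₃ (p i) (f i) (r - br i) (sphere (F x) x i)))
            where
            lemma₂ : ∀ q b f s → q * b * (+ 2 * (f * s)) ≡ + 2 * (q * f * (b * s))
            lemma₂ = solve-∀
            lemma₃ : ∀ p f r s → + 2 * (- (p * f) * - (r * s)) ≡ + 2 * (p * r) * (f * s)
            lemma₃ = solve-∀
          lemma₁ : ∀ q b T → q * b * T ≡ + 2 * (p i * (r - br i)) * T + (q * b - + 2 * (p i * (r - br i))) * T
          lemma₁ q b T = lemma q b T (+ 2 * (p i * (r - br i)))
            where
            lemma : ∀ q b T u → q * b * T ≡ u * T + (q * b - u) * T
            lemma = solve-∀

      image : (Fin n → ℤ) → Fin n → ℤ
      image v x = sum λ y → F x y * v y

      image-eigenvector : ∀ v → Eigenvector (image v)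
      image-eigenvector v z = begin
        sum (λ x → 𝟙 (Adj? z x) * sum (λ y → F x y * v y))
          ≡⟨ sum-cong-≗ (λ x → *-distribˡ-sum (𝟙 (Adj? z x)) (λ y → F x y * v y)) ⟩
        sum (λ x → sum (λ y → 𝟙 (Adj? z x) * (F x y * v y))) ≡⟨ ∑-comm (λ x y → 𝟙 (Adj? z x) * (F x y * v y)) ⟩
        sum (λ y → sum (λ x → 𝟙 (Adj? z x) * (F x y * v y)))
          ≡⟨ sum-cong-≗ (λ y → trans (sum-cong-≗ (λ x → trans (cong (λ u → 𝟙 (Adj? z x) * (u * v y)) (F-sym x y))
                                         (sym (*-assoc (𝟙 (Adj? z x)) (F y x) (v y)))))
               (trans (sym (*-distribʳ-sum (v y) (λ x → 𝟙 (Adj? z x) * F y x))) (cong (_* v y) (F-eigenvector y z)))) ⟩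
        sum (λ y → - (r * F y z) * v y)
          ≡⟨ sum-cong-≗ (λ y → trans (lemma r (F y z) (v y)) (cong (λ u → - r * (u * v y)) (F-sym y z))) ⟩
        sum (λ y → - r * (F z y * v y)) ≡⟨ *-distribˡ-sum (- r) (λ y → F z y * v y) ⟨
        - r * image v z ≡⟨ neg-distribˡ-* r (image v z) ⟨
        - (r * image v z) ∎
        where
        open ≡-Reasoning
        lemma : ∀ r a b → - (r * a) * b ≡ - r * (a * b)
        lemma = solve-∀

      -- A multiple of F is an orthogonal projection, so F is positive semidefinite.
      image-norm : ∀ v x → f 0 * sum (λ y → image v y * image v y) ≡ M x * sum (λ y → v y * image v y)
      image-norm v x = begin
        f 0 * sum (λ z → image v z * image v z)
          ≡⟨ cong (f 0 *_) (sum-cong-≗ (λ z → *-distribʳ-sum (image v z) (λ y → F z y * v y))) ⟩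
        f 0 * sum (λ z → sum (λ y → F z y * v y * image v z)) ≡⟨ cong (f 0 *_) (∑-comm (λ z y → F z y * v y * image v z)) ⟩
        f 0 * sum (λ y → sum (λ z → F z y * v y * image v z))
          ≡⟨ cong (f 0 *_) (sum-cong-≗ (λ y → trans (sum-cong-≗ (λ z → trans (cong (λ u → u * v y * image v z) (F-sym z y))
               (lemma (F y z) (v y) (image v z)))) (sym (*-distribˡ-sum (v y) (λ z → F y z * image v z))))) ⟩
        f 0 * sum (λ y → v y * image (image v) y) ≡⟨ *-distribˡ-sum (f 0) (λ y → v y * image (image v) y) ⟩
        sum (λ y → f 0 * (v y * image (image v) y))
          ≡⟨ sum-cong-≗ (λ y → trans (lemma′ (f 0) (v y) (image (image v) y))
               (trans (cong (v y *_) (trans (F-scales (image v) (image-eigenvector v) y) (cong (_* image v y) (M-constant y x))))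
                      (lemma′ (v y) (M x) (image v y)))) ⟩
        sum (λ y → M x * (v y * image v y)) ≡⟨ *-distribˡ-sum (M x) (λ y → v y * image v y) ⟨
        M x * sum (λ y → v y * image v y) ∎
        where
        open ≡-Reasoning
        lemma : ∀ a b c → a * b * c ≡ b * (a * c)
        lemma = solve-∀
        lemma′ : ∀ a b c → a * (b * c) ≡ b * (a * c)
        lemma′ = solve-∀

      p₀≡t : p 0 ≡ t
      p₀≡t = trans (cong (λ v → t + A * v) br-zero) (lemma t A)
        where
        lemma : ∀ t A → t + A * 0ℤ ≡ t
        lemma = solve-∀

      q₀≡B : q 0 ≡ B
      q₀≡B = trans (cong (λ v → B - A * v) br-zero) (lemma B A)
        where
        lemma : ∀ B A → B - A * 0ℤ ≡ B
        lemma = solve-∀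

      0<B : 0ℤ < B
      0<B = subst (0ℤ <_) q₀≡B (0<q 0 0<diameter)

      module Delsarte {C : Subset n} (clique : IsClique graph C) {x₀ : Fin n} (x₀∈C : x₀ ∈ C) where

        N : ℤ
        N = card (_∈? C)

        χ : Fin n → ℤ
        χ y = 𝟙 (y ∈? C)

        0<N : 0ℤ < N
        0<N = suc[i]≤j⇒i<j (1≤card (_∈? C) x₀∈C)

        image-on-clique : ∀ {x} → x ∈ C → image χ x ≡ f 0 + (N - 1ℤ) * f 1
        image-on-clique {x} x∈C = begin
          sum (λ y → F x y * χ y) ≡⟨ sum-cong-≗ (λ y → pointwise y (x ≟ y) (y ∈? C)) ⟩
          sum (λ y → 𝟙 (x ≟ y) * (f 0 - f 1) + χ y * f 1)
            ≡⟨ ∑-distrib-+ (λ y → 𝟙 (x ≟ y) * (f 0 - f 1)) (λ y → χ y * f 1) ⟩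
          sum (λ y → 𝟙 (x ≟ y) * (f 0 - f 1)) + sum (λ y → χ y * f 1)
            ≡⟨ cong₂ _+_ (sum-δ x (λ _ → f 0 - f 1)) (sym (*-distribʳ-sum (f 1) χ)) ⟩
          f 0 - f 1 + N * f 1 ≡⟨ lemma (f 0) (f 1) N ⟩
          f 0 + (N - 1ℤ) * f 1 ∎
          where
          open ≡-Reasoning
          lemma : ∀ a b N → a - b + N * b ≡ a + (N - 1ℤ) * b
          lemma = solve-∀
          same : ∀ a b → a * 1ℤ ≡ 1ℤ * (a - b) + 1ℤ * b
          same = solve-∀
          other : ∀ a b → b * 1ℤ ≡ 0ℤ * (a - b) + 1ℤ * b
          other = solve-∀
          outside : ∀ a b c → c * 0ℤ ≡ 0ℤ * (a - b) + 0ℤ * b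
          outside = solve-∀
          pointwise : ∀ y (e : Dec (x ≡ y)) (m : Dec (y ∈ C)) → F x y * 𝟙 m ≡ 𝟙 e * (f 0 - f 1) + 𝟙 m * f 1
          pointwise y (yes refl) (yes _) = trans (cong (_* 1ℤ) (F-diag x)) (same (f 0) (f 1))
          pointwise y (yes refl) (no x∉C) = ⊥-elim (x∉C x∈C)
          pointwise y (no x≢y) (yes y∈C) =
            trans (cong (λ i → f i * 1ℤ) (adj⇒d≡1 (clique x x∈C y y∈C x≢y))) (other (f 0) (f 1))
          pointwise y (no _) (no _) = outside (f 0) (f 1) (F x y)

        -- By `image-norm` this is χᵀFχ up to a factor. As `image χ` is constant on the clique and f
        -- 1 / f 0 = -t / B, nonnegativity of the norm becomes Delsarte's bound N ≤ 1 + β.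
        norm : B * sum (λ y → image χ y * image χ y) ≡ M x₀ * N * (B - t * (N - 1ℤ))
        norm = <-cancelˡ 0<f₀ (begin
          f 0 * (B * sum (λ y → image χ y * image χ y)) ≡⟨ lemma₁ (f 0) B _ ⟩
          B * (f 0 * sum (λ y → image χ y * image χ y)) ≡⟨ cong (B *_) (image-norm χ x₀) ⟩
          B * (M x₀ * sum (λ y → χ y * image χ y))
            ≡⟨ cong (λ u → B * (M x₀ * u)) (trans (sum-cong-≗ (λ y → pointwise y (y ∈? C)))
                 (sym (*-distribʳ-sum (f 0 + (N - 1ℤ) * f 1) χ))) ⟩
          B * (M x₀ * (N * (f 0 + (N - 1ℤ) * f 1))) ≡⟨ lemma₂ B (M x₀) N (f 0) (f 1) ⟩
          M x₀ * N * (B * f 0 + (N - 1ℤ) * (B * f 1)) ≡⟨ cong (λ u → M x₀ * N * (B * f 0 + (N - 1ℤ) * u)) B*f₁ ⟩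
          M x₀ * N * (B * f 0 + (N - 1ℤ) * - (t * f 0)) ≡⟨ lemma₃ (M x₀) N B t (f 0) ⟩
          f 0 * (M x₀ * N * (B - t * (N - 1ℤ))) ∎)
          where
          open ≡-Reasoning
          B*f₁ : B * f 1 ≡ - (t * f 0)
          B*f₁ = trans (cong (_* f 1) (sym q₀≡B)) (trans (f-suc 0 0<diameter) (cong (λ u → - (u * f 0)) p₀≡t))
          pointwise : ∀ y (m : Dec (y ∈ C)) → 𝟙 m * image χ y ≡ 𝟙 m * (f 0 + (N - 1ℤ) * f 1)
          pointwise y (yes y∈C) = cong (1ℤ *_) (image-on-clique y∈C)
          pointwise y (no _) = refl
          lemma₁ : ∀ a b c → a * (b * c) ≡ b * (a * c)
          lemma₁ = solve-∀
          lemma₂ : ∀ B M N a b → B * (M * (N * (a + (N - 1ℤ) * b))) ≡ M * N * (B * a + (N - 1ℤ) * (B * b))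
          lemma₂ = solve-∀
          lemma₃ : ∀ M N B t a → M * N * (B * a + (N - 1ℤ) * - (t * a)) ≡ a * (M * N * (B - t * (N - 1ℤ)))
          lemma₃ = solve-∀

        clique-bound : 0ℤ ≤ B - t * (N - 1ℤ)
        clique-bound = *-cancelˡ-≤ (0<* (0<M x₀) 0<N) (subst₂ _≤_ (sym (*-zeroʳ (M x₀ * N))) norm
          (0≤* (<⇒≤ 0<B) (0≤sum λ y → 0≤square (image χ y))))

        module Tight (tight : B - t * (N - 1ℤ) ≡ 0ℤ) where

          image-zero : ∀ x → image χ x ≡ 0ℤ
          image-zero x = square-zero (image χ x) (sum≤0⇒≡0 (λ y → 0≤square (image χ y)) (≤-reflexive norm-zero) x)
            where
            square-zero : ∀ a → a * a ≡ 0ℤ → a ≡ 0ℤ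
            square-zero a a²≡0 with i*j≡0⇒i≡0∨j≡0 a a²≡0
            ... | inj₁ a≡0 = a≡0
            ... | inj₂ a≡0 = a≡0
            norm-zero : sum (λ y → image χ y * image χ y) ≡ 0ℤ
            norm-zero = <-cancelˡ 0<B (trans norm
              (trans (cong (M x₀ * N *_) tight) (trans (*-zeroʳ (M x₀ * N)) (sym (*-zeroʳ B)))))

          -- Tightness makes Fχ vanish. Seen from x, the clique has φ points at distance 1 and N - φ
          -- at distance 2, so φ f 1 + (N - φ) f 2 = 0. With f 2 / f 1 = -p 1 / q 1 and p 1 + q 1 =
          -- B + t = t N this gives t φ = p 1.
          neighbours : 1 ℕ.< diameter → ∀ {x y} → x ∉ C → y ∈ C → Adj x y →
            t * card (λ y → (y ∈? C) ×-dec Adj? x y) ≡ t + A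
          neighbours 1<D {x} {y₀} x∉C y₀∈C xy₀ = <-cancelˡ 0<B+t (begin
            (B + t) * (t * φ) ≡⟨ lemma₁ B t A (br 1) φ N ⟩
            t * (φ * q 1 - (N - φ) * p 1) + (t * N) * p 1 ≡⟨ cong₂ (λ u v → t * u + v * p 1) balance tN ⟩
            t * 0ℤ + (B + t) * p 1 ≡⟨ cong (λ b → t * 0ℤ + (B + t) * (t + A * b)) br-one ⟩
            t * 0ℤ + (B + t) * (t + A * 1ℤ) ≡⟨ lemma₂ t B A ⟩
            (B + t) * (t + A) ∎)
            where
            open ≡-Reasoning
            on : ∀ y → Dec (y ∈ C × Adj x y)
            on y = (y ∈? C) ×-dec Adj? x y
            φ = card on
            0<B+t : 0ℤ < B + t
            0<B+t = +-mono-< 0<B 0<t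
            tN : t * N ≡ B + t
            tN = trans (lemma t N B) (trans (cong (λ u → B + t - u) tight) (+-identityʳ (B + t)))
              where
              lemma : ∀ t N B → t * N ≡ B + t - (B - t * (N - 1ℤ))
              lemma = solve-∀
            lemma₁ : ∀ B t A b φ N → (B + t) * (t * φ) ≡ t * (φ * (B - A * b) - (N - φ) * (t + A * b)) + (t * N) * (t + A * b)
            lemma₁ = solve-∀
            lemma₂ : ∀ t B A → t * 0ℤ + (B + t) * (t + A * 1ℤ) ≡ (B + t) * (t + A)
            lemma₂ = solve-∀
            image≡ : image χ x ≡ φ * (f 1 - f 2) + N * f 2
            image≡ = begin
              sum (λ y → F x y * χ y) ≡⟨ sum-cong-≗ (λ y → pointwise y (y ∈? C) (Adj? x y)) ⟩
              sum (λ y → 𝟙 (on y) * (f 1 - f 2) + χ y * f 2) ≡⟨ ∑-distrib-+ (λ y → 𝟙 (on y) * (f 1 - f 2)) (λ y → χ y * f 2) ⟩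
              sum (λ y → 𝟙 (on y) * (f 1 - f 2)) + sum (λ y → χ y * f 2)
                ≡⟨ cong₂ _+_ (*-distribʳ-sum (f 1 - f 2) (λ y → 𝟙 (on y))) (*-distribʳ-sum (f 2) χ) ⟨
              φ * (f 1 - f 2) + N * f 2 ∎
              where
              near : ∀ a b → a * 1ℤ ≡ 1ℤ * (a - b) + 1ℤ * b
              near = solve-∀
              far : ∀ a b → b * 1ℤ ≡ 0ℤ * (a - b) + 1ℤ * b
              far = solve-∀
              off : ∀ a b c → c * 0ℤ ≡ 0ℤ * (a - b) + 0ℤ * b
              off = solve-∀
              pointwise : ∀ y (m : Dec (y ∈ C)) (a : Dec (Adj x y)) → F x y * 𝟙 m ≡ 𝟙 (m ×-dec a) * (f 1 - f 2) + 𝟙 m * f 2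
              pointwise y (yes _) (yes xy) = trans (cong (λ i → f i * 1ℤ) (adj⇒d≡1 xy)) (near (f 1) (f 2))
              -- The neighbour y₀ of x in C is adjacent to y as well, so the distance is exactly 2.
              pointwise y (yes y∈C) (no ¬xy) = trans (cong (λ i → f i * 1ℤ)
                (d≡2 (λ { refl → x∉C y∈C }) ¬xy xy₀ (clique y y∈C y₀ y₀∈C λ { refl → ¬xy xy₀ }))) (far (f 1) (f 2))
              pointwise y (no _) (yes _) = off (f 1) (f 2) (F x y)
              pointwise y (no _) (no _) = off (f 1) (f 2) (F x y)
            balance : φ * q 1 - (N - φ) * p 1 ≡ 0ℤ
            balance = ≢-cancelˡ (f≢0 1 0<diameter) (begin
              f 1 * (φ * q 1 - (N - φ) * p 1) ≡⟨ lemma₃ (f 1) φ (q 1) N (p 1) ⟩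
              q 1 * (φ * f 1) + (N - φ) * - (p 1 * f 1) ≡⟨ cong (λ u → q 1 * (φ * f 1) + (N - φ) * u) (f-suc 1 1<D) ⟨
              q 1 * (φ * f 1) + (N - φ) * (q 1 * f 2) ≡⟨ lemma₄ (q 1) φ (f 1) N (f 2) ⟩
              q 1 * (φ * (f 1 - f 2) + N * f 2) ≡⟨ cong (q 1 *_) (trans (sym image≡) (image-zero x)) ⟩
              q 1 * 0ℤ ≡⟨ *-zeroʳ (q 1) ⟩
              0ℤ ≡⟨ *-zeroʳ (f 1) ⟨
              f 1 * 0ℤ ∎)
              where
              lemma₃ : ∀ f φ q N p → f * (φ * q - (N - φ) * p) ≡ q * (φ * f) + (N - φ) * - (p * f)
              lemma₃ = solve-∀
              lemma₄ : ∀ q φ f N g → q * (φ * f) + (N - φ) * (q * g) ≡ q * (φ * (f - g) + N * g)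
              lemma₄ = solve-∀

-- Nonzero vectors in the range of a scaled projection under linear conditions.

module Deflation where

  open Sums
  open import Data.Nat using (ℕ; zero; suc)
  open import Data.Integer using (ℤ; +_; 0ℤ; 1ℤ; _+_; _-_; _*_; -_; _≤_; _<_; +<+)
  import Data.Nat.Properties as ℕ
  import Data.Integer as ℤ
  open import Data.Integer.Properties
  open import Data.Integer.Tactic.RingSolver using (solve-∀)
  open import Data.Fin using (Fin; zero; suc)
  open import Data.Product using (_×_; _,_; ∃)
  open import Data.Sum using (inj₁; inj₂)
  open import Data.Empty using (⊥-elim)
  open import Function using (_∘_)
  open import Relation.Binary.PropositionalEquality
  open import Relation.Binary.Definitions using (Tri; tri<; tri≈; tri>)

  private variable
    n m : ℕ

  _·_ : (Fin n → ℤ) → (Fin n → ℤ) → ℤ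
  u · v = sum λ i → u i * v i

  trace : (Fin n → Fin n → ℤ) → ℤ
  trace E = sum λ i → E i i

  ·-comm : ∀ (u v : Fin n → ℤ) → u · v ≡ v · u
  ·-comm u v = sum-cong-≗ λ i → *-comm (u i) (v i)

  ·-linear : ∀ a b (u v w : Fin n → ℤ) → (λ i → a * u i - b * v i) · w ≡ a * (u · w) - b * (v · w)
  ·-linear a b u v w = begin
    sum (λ i → (a * u i - b * v i) * w i) ≡⟨ sum-cong-≗ (λ i → lemma a b (u i) (v i) (w i)) ⟩
    sum (λ i → a * (u i * w i) + - b * (v i * w i)) ≡⟨ ∑-distrib-+ (λ i → a * (u i * w i)) (λ i → - b * (v i * w i)) ⟩
    sum (λ i → a * (u i * w i)) + sum (λ i → - b * (v i * w i))
      ≡⟨ cong₂ _+_ (*-distribˡ-sum a (λ i → u i * w i)) (*-distribˡ-sum (- b) (λ i → v i * w i)) ⟨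
    a * (u · w) + - b * (v · w) ≡⟨ cong (ℤ._+_ (a * (u · w))) (neg-distribˡ-* b (v · w)) ⟨
    a * (u · w) - b * (v · w) ∎
    where
    open ≡-Reasoning
    lemma : ∀ a b u v w → (a * u - b * v) * w ≡ a * (u * w) + - b * (v * w)
    lemma = solve-∀

  ·-scale : ∀ a (u v : Fin n → ℤ) → u · (λ i → a * v i) ≡ a * (u · v)
  ·-scale a u v = trans (sum-cong-≗ λ i → lemma a (u i) (v i)) (sym (*-distribˡ-sum a λ i → u i * v i))
    where
    lemma : ∀ a u v → u * (a * v) ≡ a * (u * v)
    lemma = solve-∀

  ·-self-adjoint : ∀ (E : Fin n → Fin n → ℤ) → (∀ x y → E x y ≡ E y x) → ∀ u v → (λ x → E x · u) · v ≡ u · (λ y → E y · v)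
  ·-self-adjoint E symmetric u v = begin
    sum (λ x → sum (λ y → E x y * u y) * v x) ≡⟨ sum-cong-≗ (λ x → *-distribʳ-sum (v x) (λ y → E x y * u y)) ⟩
    sum (λ x → sum (λ y → E x y * u y * v x)) ≡⟨ ∑-comm (λ x y → E x y * u y * v x) ⟩
    sum (λ y → sum (λ x → E x y * u y * v x))
      ≡⟨ sum-cong-≗ (λ y → trans (sum-cong-≗ λ x → trans (cong (λ e → e * u y * v x) (symmetric x y)) (lemma (E y x) (u y) (v x)))
                                 (sym (*-distribˡ-sum (u y) (λ x → E y x * v x)))) ⟩
    sum (λ y → u y * (E y · v)) ∎
    where
    open ≡-Reasoning
    lemma : ∀ e u v → e * u * v ≡ u * (e * v)
    lemma = solve-∀

  -- The combinations have the form in which deflation produces its columns. Both laws accept w up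
  -- to pointwise equality, since equal values do not make functions equal.
  record Subspace (n : ℕ) (P : (Fin n → ℤ) → Set) : Set where
    field
      zero-vector : ∀ {w} → (∀ i → w i ≡ 0ℤ) → P w
      combination : ∀ a b {u v w} → P u → P v → (∀ i → w i ≡ a * u i - b * v i) → P w

    linear-combination : ∀ {m} (c : Fin m → ℤ) (U : Fin m → Fin n → ℤ) → (∀ j → P (U j)) →
      ∀ {w} → (∀ i → w i ≡ sum (λ j → c j * U j i)) → P w
    linear-combination {zero} c U PU w≡ = zero-vector w≡
    linear-combination {suc m} c U PU w≡ = combination (c zero) (- 1ℤ) (PU zero)
      (linear-combination (c ∘ suc) (U ∘ suc) (PU ∘ suc) λ i → refl)
      λ i → trans (w≡ i) (lemma (c zero * U zero i) (sum λ j → c (suc j) * U (suc j) i))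
      where
      lemma : ∀ a s → a + s ≡ a - - 1ℤ * s
      lemma = solve-∀

  kernel : ∀ {P : (Fin n → ℤ) → Set} → Subspace n P → ∀ ν → Subspace n (λ u → P u × u · ν ≡ 0ℤ)
  kernel P-subspace ν = record
    { zero-vector = λ w≡0 → zero-vector w≡0 , sum-zero λ i → trans (cong (_* ν i) (w≡0 i)) (*-zeroˡ (ν i))
    ; combination = λ a b {u} {v} (Pu , u⊥) (Pv , v⊥) w≡ → combination a b Pu Pv w≡ ,
        trans (sum-cong-≗ λ i → cong (_* ν i) (w≡ i))
              (trans (·-linear a b u v ν) (trans (cong₂ (λ s t → a * s - b * t) u⊥ v⊥) (lemma a b)))
    }
    where
    open Subspace P-subspace
    lemma : ∀ a b → a * 0ℤ - b * 0ℤ ≡ 0ℤ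
    lemma = solve-∀

  -- E is scale times an orthogonal projection, of rank greater than m, onto a space of vectors
  -- satisfying P.
  record Projection (n : ℕ) (P : (Fin n → ℤ) → Set) (m : ℕ) : Set where
    field
      E         : Fin n → Fin n → ℤ
      scale     : ℤ
      0<scale   : 0ℤ < scale
      symmetric : ∀ x y → E x y ≡ E y x
      square    : ∀ x y → E x · E y ≡ scale * E x y
      column    : ∀ x → P (E x)
      rank      : + m * scale < trace E

  -- Replaces E by (νᵀEν) E - (Eν)(Eν)ᵀ, which annihilates ν and has rank smaller by one.
  deflate : ∀ {P : (Fin n → ℤ) → Set} → Subspace n P → ∀ {m} ν → Projection n P (suc m) → Projection n (λ u → P u × u · ν ≡ 0ℤ) m
  deflate {n} {P} P-subspace {m} ν π = cases (<-cmp q 0ℤ)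
    where
    open Projection π
    open Subspace P-subspace
    e : Fin n → ℤ
    e x = E x · ν
    q : ℤ
    q = e · ν
    E-e : ∀ x → E x · e ≡ scale * e x
    E-e x = begin
      E x · e ≡⟨ ·-comm (E x) e ⟩
      e · E x ≡⟨ ·-self-adjoint E symmetric ν (E x) ⟩
      ν · (λ y → E y · E x) ≡⟨ sum-cong-≗ (λ y → cong (ν y *_) (trans (square y x) (cong (scale *_) (symmetric y x)))) ⟩
      ν · (λ y → scale * E x y) ≡⟨ ·-scale scale ν (E x) ⟩
      scale * (ν · E x) ≡⟨ cong (scale *_) (·-comm ν (E x)) ⟩
      scale * e x ∎
      where open ≡-Reasoning
    norm : e · e ≡ scale * q
    norm = begin
      e · e ≡⟨ ·-self-adjoint E symmetric ν e ⟩
      ν · (λ y → E y · e) ≡⟨ sum-cong-≗ (λ y → cong (ν y *_) (E-e y)) ⟩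
      ν · (λ y → scale * e y) ≡⟨ ·-scale scale ν e ⟩
      scale * (ν · e) ≡⟨ cong (scale *_) (·-comm ν e) ⟩
      scale * q ∎
      where open ≡-Reasoning
    0≤norm : 0ℤ ≤ e · e
    0≤norm = 0≤sum λ x → 0≤square (e x)
    Pe : P e
    Pe = linear-combination ν E column λ i → sum-cong-≗ λ y → trans (*-comm (E i y) (ν y)) (cong (ν y *_) (symmetric i y))
    cases : Tri (q < 0ℤ) (q ≡ 0ℤ) (0ℤ < q) → Projection n (λ u → P u × u · ν ≡ 0ℤ) m
    cases (tri< q<0 _ _) = ⊥-elim (<⇒≱ q<0 (*-cancelˡ-≤ 0<scale
      (subst₂ _≤_ (sym (*-zeroʳ scale)) norm 0≤norm)))
    -- Here Eν has norm scale * q = 0, so all columns are already orthogonal to ν and E is kept; the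
    -- rank bound is merely weakened.
    cases (tri≈ _ q≡0 _) = record
      { E = E ; scale = scale ; 0<scale = 0<scale ; symmetric = symmetric ; square = square
      ; column = λ x → column x , square-zero (e x) (sum≤0⇒≡0 (λ y → 0≤square (e y)) (≤-reflexive e·e≡0) x)
      ; rank = <-trans (*-monoʳ-<-pos scale {{ℤ.positive 0<scale}} (+<+ (ℕ.n<1+n m))) rank
      }
      where
      e·e≡0 : e · e ≡ 0ℤ
      e·e≡0 = trans norm (trans (cong (scale *_) q≡0) (*-zeroʳ scale))
      square-zero : ∀ a → a * a ≡ 0ℤ → a ≡ 0ℤ
      square-zero a a²≡0 with i*j≡0⇒i≡0∨j≡0 a a²≡0
      ... | inj₁ a≡0 = a≡0
      ... | inj₂ a≡0 = a≡0
    -- Multiplying by q instead of dividing keeps the entries integral. The trace becomes q * trace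
    -- E - scale * q, so trace over scale drops by exactly 1.
    cases (tri> _ _ 0<q) = record
      { E = E′ ; scale = q * scale ; 0<scale = 0<* 0<q 0<scale
      ; symmetric = λ x y → cong₂ (λ u v → q * u - v) (symmetric x y) (*-comm (e x) (e y))
      ; square = square′
      ; column = λ x → combination q (e x) (column x) Pe (λ i → refl) ,
          trans (·-linear q (e x) (E x) e ν) (lemma₀ q (e x))
      ; rank = rank′
      }
      where
      E′ : Fin n → Fin n → ℤ
      E′ x y = q * E x y - e x * e y
      lemma₀ : ∀ q a → q * a - a * q ≡ 0ℤ
      lemma₀ = solve-∀
      e-E′ : ∀ y → e · E′ y ≡ 0ℤ
      e-E′ y = begin
        e · E′ y ≡⟨ ·-comm e (E′ y) ⟩
        E′ y · e ≡⟨ ·-linear q (e y) (E y) e e ⟩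
        q * (E y · e) - e y * (e · e) ≡⟨ cong₂ (λ u v → q * u - e y * v) (E-e y) norm ⟩
        q * (scale * e y) - e y * (scale * q) ≡⟨ lemma q scale (e y) ⟩
        0ℤ ∎
        where
        open ≡-Reasoning
        lemma : ∀ q s a → q * (s * a) - a * (s * q) ≡ 0ℤ
        lemma = solve-∀
      E-E′ : ∀ x y → E x · E′ y ≡ scale * E′ x y
      E-E′ x y = begin
        E x · E′ y ≡⟨ ·-comm (E x) (E′ y) ⟩
        E′ y · E x ≡⟨ ·-linear q (e y) (E y) e (E x) ⟩
        q * (E y · E x) - e y * (e · E x)
          ≡⟨ cong₂ (λ u v → q * u - e y * v) (trans (square y x) (cong (scale *_) (symmetric y x)))
                                             (trans (·-comm e (E x)) (E-e x)) ⟩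
        q * (scale * E x y) - e y * (scale * e x) ≡⟨ lemma q scale (E x y) (e x) (e y) ⟩
        scale * E′ x y ∎
        where
        open ≡-Reasoning
        lemma : ∀ q s w a b → q * (s * w) - b * (s * a) ≡ s * (q * w - a * b)
        lemma = solve-∀
      square′ : ∀ x y → E′ x · E′ y ≡ q * scale * E′ x y
      square′ x y = trans (·-linear q (e x) (E x) e (E′ y))
        (trans (cong₂ (λ u v → q * u - e x * v) (E-E′ x y) (e-E′ y)) (lemma q scale (E′ x y) (e x)))
        where
        lemma : ∀ q s w a → q * (s * w) - a * 0ℤ ≡ q * s * w
        lemma = solve-∀
      trace′ : trace E′ ≡ q * trace E - scale * q
      trace′ = begin
        sum (λ x → q * E x x - e x * e x) ≡⟨ sum-cong-≗ (λ x → lemma (q * E x x) (e x)) ⟩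
        sum (λ x → q * E x x + - 1ℤ * (e x * e x)) ≡⟨ ∑-distrib-+ (λ x → q * E x x) (λ x → - 1ℤ * (e x * e x)) ⟩
        sum (λ x → q * E x x) + sum (λ x → - 1ℤ * (e x * e x))
          ≡⟨ cong₂ _+_ (*-distribˡ-sum q (λ x → E x x)) (*-distribˡ-sum (- 1ℤ) (λ x → e x * e x)) ⟨
        q * trace E + - 1ℤ * (e · e) ≡⟨ cong (λ u → q * trace E + - 1ℤ * u) norm ⟩
        q * trace E + - 1ℤ * (scale * q) ≡⟨ lemma′ (q * trace E) (scale * q) ⟩
        q * trace E - scale * q ∎
        where
        open ≡-Reasoning
        lemma : ∀ a b → a - b * b ≡ a + - 1ℤ * (b * b)
        lemma = solve-∀
        lemma′ : ∀ a b → a + - 1ℤ * b ≡ a - b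
        lemma′ = solve-∀
      rank′ : + m * (q * scale) < trace E′
      rank′ = subst₂ _<_ (lemma (+ m) q scale) (sym trace′)
        (+-monoˡ-< (- (scale * q)) (*-monoˡ-<-pos q {{ℤ.positive 0<q}} rank))
        where
        lemma : ∀ m q s → q * ((1ℤ + m) * s) + - (s * q) ≡ m * (q * s)
        lemma = solve-∀

  -- After one deflation per condition the trace is still positive, and the column through a
  -- positive diagonal entry is nonzero.
  nonzero-in-kernel : ∀ {P : (Fin n → ℤ) → Set} → Subspace n P → ∀ {m} (ν : Fin m → Fin n → ℤ) → Projection n P m →
    ∃ λ u → P u × (∀ j → u · ν j ≡ 0ℤ) × ∃ λ x → u x ≢ 0ℤ
  nonzero-in-kernel P-subspace {zero} ν π =
    let x , 0<Exx = sum>0⇒∃>0 (λ x → E x x) (subst (_< trace E) (*-zeroˡ scale) rank)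
    in E x , column x , (λ ()) , x , ≢-sym (<⇒≢ 0<Exx)
    where open Projection π
  nonzero-in-kernel P-subspace {suc m} ν π =
    let u , (Pu , u⊥ν₀) , u⊥ν , nonzero = nonzero-in-kernel (kernel P-subspace (ν zero)) (ν ∘ suc) (deflate P-subspace (ν zero) π)
    in u , Pu , (λ { zero → u⊥ν₀ ; (suc j) → u⊥ν j }) , nonzero

-- The partial linear space of lines and its incidence matrix.

module Geometry where

  open import Defs
  open Sums
  open Metsch
  open Distance
  open import Data.Nat using (ℕ; zero; suc; z≤n)
  import Data.Nat as ℕ
  import Data.Nat.Properties as ℕ
  open import Data.Integer using (ℤ; +_; 0ℤ; 1ℤ; _+_; _-_; _*_; -_; _≤_; +≤+)
  import Data.Integer as ℤ
  open import Data.Integer.Properties hiding (_≟_)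
  open import Data.Integer.Tactic.RingSolver using (solve-∀)
  open import Data.Fin using (Fin; zero; suc)
  open import Data.Fin.Properties using (_≟_; any?)
  open import Data.Fin.Subset using (Subset; inside; outside; _∈_; _∉_)
  open import Data.Fin.Subset.Properties using (_∈?_)
  open import Data.List using (List; []; _∷_; map; filter; length; lookup; allFin; cartesianProduct)
  import Data.List.Extrema.Nat as Extrema
  import Data.List.Membership.Propositional as List
  open import Data.List.Membership.Propositional.Properties using (∈-map⁺; ∈-map⁻; ∈-++⁺ˡ; ∈-++⁺ʳ; ∈-filter⁺; ∈-lookup)
  open import Data.List.Relation.Unary.All using ([]; _∷_)
  import Data.List.Relation.Unary.All as All
  import Data.List.Relation.Unary.All.Properties as All
  open import Data.List.Relation.Unary.Any using (here; index)
  open import Data.List.Relation.Unary.Any.Properties using (lookup-index)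
  open import Data.List.Relation.Unary.AllPairs using ([]; _∷_)
  open import Data.List.Relation.Unary.Unique.Propositional using (Unique)
  import Data.List.Relation.Unary.Unique.Propositional.Properties as Unique
  import Data.Vec as Vec
  import Data.Vec.Properties as Vec
  open import Data.Empty using (⊥-elim)
  open import Data.Product using (_×_; _,_; ∃; proj₁; proj₂)
  open import Function using (_∘_; mk⇔)
  open import Level using (0ℓ)
  open import Relation.Nullary using (¬_; Dec; yes; no; ¬?; _×-dec_)
  open import Relation.Unary using (Decidable; Pred)
  open import Relation.Binary.PropositionalEquality

  allSubsets-complete : ∀ {n} (S : Subset n) → S List.∈ allSubsets n
  allSubsets-complete Vec.[] = here refl
  allSubsets-complete (inside Vec.∷ S) = ∈-++⁺ˡ (∈-map⁺ (inside Vec.∷_) (allSubsets-complete S))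
  allSubsets-complete {suc n} (outside Vec.∷ S) =
    ∈-++⁺ʳ (map (inside Vec.∷_) (allSubsets n)) (∈-map⁺ (outside Vec.∷_) (allSubsets-complete S))

  allSubsets-unique : ∀ n → Unique (allSubsets n)
  allSubsets-unique zero = [] ∷ []
  allSubsets-unique (suc n) = Unique.++⁺ (Unique.map⁺ Vec.∷-injectiveʳ (allSubsets-unique n)) (Unique.map⁺ Vec.∷-injectiveʳ (allSubsets-unique n))
    λ (∈ins , ∈out) → disjoint (proj₂ (proj₂ (∈-map⁻ _ ∈ins))) (proj₂ (proj₂ (∈-map⁻ _ ∈out)))
    where
    disjoint : ∀ {S T : Subset n} {V} → V ≡ inside Vec.∷ S → ¬ V ≡ outside Vec.∷ T
    disjoint refl ()

  -- The incidence structure names lines by their positions in a list; without repetitions, equal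
  -- point sets mean equal lines.
  lookup-injective : ∀ {A : Set} {xs : List A} → Unique xs → ∀ i j → lookup xs i ≡ lookup xs j → i ≡ j
  lookup-injective (_ ∷ _) zero zero _ = refl
  lookup-injective {xs = x ∷ xs} (x∉ ∷ _) zero (suc j) e = ⊥-elim (All.lookup x∉ (∈-lookup j) e)
  lookup-injective {xs = x ∷ xs} (x∉ ∷ _) (suc i) zero e = ⊥-elim (All.lookup x∉ (∈-lookup i) (sym e))
  lookup-injective (_ ∷ unique) (suc i) (suc j) e = cong suc (lookup-injective unique i j e)

  length-filter-lookup : ∀ {A : Set} {P : Pred A 0ℓ} (P? : Decidable P) xs → + length (filter P? xs) ≡ card (λ j → P? (lookup xs j))
  length-filter-lookup P? [] = refl
  length-filter-lookup P? (x ∷ xs) with P? x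
  ... | yes _ = cong (ℤ._+_ 1ℤ) (length-filter-lookup P? xs)
  ... | no _ = trans (length-filter-lookup P? xs) (sym (+-identityˡ _))

  module Lines {n : ℕ} (Γ : DistanceRegularGraph n) (s : ℕ)
    (2≤s : 2 ℕ.≤ s)
    (1≤c₂ : 1 ℕ.≤ DistanceRegularGraph.intc Γ 2)
    (a-large : (+ 2 * + s - 1ℤ) * (+ DistanceRegularGraph.intc Γ 2 - 1ℤ) ≤ DistanceRegularGraph.inta Γ 1)
    (κ-small : + 2 * + DistanceRegularGraph.valency Γ + 1ℤ ≤
       (+ s + 1ℤ) * (+ 2 * (DistanceRegularGraph.inta Γ 1 + 1ℤ) - + s * (+ DistanceRegularGraph.intc Γ 2 - 1ℤ)))
    where
    open DistanceRegularGraph Γ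
    open DistanceFunction Γ using (degree; adj-count; nonadj-count)
    module Combinatorics = Claws graph (inta 1) (+ intc 2) s adj-count nonadj-count (+≤+ 1≤c₂) a-large
    open Combinatorics using (Line; clique-adj; adj⇒≢)
    open Combinatorics.Degree (+ valency) degree κ-small using (line-through; lines-through-≤)

    lineList : List (Subset n)
    lineList = lines Γ (+ intc 2) (+ s)

    L : ℕ
    L = length lineList

    line : Fin L → Subset n
    line = lookup lineList

    line-isLine : ∀ j → Line (line j)
    line-isLine j = All.lookup (All.all-filter (IsLine? Γ (+ intc 2) (+ s)) (allSubsets n)) (∈-lookup j)

    isLine-index : ∀ {S} → Line S → ∃ λ j → S ≡ line j
    isLine-index {S} isLine = index S∈ , lookup-index S∈
      where
      S∈ : S List.∈ lineList
      S∈ = ∈-filter⁺ (IsLine? Γ (+ intc 2) (+ s)) (allSubsets-complete S) isLine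

    lineList-unique : Unique lineList
    lineList-unique = Unique.filter⁺ (IsLine? Γ (+ intc 2) (+ s)) (allSubsets-unique n)

    line-index-≡ : ∀ x y j k → x ≢ y → x ∈ line j → y ∈ line j → x ∈ line k → y ∈ line k → j ≡ k
    line-index-≡ x y j k x≢y xj yj xk yk = lookup-injective lineList-unique j k
      (Combinatorics.line-≡ (line-isLine j) (line-isLine k) x≢y xj yj xk yk)

    joining-line : ∀ {x y} → Adj x y → ∃ λ j → x ∈ line j × y ∈ line j
    joining-line xy with line-through xy
    ... | S , isLine , x∈S , y∈S with isLine-index isLine
    ...   | j , refl = j , x∈S , y∈S

    collinear-adj : ∀ {x y j} → x ≢ y → x ∈ line j → y ∈ line j → Adj x y
    collinear-adj {j = j} x≢y xj yj = clique-adj (line-isLine j) xj yj x≢y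

    line-count : Fin n → ℤ
    line-count x = card (λ j → x ∈? line j)

    line-count≤s : ∀ x → line-count x ≤ + s
    line-count≤s x = subst (_≤ + s) (length-filter-lookup (x ∈?_) lineList)
      (+≤+ (lines-through-≤ x through
        (All.zip (All.filter⁺ (x ∈?_) (All.all-filter (IsLine? Γ (+ intc 2) (+ s)) (allSubsets n)) , All.all-filter (x ∈?_) lineList))
        (Unique.filter⁺ (x ∈?_) lineList-unique)))
      where
      through : List (Subset n)
      through = filter (x ∈?_) lineList

    space : IncidenceStructure n L
    space = cliqueSpace Γ (+ intc 2) (+ s)

    collinearPoints≤c₂ : ∀ x j → x ∉ line j → collinearPoints space x j ℕ.≤ intc 2
    collinearPoints≤c₂ x j x∉j = drop‿+≤+ (begin
      + collinearPoints space x j ≡⟨ +#≡card collinear? ⟩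
      card collinear? ≤⟨ card-mono collinear? (λ y → (y ∈? line j) ×-dec Adj? x y)
        (λ (y∈j , x≢y , k , xk , yk) → y∈j , collinear-adj x≢y xk yk) ⟩
      card (λ y → (y ∈? line j) ×-dec Adj? x y) ≤⟨ Combinatorics.neighbours-on-line (line-isLine j) x∉j ⟩
      + intc 2 ∎)
      where
      open ≤-Reasoning
      collinear? : Decidable λ y → y ∈ line j × Graph.Adj (pointGraph space) x y
      collinear? y = (y ∈? line j) ×-dec Graph.Adj? (pointGraph space) x y

    hasSPLS : HasSPLS Γ (+ s)
    hasSPLS = record
      { c≥1 = +≤+ 1≤c₂
      ; s≥2 = +≤+ 2≤s
      ; partialLinear = line-index-≡
      ; isPointGraph = λ x y → mk⇔ (λ xy → adj⇒≢ xy , joining-line xy) λ (x≢y , j , xj , yj) → collinear-adj x≢y xj yj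
      ; a₁-bound = a-large
      ; lines≤s = λ x → subst (_≤ + s) (sym (+#≡card (λ j → x ∈? line j))) (line-count≤s x)
      ; τ≤c = +≤+ (Extrema.max≤v⁺ z≤n (All.map⁺ (All.map (λ {(x , j)} x∉j → collinearPoints≤c₂ x j x∉j)
                (All.all-filter (λ (x , j) → ¬? (x ∈? line j)) (cartesianProduct (allFin n) (allFin L))))))
      }

    N : Fin n → Fin L → ℤ
    N x j = 𝟙 (x ∈? line j)

    -- Adjacent vertices share exactly one line, distinct nonadjacent ones none.
    N-products : ∀ x y → sum (λ j → N x j * N y j) ≡ 𝟙 (x ≟ y) * line-count x + 𝟙 (Adj? x y)
    N-products x y = products (x ≟ y) (Adj? x y)
      where
      idempotent : ∀ {P : Set} (d : Dec P) → 𝟙 d * 𝟙 d ≡ 𝟙 d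
      idempotent (yes _) = refl
      idempotent (no _) = refl
      products : (e : Dec (x ≡ y)) (a : Dec (Adj x y)) → sum (λ j → N x j * N y j) ≡ 𝟙 e * line-count x + 𝟙 a
      products (yes refl) (yes xx) = ⊥-elim (Adj-irrefl xx)
      products (yes refl) (no _) = trans (sum-cong-≗ λ j → idempotent (x ∈? line j))
        (sym (trans (+-identityʳ _) (*-identityˡ (line-count x))))
      products (no x≢y) (no ¬xy) = sum-zero λ j → vanish j (x ∈? line j) (y ∈? line j)
        where
        vanish : ∀ j (p : Dec (x ∈ line j)) (q : Dec (y ∈ line j)) → 𝟙 p * 𝟙 q ≡ 0ℤ
        vanish j (yes xj) (yes yj) = ⊥-elim (¬xy (collinear-adj x≢y xj yj))
        vanish j (yes _) (no _) = refl
        vanish j (no _) (yes _) = refl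
        vanish j (no _) (no _) = refl
      products (no x≢y) (yes xy) = trans (sum-cong-≗ λ j → trans (sym (𝟙-× (x ∈? line j) (y ∈? line j)))
          (𝟙-cong ((x ∈? line j) ×-dec (y ∈? line j)) (j₀ ≟ j)
            (λ (xj , yj) → line-index-≡ x y j₀ j x≢y xj₀ yj₀ xj yj) λ { refl → xj₀ , yj₀ }))
        (card-≡ j₀)
        where
        j₀ = proj₁ (joining-line xy)
        xj₀ = proj₁ (proj₂ (joining-line xy))
        yj₀ = proj₂ (proj₂ (joining-line xy))

    -- Double counting with `N-products`. It is applied to an eigenvector, to the constant 1 and to
    -- indicator functions.
    sum-over-pencil : ∀ (w : Fin n → ℤ) x →
      sum (λ j → N x j * sum (λ y → N y j * w y)) ≡ line-count x * w x + sum (λ y → 𝟙 (Adj? x y) * w y)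
    sum-over-pencil w x = begin
      sum (λ j → N x j * sum (λ y → N y j * w y)) ≡⟨ sum-cong-≗ (λ j → *-distribˡ-sum (N x j) (λ y → N y j * w y)) ⟩
      sum (λ j → sum (λ y → N x j * (N y j * w y))) ≡⟨ ∑-comm (λ j y → N x j * (N y j * w y)) ⟩
      sum (λ y → sum (λ j → N x j * (N y j * w y)))
        ≡⟨ sum-cong-≗ (λ y → trans (sum-cong-≗ λ j → sym (*-assoc (N x j) (N y j) (w y)))
             (trans (sym (*-distribʳ-sum (w y) (λ j → N x j * N y j))) (cong (_* w y) (N-products x y)))) ⟩
      sum (λ y → (𝟙 (x ≟ y) * line-count x + 𝟙 (Adj? x y)) * w y)
        ≡⟨ sum-cong-≗ (λ y → lemma (𝟙 (x ≟ y)) (line-count x) (𝟙 (Adj? x y)) (w y)) ⟩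
      sum (λ y → 𝟙 (x ≟ y) * (line-count x * w y) + 𝟙 (Adj? x y) * w y)
        ≡⟨ ∑-distrib-+ (λ y → 𝟙 (x ≟ y) * (line-count x * w y)) (λ y → 𝟙 (Adj? x y) * w y) ⟩
      sum (λ y → 𝟙 (x ≟ y) * (line-count x * w y)) + sum (λ y → 𝟙 (Adj? x y) * w y)
        ≡⟨ cong (λ u → u + sum (λ y → 𝟙 (Adj? x y) * w y)) (sum-δ x (λ y → line-count x * w y)) ⟩
      line-count x * w x + sum (λ y → 𝟙 (Adj? x y) * w y) ∎
      where
      open ≡-Reasoning
      lemma : ∀ e m a w → (e * m + a) * w ≡ e * (m * w) + a * w
      lemma = solve-∀

    -- Incidences are counted from both sides: at least m on each line, at most s at each vertex.
    lines-few : ∀ {m} → m ≤ inta 1 + + 2 - (+ intc 2 - 1ℤ) * (+ s - 1ℤ) → + L * m ≤ + n * + s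
    lines-few {m} m≤size = begin
      + L * m ≡⟨ sum-const L m ⟨
      sum {L} (λ _ → m) ≤⟨ sum-mono (λ j → ≤-trans m≤size (≤-trans (proj₂ (line-isLine j)) (≤-reflexive (+∣∣≡card (line j))))) ⟩
      sum (λ j → sum (λ x → N x j)) ≡⟨ ∑-comm (λ j x → N x j) ⟩
      sum (λ x → line-count x) ≤⟨ sum-mono line-count≤s ⟩
      sum {n} (λ _ → + s) ≡⟨ sum-const n (+ s) ⟩
      + n * + s ∎
      where open ≤-Reasoning

    -- Each of the φ neighbours of x on line k determines a line through x, on which y in turn has φ
    -- neighbours.
    common-neighbours-≥ : ∀ {x y k} φ → 0ℤ ≤ φ → x ∉ line k → y ∈ line k → ¬ Adj x y → x ≢ y →
      card (λ w → (w ∈? line k) ×-dec Adj? x w) ≡ φ →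
      (∀ {j w} → x ∈ line j → y ∉ line j → w ∈ line j → Adj y w → card (λ v → (v ∈? line j) ×-dec Adj? y v) ≡ φ) →
      φ * φ ≤ card (λ v → Adj? x v ×-dec Adj? y v)
    common-neighbours-≥ {x} {y} {k} φ 0≤φ x∉k y∈k ¬xy x≢y on-k on-j = begin
      φ * φ ≡⟨ cong (φ *_) on-k ⟨
      φ * card (λ w → (w ∈? line k) ×-dec Adj? x w)
        ≡⟨ cong (φ *_) (trans (sum-cong-≗ λ w → trans (𝟙-cong ((w ∈? line k) ×-dec Adj? x w) (Adj? x w ×-dec (w ∈? line k))
              (λ (p , q) → q , p) (λ (p , q) → q , p)) (𝟙-× (Adj? x w) (w ∈? line k)))
            (pencil-sum (λ w → 𝟙 (w ∈? line k)) (𝟙-no (x ∈? line k) x∉k))) ⟩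
      φ * sum (λ j → N x j * sum (λ w → N w j * N w k)) ≡⟨ *-distribˡ-sum φ (λ j → N x j * sum (λ w → N w j * N w k)) ⟩
      sum (λ j → φ * (N x j * sum (λ w → N w j * N w k))) ≤⟨ sum-mono (λ j → per-line j (x ∈? line j)) ⟩
      sum (λ j → N x j * sum (λ v → N v j * 𝟙 (Adj? y v)))
        ≡⟨ pencil-sum (λ v → 𝟙 (Adj? y v)) (𝟙-no (Adj? y x) (¬xy ∘ Adj-sym)) ⟨
      sum (λ v → 𝟙 (Adj? x v) * 𝟙 (Adj? y v)) ≡⟨ sum-cong-≗ (λ v → sym (𝟙-× (Adj? x v) (Adj? y v))) ⟩
      card (λ v → Adj? x v ×-dec Adj? y v) ∎
      where
      open ≤-Reasoning
      pencil-sum : ∀ w → w x ≡ 0ℤ → sum (λ y → 𝟙 (Adj? x y) * w y) ≡ sum (λ j → N x j * sum (λ y → N y j * w y))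
      pencil-sum w wx≡0 = sym (trans (sum-over-pencil w x)
        (trans (cong (λ u → u + sum (λ y → 𝟙 (Adj? x y) * w y)) (trans (cong (line-count x *_) wx≡0) (*-zeroʳ (line-count x)))) (+-identityˡ _)))
      meet-count : ∀ j → sum (λ w → N w j * N w k) ≡ card (λ w → (w ∈? line j) ×-dec (w ∈? line k))
      meet-count j = sum-cong-≗ λ w → sym (𝟙-× (w ∈? line j) (w ∈? line k))
      per-line : ∀ j (p : Dec (x ∈ line j)) → φ * (𝟙 p * sum (λ w → N w j * N w k)) ≤ 𝟙 p * sum (λ v → N v j * 𝟙 (Adj? y v))
      per-line j (no _) = ≤-reflexive (*-zeroʳ φ)
      per-line j (yes x∈j) = subst₂ _≤_ (cong (λ u → φ * (1ℤ * u)) (sym (meet-count j)))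
        (trans (sum-cong-≗ λ v → 𝟙-× (v ∈? line j) (Adj? y v)) (sym (*-identityˡ (sum (λ v → N v j * 𝟙 (Adj? y v))))))
        (meeting (any? λ w → (w ∈? line j) ×-dec (w ∈? line k)))
        where
        meeting : Dec (∃ λ w → w ∈ line j × w ∈ line k) →
          φ * (1ℤ * card (λ w → (w ∈? line j) ×-dec (w ∈? line k))) ≤ card (λ v → (v ∈? line j) ×-dec Adj? y v)
        meeting (no none) = ≤-trans
          (≤-reflexive (trans (cong (λ u → φ * (1ℤ * u)) (card-zero (λ w → (w ∈? line j) ×-dec (w ∈? line k)) λ w m → none (w , m))) (*-zeroʳ φ)))
          (0≤card (λ v → (v ∈? line j) ×-dec Adj? y v))
        -- As x lies on line j but not on line k, the two lines meet only in w, so the left side is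
        -- at most φ.
        meeting (yes (w , w∈j , w∈k)) = begin
          φ * (1ℤ * card (λ v → (v ∈? line j) ×-dec (v ∈? line k)))
            ≤⟨ *-monoˡ-≤-nonNeg φ {{ℤ.nonNegative 0≤φ}} (*-monoˡ-≤-nonNeg 1ℤ (≤-trans
                 (card-mono (λ v → (v ∈? line j) ×-dec (v ∈? line k)) (w ≟_) single) (≤-reflexive (card-≡ w)))) ⟩
          φ * (1ℤ * 1ℤ) ≡⟨ *-identityʳ φ ⟩
          φ ≡⟨ on-j x∈j y∉j w∈j (collinear-adj (λ { refl → y∉j w∈j }) y∈k w∈k) ⟨
          card (λ v → (v ∈? line j) ×-dec Adj? y v) ∎
          where
          y∉j : y ∉ line j
          y∉j y∈j = ¬xy (collinear-adj x≢y x∈j y∈j)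
          single : ∀ {v} → v ∈ line j × v ∈ line k → w ≡ v
          single {v} (v∈j , v∈k) with w ≟ v
          ... | yes w≡v = w≡v
          ... | no w≢v = ⊥-elim (x∉k (subst (λ i → x ∈ line i) (line-index-≡ w v j k w≢v w∈j v∈j w∈k v∈k) x∈j))

-- Multiplicity of -r, tight lines and the integrality of α.

module Integrality where

  open import Defs
  open Sums
  open Distance
  open Spectral
  open Deflation
  open Geometry
  open import Data.Nat using (ℕ; suc; z≤n; s≤s)
  import Data.Nat as ℕ
  import Data.Nat.Properties as ℕ
  open import Data.Integer using (ℤ; +_; 0ℤ; 1ℤ; _+_; _-_; _*_; -_; _≤_; _<_; +≤+; +<+)
  import Data.Integer as ℤ
  open import Data.Integer.Properties hiding (_≟_)
  open import Data.Integer.Tactic.RingSolver using (solve-∀)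
  open import Data.Fin using (Fin; suc)
  open import Data.Fin.Properties using (_≟_; any?)
  open import Data.Fin.Subset using (_∈_; _∉_)
  open import Data.Fin.Subset.Properties using (_∈?_)
  open import Data.Empty using (⊥-elim)
  open import Data.Product using (_×_; _,_; ∃; proj₁)
  open import Relation.Nullary using (¬_; Dec; yes; no; ¬?; _×-dec_)
  open import Relation.Nullary.Decidable using (decidable-stable)
  open import Relation.Binary.PropositionalEquality

  module _ {n : ℕ} (Γ : DistanceRegularGraph n) (t A B : ℤ) (br : ℕ → ℤ)
    (parameters : Eigenspace.Parameters Γ t A B br)
    (s : ℕ) (2≤s : 2 ℕ.≤ s)
    (1≤c₂ : 1 ℕ.≤ DistanceRegularGraph.intc Γ 2)
    (a-large : (+ 2 * + s - 1ℤ) * (+ DistanceRegularGraph.intc Γ 2 - 1ℤ) ≤ DistanceRegularGraph.inta Γ 1)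
    (κ-small : + 2 * + DistanceRegularGraph.valency Γ + 1ℤ ≤
       (+ s + 1ℤ) * (+ 2 * (DistanceRegularGraph.inta Γ 1 + 1ℤ) - + s * (+ DistanceRegularGraph.intc Γ 2 - 1ℤ)))
    (lines-large : + 2 * + s + 1ℤ ≤ DistanceRegularGraph.inta Γ 1 + + 2 - (+ DistanceRegularGraph.intc Γ 2 - 1ℤ) * (+ s - 1ℤ))
    (halving : ∀ i → i ℕ.< DistanceRegularGraph.diameter Γ →
      + 2 * (Eigenspace.p Γ t A B br i * (Eigenspace.r Γ t A B br - br i)) ≤ Eigenspace.q Γ t A B br i * br (suc i))
    (1<diameter : 1 ℕ.< DistanceRegularGraph.diameter Γ)
    where
    open DistanceRegularGraph Γ
    open DistanceFunction Γ
    open Lines Γ s 2≤s 1≤c₂ a-large κ-small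
    open Eigenspace Γ t A B br
    open Parameters parameters
    open Theory parameters

    x₀ : Fin n
    x₀ = proj₁ diameter-attained

    eigenspace : Subspace n Eigenvector
    eigenspace = record
      { zero-vector = λ {w} w≡0 z → trans (sum-zero λ y → trans (cong (𝟙 (Adj? z y) *_) (w≡0 y)) (*-zeroʳ (𝟙 (Adj? z y))))
          (sym (cong -_ (trans (cong (r *_) (w≡0 z)) (*-zeroʳ r))))
      ; combination = λ a b {u} {v} {w} eu ev w≡ z → begin
          sum (λ y → 𝟙 (Adj? z y) * w y)
            ≡⟨ sum-cong-≗ (λ y → trans (cong (𝟙 (Adj? z y) *_) (w≡ y)) (lemma₁ (𝟙 (Adj? z y)) a b (u y) (v y))) ⟩
          sum (λ y → a * (𝟙 (Adj? z y) * u y) + - b * (𝟙 (Adj? z y) * v y))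
            ≡⟨ ∑-distrib-+ (λ y → a * (𝟙 (Adj? z y) * u y)) (λ y → - b * (𝟙 (Adj? z y) * v y)) ⟩
          sum (λ y → a * (𝟙 (Adj? z y) * u y)) + sum (λ y → - b * (𝟙 (Adj? z y) * v y))
            ≡⟨ cong₂ _+_ (*-distribˡ-sum a (λ y → 𝟙 (Adj? z y) * u y)) (*-distribˡ-sum (- b) (λ y → 𝟙 (Adj? z y) * v y)) ⟨
          a * sum (λ y → 𝟙 (Adj? z y) * u y) + - b * sum (λ y → 𝟙 (Adj? z y) * v y)
            ≡⟨ cong₂ (λ p q → a * p + - b * q) (eu z) (ev z) ⟩
          a * - (r * u z) + - b * - (r * v z) ≡⟨ lemma₂ a b r (u z) (v z) ⟩
          - (r * (a * u z - b * v z)) ≡⟨ cong (λ p → - (r * p)) (w≡ z) ⟨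
          - (r * w z) ∎
      }
      where
      open ≡-Reasoning
      lemma₁ : ∀ e a b u v → e * (a * u - b * v) ≡ a * (e * u) + - b * (e * v)
      lemma₁ = solve-∀
      lemma₂ : ∀ a b r u v → a * - (r * u) + - b * - (r * v) ≡ - (r * (a * u - b * v))
      lemma₂ = solve-∀

    0<n : 0ℤ < + n
    0<n = +<+ (ℕ.≤-trans (s≤s z≤n) (Data.Fin.Properties.toℕ<n x₀))

    -- By `lines-few` with m = 2s + 1, 2L (2s + 1) ≤ 2s n, which is less than (2s + 1) n.
    2L<n : + 2 * + L < + n
    2L<n = ≰⇒> λ n≤2L → <⇒≱ 0<n (≤-by _
      (0≤+ (0≤* {+ 2} (+≤+ z≤n) (0≤- (lines-few lines-large)))
           (0≤* (0≤+ (0≤* {+ 2} {+ s} (+≤+ z≤n) (+≤+ z≤n)) (+≤+ z≤n)) (0≤- n≤2L))) (lemma (+ n) (+ L) (+ s)))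
      where
      lemma : ∀ n L s → 0ℤ ≡ n + (+ 2 * (n * s - L * (+ 2 * s + 1ℤ)) + (+ 2 * s + 1ℤ) * (+ 2 * L - n))
      lemma = solve-∀

    projection : Projection n Eigenvector L
    projection = record
      { E = λ x y → f 0 * F x y
      ; scale = M x₀
      ; 0<scale = 0<M x₀
      ; symmetric = λ x y → cong (f 0 *_) (F-sym x y)
      ; square = λ x y → begin
          sum (λ z → f 0 * F x z * (f 0 * F y z)) ≡⟨ sum-cong-≗ (λ z → lemma₁ (f 0) (F x z) (F y z)) ⟩
          sum (λ z → f 0 * (f 0 * (F x z * F y z))) ≡⟨ *-distribˡ-sum (f 0) (λ z → f 0 * (F x z * F y z)) ⟨
          f 0 * sum (λ z → f 0 * (F x z * F y z)) ≡⟨ cong (f 0 *_) (*-distribˡ-sum (f 0) (λ z → F x z * F y z)) ⟨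
          f 0 * (f 0 * sum (λ z → F x z * F y z)) ≡⟨ cong (f 0 *_) (F-scales (F y) (F-eigenvector y) x) ⟩
          f 0 * (M x * F y x) ≡⟨ cong₂ (λ u v → f 0 * (u * v)) (M-constant x x₀) (F-sym y x) ⟩
          f 0 * (M x₀ * F x y) ≡⟨ lemma₂ (f 0) (M x₀) (F x y) ⟩
          M x₀ * (f 0 * F x y) ∎
      ; column = λ x z → trans
          (trans (sum-cong-≗ λ y → lemma₂ (𝟙 (Adj? z y)) (f 0) (F x y))
            (trans (sym (*-distribˡ-sum (f 0) (λ y → 𝟙 (Adj? z y) * F x y))) (cong (f 0 *_) (F-eigenvector x z))))
          (lemma₃ (f 0) r (F x z))
      -- The trace n f(0)² exceeds L M because M ≤ 2 f(0)² and 2L < n.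
      ; rank = subst (+ L * M x₀ <_)
          (sym (trans (sum-cong-≗ λ x → cong (f 0 *_) (F-diag x)) (sum-const n (f 0 * f 0))))
          (≤-<-trans (≤-trans (*-monoˡ-≤-nonNeg (+ L) (M≤2f₀² halving x₀)) (≤-reflexive (lemma₄ (+ L) (f 0 * f 0))))
                     (*-monoʳ-<-pos (f 0 * f 0) {{ℤ.positive (0<* 0<f₀ 0<f₀)}} 2L<n))
      }
      where
      open ≡-Reasoning
      lemma₁ : ∀ a u v → a * u * (a * v) ≡ a * (a * (u * v))
      lemma₁ = solve-∀
      lemma₂ : ∀ a u v → a * (u * v) ≡ u * (a * v)
      lemma₂ = solve-∀
      lemma₃ : ∀ a r v → a * - (r * v) ≡ - (r * (a * v))
      lemma₃ = solve-∀
      lemma₄ : ∀ L a → L * (+ 2 * a) ≡ + 2 * L * a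
      lemma₄ = solve-∀

    0<r : ∀ D → 0 ℕ.< D → 0ℤ < br D
    0<r (suc D) _ = 0<br D

    Integral : Set
    Integral = ∃ λ φ → t * φ ≡ t + A × φ * φ ≤ + intc 2

    module _ (u : Fin n → ℤ) (eigenvector : Eigenvector u) (u⊥lines : ∀ j → sum (λ y → N y j * u y) ≡ 0ℤ) where

      -- For such u the identity `sum-over-pencil` reads 0 = (line-count x - r) u x.
      line-count≡r : ∀ {x} → u x ≢ 0ℤ → line-count x ≡ r
      line-count≡r {x} ux≢0 = ≢-cancelˡ ux≢0 (begin
        u x * line-count x ≡⟨ lemma (u x) (line-count x) r ⟩
        u x * r + (line-count x * u x + - (r * u x)) ≡⟨ cong (λ v → u x * r + (line-count x * u x + v)) (eigenvector x) ⟨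
        u x * r + (line-count x * u x + sum (λ y → 𝟙 (Adj? x y) * u y)) ≡⟨ cong (ℤ._+_ (u x * r)) (sum-over-pencil u x) ⟨
        u x * r + sum (λ j → N x j * sum (λ y → N y j * u y))
          ≡⟨ cong (ℤ._+_ (u x * r)) (sum-zero λ j → trans (cong (N x j *_) (u⊥lines j)) (*-zeroʳ (N x j))) ⟩
        u x * r + 0ℤ ≡⟨ +-identityʳ (u x * r) ⟩
        u x * r ∎)
        where
        open ≡-Reasoning
        lemma : ∀ u m r → u * m ≡ u * r + (m * u + - (r * u))
        lemma = solve-∀

      size : Fin L → ℤ
      size j = card (_∈? line j)

      line-clique : ∀ j → IsClique graph (line j)
      line-clique j = proj₁ (proj₁ (line-isLine j))

      -- The line sizes through x add up to r (1 + β), and none exceeds 1 + β.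
      tight : ∀ {x} → u x ≢ 0ℤ → ∀ {j} → x ∈ line j → B - t * (size j - 1ℤ) ≡ 0ℤ
      tight {x} ux≢0 {j} x∈j = trans (sym (*-identityˡ (B - t * (size j - 1ℤ))))
        (trans (cong (_* (B - t * (size j - 1ℤ))) (sym (𝟙-yes (x ∈? line j) x∈j)))
               (sum≤0⇒≡0 (λ k → slack≥0 k (x ∈? line k)) (≤-reflexive total) j))
        where
        open ≡-Reasoning
        slack≥0 : ∀ k (m : Dec (x ∈ line k)) → 0ℤ ≤ 𝟙 m * (B - t * (size k - 1ℤ))
        slack≥0 k (yes x∈k) = 0≤* {1ℤ} (+≤+ z≤n) (Delsarte.clique-bound (line-clique k) x∈k)
        slack≥0 k (no _) = +≤+ z≤n
        sizes : sum (λ k → N x k * size k) ≡ line-count x + + valency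
        sizes = begin
          sum (λ k → N x k * size k) ≡⟨ sum-cong-≗ (λ k → cong (N x k *_) (sum-cong-≗ λ y → sym (*-identityʳ (N y k)))) ⟩
          sum (λ k → N x k * sum (λ y → N y k * 1ℤ)) ≡⟨ sum-over-pencil (λ _ → 1ℤ) x ⟩
          line-count x * 1ℤ + sum (λ y → 𝟙 (Adj? x y) * 1ℤ)
            ≡⟨ cong₂ _+_ (*-identityʳ (line-count x)) (trans (sum-cong-≗ λ y → *-identityʳ (𝟙 (Adj? x y))) (degree x)) ⟩
          line-count x + + valency ∎
        total : sum (λ k → N x k * (B - t * (size k - 1ℤ))) ≡ 0ℤ
        total = begin
          sum (λ k → N x k * (B - t * (size k - 1ℤ))) ≡⟨ sum-cong-≗ (λ k → lemma₁ (N x k) B t (size k)) ⟩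
          sum (λ k → (B + t) * N x k + - t * (N x k * size k))
            ≡⟨ ∑-distrib-+ (λ k → (B + t) * N x k) (λ k → - t * (N x k * size k)) ⟩
          sum (λ k → (B + t) * N x k) + sum (λ k → - t * (N x k * size k))
            ≡⟨ cong₂ _+_ (*-distribˡ-sum (B + t) (λ k → N x k)) (*-distribˡ-sum (- t) (λ k → N x k * size k)) ⟨
          (B + t) * line-count x + - t * sum (λ k → N x k * size k)
            ≡⟨ cong₂ (λ p q → (B + t) * p + - t * q) (line-count≡r ux≢0) (trans sizes (cong (λ p → p + + valency) (line-count≡r ux≢0))) ⟩
          (B + t) * r + - t * (r + + valency) ≡⟨ lemma₂ B t r (+ valency) ⟩
          r * B - t * + valency ≡⟨ cong (λ p → r * B - p) t*valency ⟩
          r * B - r * B ≡⟨ +-inverseʳ (r * B) ⟩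
          0ℤ ∎
          where
          lemma₁ : ∀ N B t c → N * (B - t * (c - 1ℤ)) ≡ (B + t) * N + - t * (N * c)
          lemma₁ = solve-∀
          lemma₂ : ∀ B t r k → (B + t) * r + - t * (r + k) ≡ r * B - t * k
          lemma₂ = solve-∀

      tight-neighbours : ∀ {x j y} → u x ≢ 0ℤ → x ∈ line j → ∀ {z} → z ∉ line j → y ∈ line j → Adj z y →
        t * card (λ w → (w ∈? line j) ×-dec Adj? z w) ≡ t + A
      tight-neighbours {x} {j} ux≢0 x∈j = Delsarte.Tight.neighbours (line-clique j) x∈j (tight ux≢0 x∈j) 1<diameter

      -- The values of u on the line sum to zero, so x cannot carry the only nonzero one.
      second-nonzero : ∀ {x j} → u x ≢ 0ℤ → x ∈ line j → ∃ λ z → z ∈ line j × x ≢ z × u z ≢ 0ℤ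
      second-nonzero {x} {j} ux≢0 x∈j = decidable-stable
        (any? λ z → (z ∈? line j) ×-dec (¬? (x ≟ z) ×-dec ¬? (u z ℤ.≟ 0ℤ)))
        λ none → ux≢0 (trans (sym (trans (sum-cong-≗ λ y → only-x none y (x ≟ y) (y ∈? line j)) (sum-δ x u))) (u⊥lines j))
        where
        only-x : ¬ (∃ λ z → z ∈ line j × x ≢ z × u z ≢ 0ℤ) → ∀ y (e : Dec (x ≡ y)) (m : Dec (y ∈ line j)) → 𝟙 m * u y ≡ 𝟙 e * u y
        only-x none y (yes refl) (yes _) = refl
        only-x none y (yes refl) (no x∉j) = ⊥-elim (x∉j x∈j)
        only-x none y (no x≢y) (yes y∈j) = cong (1ℤ *_) (decidable-stable (u y ℤ.≟ 0ℤ) λ uy≢0 → none (y , y∈j , x≢y , uy≢0))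
        only-x none y (no _) (no _) = refl

      -- Lines through x are tight because of u x, but line k misses x and is tight because of u z;
      -- hence the need for two vertices. Then x has φ neighbours on k, and y has the same number on
      -- each line through x that contains a neighbour of y.
      from-triple : ∀ {x y z j k} → u x ≢ 0ℤ → u z ≢ 0ℤ → Adj x z → Adj z y → d x y ≡ 2 →
        x ∈ line j → z ∈ line k → y ∈ line k → Integral
      from-triple {x} {y} {z} {j} {k} ux≢0 uz≢0 xz zy xy≡2 x∈j z∈k y∈k = φ , tφ≡ , ≤-trans
        (common-neighbours-≥ φ (0≤card (λ w → (w ∈? line k) ×-dec Adj? x w)) x∉k y∈k ¬xy x≢y refl
          λ x∈i y∉i w∈i yw → <-cancelˡ 0<t (trans (tight-neighbours ux≢0 x∈i y∉i w∈i yw) (sym tφ≡)))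
        (≤-reflexive (nonadj-count x≢y ¬xy xz (Adj-sym zy)))
        where
        ¬xy : ¬ Adj x y
        ¬xy xy = ℕ.<⇒≢ ℕ.≤-refl (trans (sym (adj⇒d≡1 xy)) xy≡2)
        x≢y : x ≢ y
        x≢y x≡y = ℕ.0≢1+n (trans (sym (d-refl x)) (trans (cong (d x) x≡y) xy≡2))
        x∉k : x ∉ line k
        x∉k x∈k = ¬xy (collinear-adj x≢y x∈k y∈k)
        φ : ℤ
        φ = card (λ w → (w ∈? line k) ×-dec Adj? x w)
        tφ≡ : t * φ ≡ t + A
        tφ≡ = tight-neighbours uz≢0 z∈k x∉k z∈k xz

      from-pair : ∀ {x z j} → u x ≢ 0ℤ → u z ≢ 0ℤ → Adj x z → x ∈ line j → Integral
      from-pair {x} {z} ux≢0 uz≢0 xz x∈j =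
        let y , zy , xy≡ = card>0⇒∃ (farther? x z)
              (subst (0ℤ <_) (sym (trans (farther-count x z) (cong (λ i → + intb i) xz≡1))) (+<+ (0<intb 1<diameter)))
            k , z∈k , y∈k = joining-line zy
        in from-triple ux≢0 uz≢0 xz zy (trans xy≡ (cong suc xz≡1)) x∈j z∈k y∈k
        where
        xz≡1 : d x z ≡ 1
        xz≡1 = adj⇒d≡1 xz

      from-vertex : ∀ {x} → u x ≢ 0ℤ → Integral
      from-vertex {x} ux≢0 =
        let j , x∈j = card>0⇒∃ (λ j → x ∈? line j) (subst (0ℤ <_) (sym (line-count≡r ux≢0)) (0<r diameter 0<diameter))
            z , z∈j , x≢z , uz≢0 = second-nonzero ux≢0 x∈j
        in from-pair ux≢0 uz≢0 (collinear-adj x≢z x∈j z∈j) x∈j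

    -- The eigenvalue -r has multiplicity at least n / 2, which exceeds the number of lines.
    integrality : Integral
    integrality =
      let u , eigenvector , u⊥lines , x , ux≢0 = nonzero-in-kernel eigenspace (λ j y → N y j) projection
      in from-vertex u eigenvector (λ j → trans (·-comm (λ y → N y j) u) (u⊥lines j)) ux≢0

-- Arithmetic of the classical parameters with denominators cleared.

module Parameters where

  open import Defs
  open Sums
  open Distance
  open Spectral
  open Geometry
  open Integrality
  open import Data.Nat using (ℕ; zero; suc; z≤n; s≤s)
  import Data.Nat as ℕ
  import Data.Nat.Properties as ℕ
  open import Data.Integer using (ℤ; +_; 0ℤ; 1ℤ; _+_; _-_; _*_; -_; _≤_; _<_; +≤+; +<+)
  import Data.Integer as ℤ
  open import Data.Integer.Properties
  open import Data.Integer.Tactic.RingSolver using (solve-∀)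
  open import Data.Product using (_×_; ∃)
  open import Data.Sum using (inj₁; inj₂)
  open import Relation.Binary.PropositionalEquality

  -- The geometric sum 1 + b + ... + b^(j-1) by Horner's rule, free of division.
  integerBracket : ℤ → ℕ → ℤ
  integerBracket b zero = 0ℤ
  integerBracket b (suc i) = b * integerBracket b i + 1ℤ

  0≤ℕ : ∀ m → 0ℤ ≤ + m
  0≤ℕ m = +≤+ z≤n

  module Bracket (b : ℤ) (2≤b : + 2 ≤ b) where

    br : ℕ → ℤ
    br = integerBracket b

    0≤b-1 : 0ℤ ≤ b - 1ℤ
    0≤b-1 = 0≤- (≤-trans (+≤+ (s≤s z≤n)) 2≤b)

    0≤b : 0ℤ ≤ b
    0≤b = ≤-trans (0≤ℕ 2) 2≤b

    br-one : br 1 ≡ 1ℤ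
    br-one = lemma b
      where
      lemma : ∀ b → b * 0ℤ + 1ℤ ≡ 1ℤ
      lemma = solve-∀

    br-two : br 2 ≡ b + 1ℤ
    br-two = lemma b
      where
      lemma : ∀ b → b * (b * 0ℤ + 1ℤ) + 1ℤ ≡ b + 1ℤ
      lemma = solve-∀

    0≤br : ∀ i → 0ℤ ≤ br i
    0≤br zero = ≤-refl
    0≤br (suc i) = 0≤+ (0≤* 0≤b (0≤br i)) (0≤ℕ 1)

    0<br : ∀ i → 0ℤ < br (suc i)
    0<br i = +-mono-≤-< (0≤* 0≤b (0≤br i)) (+<+ (s≤s z≤n))

    br-mono : ∀ {i j} → i ℕ.≤ j → br i ≤ br j
    br-mono {i} {j} i≤j with ℕ.m≤n⇒m<n∨m≡n i≤j
    br-mono {i} {j} i≤j | inj₂ refl = ≤-refl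
    br-mono {i} {suc j} i≤j | inj₁ (s≤s i≤j′) = ≤-trans (br-mono i≤j′)
      (≤-by _ (0≤+ (0≤* 0≤b-1 (0≤br j)) (0≤ℕ 1)) (lemma b (br j)))
      where
      lemma : ∀ b e → b * e + 1ℤ ≡ e + ((b - 1ℤ) * e + 1ℤ)
      lemma = solve-∀

    3≤br : ∀ {i} → 2 ℕ.≤ i → + 3 ≤ br i
    3≤br 2≤i = ≤-trans (≤-trans (+-monoˡ-≤ 1ℤ 2≤b) (≤-reflexive (sym br-two))) (br-mono 2≤i)

  module IntegralParameters {n : ℕ} (Γ : DistanceRegularGraph n) (t A B b : ℤ) (s : ℕ)
    (2≤b : + 2 ≤ b) (0<t : 0ℤ < t) (3≤D : 3 ℕ.≤ DistanceRegularGraph.diameter Γ)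
    (t*intc : ∀ i → i ℕ.< DistanceRegularGraph.diameter Γ →
      t * + DistanceRegularGraph.intc Γ (suc i) ≡ integerBracket b (suc i) * (t + A * integerBracket b i))
    (t*intb : ∀ i → i ℕ.< DistanceRegularGraph.diameter Γ →
      t * + DistanceRegularGraph.intb Γ i ≡
        (integerBracket b (DistanceRegularGraph.diameter Γ) - integerBracket b i) * (B - A * integerBracket b i))
    (B-large : (+ 8 * A * b + + 8 * b * t + + 5 * A) * integerBracket b (DistanceRegularGraph.diameter Γ) ≤ + 3 * B)
    -- This and the next bound together say that s = ⌊4r/3⌋.
    (s-below : + 3 * + s ≤ + 4 * integerBracket b (DistanceRegularGraph.diameter Γ))
    (s-above : + 4 * integerBracket b (DistanceRegularGraph.diameter Γ) ≤ + 3 * + s + + 2)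
    where
    open DistanceRegularGraph Γ
    open DistanceFunction Γ using (0<intc)
    open Bracket b 2≤b

    r : ℤ
    r = br diameter

    3≤r : + 3 ≤ r
    3≤r = 3≤br (ℕ.≤-trans (s≤s (s≤s z≤n)) 3≤D)

    0≤r-1 : 0ℤ ≤ r - 1ℤ
    0≤r-1 = 0≤- (≤-trans (+≤+ (s≤s z≤n)) 3≤r)

    0≤r : 0ℤ ≤ r
    0≤r = 0≤br diameter

    0≤t : 0ℤ ≤ t
    0≤t = <⇒≤ 0<t

    1<D : 1 ℕ.< diameter
    1<D = ℕ.≤-trans (s≤s (s≤s z≤n)) 3≤D

    c₂ a₁ : ℤ
    c₂ = + intc 2
    a₁ = inta 1

    t*c₂ : t * c₂ ≡ (b + 1ℤ) * (t + A)
    t*c₂ = trans (t*intc 1 1<D) (cong₂ (λ u v → u * (t + v)) br-two (trans (cong (A *_) br-one) (*-identityʳ A)))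

    -- The source of α ≥ 0. In t c₂ = t b + (t + A (b + 1)) the last summand is positive because c₃
    -- > 0, so c₂ > b; integrality of c₂ improves this by a whole unit.
    b+1≤c₂ : b + 1ℤ ≤ c₂
    b+1≤c₂ = subst (_≤ c₂) (+-comm 1ℤ b) (i<j⇒suc[i]≤j (*-cancelˡ-<-nonNeg t {{ℤ.nonNegative 0≤t}} (subst (t * b <_)
      (trans (lemma t A b) (sym t*c₂)) (subst (_< t * b + (t + A * (b + 1ℤ))) (+-identityʳ (t * b)) (+-monoʳ-< (t * b) 0<p₂)))))
      where
      lemma : ∀ t A b → t * b + (t + A * (b + 1ℤ)) ≡ (b + 1ℤ) * (t + A)
      lemma = solve-∀
      0<p₂ : 0ℤ < t + A * (b + 1ℤ)
      0<p₂ = *-cancelˡ-<-nonNeg (br 3) {{ℤ.nonNegative (0≤br 3)}} (subst₂ _<_ (sym (*-zeroʳ (br 3)))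
        (trans (t*intc 2 3≤D) (cong (λ v → br 3 * (t + A * v)) br-two)) (0<* 0<t (+<+ (0<intc 3≤D))))

    0≤A : 0ℤ ≤ A
    0≤A = *-cancelˡ-≤ (+-mono-≤-< 0≤b (+<+ (s≤s z≤n))) (≤-by _ (0≤* 0≤t (0≤- b+1≤c₂))
      (trans (lemma₁ b A t) (trans (cong (λ u → (b + 1ℤ) * 0ℤ + (u - t * (b + 1ℤ))) (sym t*c₂)) (lemma₂ b t c₂))))
      where
      lemma₁ : ∀ b A t → (b + 1ℤ) * A ≡ (b + 1ℤ) * 0ℤ + ((b + 1ℤ) * (t + A) - t * (b + 1ℤ))
      lemma₁ = solve-∀
      lemma₂ : ∀ b t c → (b + 1ℤ) * 0ℤ + (t * c - t * (b + 1ℤ)) ≡ (b + 1ℤ) * 0ℤ + t * (c - (b + 1ℤ))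
      lemma₂ = solve-∀

    m : ℤ
    m = b * t + b * A + A

    0≤m : 0ℤ ≤ m
    0≤m = 0≤+ (0≤+ (0≤* 0≤b 0≤t) (0≤* 0≤b 0≤A)) 0≤A

    t*[c₂-1] : t * (c₂ - 1ℤ) ≡ m
    t*[c₂-1] = trans (lemma₁ t c₂) (trans (cong (λ u → u - t) t*c₂) (lemma₂ t A b))
      where
      lemma₁ : ∀ t c → t * (c - 1ℤ) ≡ t * c - t
      lemma₁ = solve-∀
      lemma₂ : ∀ t A b → (b + 1ℤ) * (t + A) - t ≡ b * t + b * A + A
      lemma₂ = solve-∀

    t*valency : t * + valency ≡ r * B
    t*valency = trans (t*intb 0 (ℕ.<-trans (s≤s z≤n) 1<D)) (lemma r A B)
      where
      lemma : ∀ r A B → (r - 0ℤ) * (B - A * 0ℤ) ≡ r * B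
      lemma = solve-∀

    t*a₁ : t * a₁ ≡ B + (r - 1ℤ) * A - t
    t*a₁ = begin
      t * (+ valency - + intb 1 - + intc 1) ≡⟨ lemma₁ t (+ valency) (+ intb 1) (+ intc 1) ⟩
      t * + valency - t * + intb 1 - t * + intc 1
        ≡⟨ cong₂ _-_ (cong₂ _-_ t*valency (t*intb 1 1<D)) (t*intc 0 (ℕ.<-trans (s≤s z≤n) 1<D)) ⟩
      r * B - (r - br 1) * (B - A * br 1) - br 1 * (t + A * 0ℤ)
        ≡⟨ cong (λ u → r * B - (r - u) * (B - A * u) - u * (t + A * 0ℤ)) br-one ⟩
      r * B - (r - 1ℤ) * (B - A * 1ℤ) - 1ℤ * (t + A * 0ℤ) ≡⟨ lemma₂ r B A t ⟩
      B + (r - 1ℤ) * A - t ∎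
      where
      open ≡-Reasoning
      lemma₁ : ∀ t k b c → t * (k - b - c) ≡ t * k - t * b - t * c
      lemma₁ = solve-∀
      lemma₂ : ∀ r B A t → r * B - (r - 1ℤ) * (B - A * 1ℤ) - 1ℤ * (t + A * 0ℤ) ≡ B + (r - 1ℤ) * A - t
      lemma₂ = solve-∀

    0<6t : 0ℤ < + 6 * t
    0<6t = 0<* {+ 6} (+<+ (s≤s z≤n)) 0<t

    -- Multiplied by t, the claim compares (2s - 1) m ≤ (8r/3 - 1) m with B + (r - 1) A - t. The
    -- summand r A of the latter raises the 5A of `B-large` to the 8A that 8 m contains; t (b - 1) +
    -- b A is left over.
    a-large : (+ 2 * + s - 1ℤ) * (c₂ - 1ℤ) ≤ a₁
    a-large = *-cancelˡ-≤ 0<6t (begin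
      + 6 * t * ((+ 2 * + s - 1ℤ) * (c₂ - 1ℤ)) ≡⟨ lemma₁ t (+ s) (c₂ - 1ℤ) ⟩
      + 6 * ((+ 2 * + s - 1ℤ) * (t * (c₂ - 1ℤ))) ≡⟨ cong (λ u → + 6 * ((+ 2 * + s - 1ℤ) * u)) t*[c₂-1] ⟩
      + 6 * ((+ 2 * + s - 1ℤ) * m)
        ≤⟨ ≤-by _ (0≤* (0≤ℕ 2) (0≤+ (0≤+ (0≤- B-large) (0≤* (0≤ℕ 2) (0≤* (0≤- s-below) 0≤m)))
                                     (0≤* (0≤ℕ 3) (0≤+ (0≤* 0≤t 0≤b-1) (0≤* 0≤b 0≤A))))) (lemma₂ t A B b r (+ s)) ⟩
      + 6 * (B + (r - 1ℤ) * A - t) ≡⟨ cong (+ 6 *_) t*a₁ ⟨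
      + 6 * (t * a₁) ≡⟨ *-assoc (+ 6) t a₁ ⟨
      + 6 * t * a₁ ∎)
      where
      open ≤-Reasoning
      lemma₁ : ∀ t s u → + 6 * t * ((+ 2 * s - 1ℤ) * u) ≡ + 6 * ((+ 2 * s - 1ℤ) * (t * u))
      lemma₁ = solve-∀
      lemma₂ : ∀ t A B b r s → + 6 * (B + (r - 1ℤ) * A - t) ≡ + 6 * ((+ 2 * s - 1ℤ) * (b * t + b * A + A))
        + + 2 * ((+ 3 * B - (+ 8 * A * b + + 8 * b * t + + 5 * A) * r) + + 2 * ((+ 4 * r - + 3 * s) * (b * t + b * A + A))
                 + + 3 * (t * (b - 1ℤ) + b * A))
      lemma₂ = solve-∀

    -- This is t times the factor 2 (a₁ + 1) - s (c₂ - 1) of `κ-small`: up to 2t, the average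
    -- contribution of a leaf in `covered-count`.
    Q : ℤ
    Q = + 2 * (B + (r - 1ℤ) * A) - + s * m

    -- From s ≤ 4r/3 and `B-large` follows s m ≤ (B + r A) / 2, which leaves 3B/2 and a multiple of
    -- A that is nonnegative for r ≥ 3.
    3B≤2Q : + 3 * B ≤ + 2 * Q
    3B≤2Q = *-cancelˡ-≤ {c = + 3} (+<+ (s≤s z≤n)) (≤-by _
      (0≤+ (0≤+ (0≤- B-large) (0≤* (0≤ℕ 2) (0≤* (0≤- s-below) 0≤m)))
           (0≤* (0≤* (0≤ℕ 3) 0≤A) (0≤+ (0≤* (0≤ℕ 3) (0≤- 3≤r)) (0≤ℕ 5)))) (lemma t A B b r (+ s)))
      where
      lemma : ∀ t A B b r s → + 3 * (+ 2 * (+ 2 * (B + (r - 1ℤ) * A) - s * (b * t + b * A + A))) ≡ + 3 * (+ 3 * B)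
        + ((+ 3 * B - (+ 8 * A * b + + 8 * b * t + + 5 * A) * r) + + 2 * ((+ 4 * r - + 3 * s) * (b * t + b * A + A))
                 + + 3 * A * (+ 3 * (r - + 3) + + 5))
      lemma = solve-∀

    6t≤3B : + 6 * t ≤ + 3 * B
    6t≤3B = ≤-by _ (0≤+ (0≤- B-large) (0≤+ (0≤* (0≤+ (0≤* (0≤* (0≤ℕ 8) 0≤A) 0≤b) (0≤* (0≤ℕ 5) 0≤A)) 0≤r)
        (0≤* 0≤t (0≤+ (0≤* (0≤ℕ 8) (0≤+ (0≤* 0≤b-1 0≤r) 0≤r-1)) (0≤ℕ 2))))) (lemma t A B b r)
      where
      lemma : ∀ t A B b r → + 3 * B ≡ + 6 * t + ((+ 3 * B - (+ 8 * A * b + + 8 * b * t + + 5 * A) * r)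
        + ((+ 8 * A * b + + 5 * A) * r + t * (+ 8 * ((b - 1ℤ) * r + (r - 1ℤ)) + + 2)))
      lemma = solve-∀

    -- With s + 1 ≥ (4r + 1) / 3 and Q ≥ 3B/2 the product (s + 1) Q is at least 2 r B + B/2. The
    -- main term is twice t times the valency, and B/2 ≥ t pays for the unit.
    κ-small : + 2 * + valency + 1ℤ ≤ (+ s + 1ℤ) * (+ 2 * (a₁ + 1ℤ) - + s * (c₂ - 1ℤ))
    κ-small = *-cancelˡ-≤ 0<6t (begin
      + 6 * t * (+ 2 * + valency + 1ℤ) ≡⟨ lemma₁ t (+ valency) ⟩
      + 12 * (t * + valency) + + 6 * t ≡⟨ cong (λ u → + 12 * u + + 6 * t) t*valency ⟩
      + 12 * (r * B) + + 6 * t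
        ≤⟨ ≤-by _ (0≤+ (0≤+ (0≤* (0≤+ (0≤* (0≤ℕ 4) 0≤r) (0≤ℕ 1)) (0≤- 3B≤2Q))
                             (0≤* (0≤- s-above) (0≤+ (0≤- 3B≤2Q) (0≤+ (0≤- 6t≤3B) (0≤* (0≤ℕ 6) 0≤t)))))
                       (0≤- 6t≤3B)) (lemma₂ r (+ s) B t Q) ⟩
      + 6 * ((+ s + 1ℤ) * (+ 2 * (B + (r - 1ℤ) * A) - + s * m)) ≡⟨ cong (λ u → + 6 * ((+ s + 1ℤ) * u)) Q≡ ⟩
      + 6 * ((+ s + 1ℤ) * (t * (+ 2 * (a₁ + 1ℤ) - + s * (c₂ - 1ℤ)))) ≡⟨ lemma₄ t (+ s + 1ℤ) (+ 2 * (a₁ + 1ℤ) - + s * (c₂ - 1ℤ)) ⟩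
      + 6 * t * ((+ s + 1ℤ) * (+ 2 * (a₁ + 1ℤ) - + s * (c₂ - 1ℤ))) ∎)
      where
      open ≤-Reasoning
      lemma₁ : ∀ t k → + 6 * t * (+ 2 * k + 1ℤ) ≡ + 12 * (t * k) + + 6 * t
      lemma₁ = solve-∀
      lemma₂ : ∀ r s B t Q → + 6 * ((s + 1ℤ) * Q) ≡ + 12 * (r * B) + + 6 * t
        + ((+ 4 * r + 1ℤ) * (+ 2 * Q - + 3 * B) + (+ 3 * s + + 2 - + 4 * r) * (+ 2 * Q - + 3 * B + (+ 3 * B - + 6 * t + + 6 * t))
           + (+ 3 * B - + 6 * t))
      lemma₂ = solve-∀
      lemma₃ : ∀ t s a c → t * (+ 2 * (a + 1ℤ) - s * (c - 1ℤ)) ≡ + 2 * (t * a + t) - s * (t * (c - 1ℤ))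
      lemma₃ = solve-∀
      lemma₅ : ∀ B A r t → B + (r - 1ℤ) * A - t + t ≡ B + (r - 1ℤ) * A
      lemma₅ = solve-∀
      lemma₄ : ∀ t s u → + 6 * (s * (t * u)) ≡ + 6 * t * (s * u)
      lemma₄ = solve-∀
      Q≡ : Q ≡ t * (+ 2 * (a₁ + 1ℤ) - + s * (c₂ - 1ℤ))
      Q≡ = sym (trans (lemma₃ t (+ s) a₁ c₂) (cong₂ (λ u v → + 2 * u - + s * v)
        (trans (cong (λ u → u + t) t*a₁) (lemma₅ B A r t)) t*[c₂-1]))

    -- After `a-large` the right side is at least s (c₂ - 1) + 2, and c₂ - 1 ≥ b ≥ 2.
    lines-large : + 2 * + s + 1ℤ ≤ a₁ + + 2 - (c₂ - 1ℤ) * (+ s - 1ℤ)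
    lines-large = ≤-by _ (0≤+ (0≤+ (0≤- a-large)
        (0≤* (0≤ℕ s) (0≤+ (0≤- b+1≤c₂) (0≤- 2≤b)))) (0≤ℕ 1)) (lemma a₁ c₂ (+ s) b)
      where
      lemma : ∀ a c s b → a + + 2 - (c - 1ℤ) * (s - 1ℤ) ≡ + 2 * s + 1ℤ
        + ((a - (+ 2 * s - 1ℤ) * (c - 1ℤ)) + s * (c - (b + 1ℤ) + (b - + 2)) + 1ℤ)
      lemma = solve-∀

    2≤s : 2 ℕ.≤ s
    2≤s = drop‿+≤+ (*-cancelˡ-≤ {c = + 3} (+<+ (s≤s z≤n))
      (≤-by _ (0≤+ (0≤+ (0≤- s-above) (0≤* (0≤ℕ 4) (0≤- 3≤r))) (0≤ℕ 4)) (lemma (+ s) r)))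
      where
      lemma : ∀ s r → + 3 * s ≡ + 3 * + 2 + ((+ 3 * s + + 2 - + 4 * r) + + 4 * (r - + 3) + + 4)
      lemma = solve-∀

    p q : ℕ → ℤ
    p i = t + A * br i
    q i = B - A * br i

    0<q : ∀ i → i ℕ.< diameter → 0ℤ < q i
    0<q i i<D = *-cancelˡ-<-nonNeg (+ 3) (<-≤-trans (0<* {+ 2} (+<+ (s≤s z≤n)) 0<t) (≤-by _
      (0≤+ (0≤+ (0≤- B-large) (0≤* (0≤ℕ 3) (0≤* 0≤A (0≤- (br-mono (ℕ.<⇒≤ i<D))))))
           (0≤+ (0≤* (0≤+ (0≤* (0≤* (0≤ℕ 8) 0≤A) 0≤b) (0≤* (0≤ℕ 2) 0≤A)) 0≤r)
                (0≤* 0≤t (0≤+ (0≤* (0≤ℕ 8) (0≤+ (0≤* 0≤b-1 0≤r) 0≤r-1)) (0≤ℕ 6)))))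
      (lemma t A B b r (br i))))
      where
      lemma : ∀ t A B b r e → + 3 * (B - A * e) ≡ + 2 * t + ((+ 3 * B - (+ 8 * A * b + + 8 * b * t + + 5 * A) * r)
        + + 3 * (A * (r - e)) + ((+ 8 * A * b + + 2 * A) * r + t * (+ 8 * ((b - 1ℤ) * r + (r - 1ℤ)) + + 6)))
      lemma = solve-∀

    -- Weight `B-large` by [i+1] = b [i] + 1. Its part 5 A r / 3 absorbs the A [i] subtracted in q
    -- i, and the part (8b/3)(A + t) r dominates 2 r p_i.
    halving : ∀ i → i ℕ.< diameter → + 2 * (p i * (r - br i)) ≤ q i * br (suc i)
    halving i i<D = *-cancelˡ-≤ {c = + 3} (+<+ (s≤s z≤n)) (≤-by _
      (0≤+ (0≤+ (0≤* (0≤- B-large) 0≤be+1)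
                (0≤* 0≤r (0≤+ (0≤+ (0≤* (0≤* (0≤ℕ 6) 0≤t) 0≤b-1) (0≤+ (0≤* (0≤* (0≤ℕ 8) 0≤b) (0≤+ 0≤A (0≤* (0≤* 0≤b 0≤t) 0≤e))) (0≤* (0≤* (0≤ℕ 2) 0≤b) 0≤t)))
                              (0≤* (0≤* 0≤A 0≤e) (0≤+ (0≤* (0≤* (0≤ℕ 6) 0≤b-1) (0≤+ 0≤b (0≤ℕ 1))) (0≤* (0≤* (0≤ℕ 2) 0≤b) 0≤b))))))
           (0≤+ (0≤* (0≤* (0≤ℕ 6) (0≤+ 0≤t (0≤* 0≤A 0≤e))) 0≤e)
                (0≤* (0≤+ (0≤* (0≤* (0≤ℕ 5) 0≤A) 0≤r-e) (0≤* (0≤* (0≤ℕ 2) 0≤A) 0≤e)) 0≤be+1)))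
      (lemma t A B b r (br i)))
      where
      0≤e = 0≤br i
      0≤be+1 = 0≤br (suc i)
      0≤r-e : 0ℤ ≤ r - br i
      0≤r-e = 0≤- (br-mono (ℕ.<⇒≤ i<D))
      lemma : ∀ t A B b r e → + 3 * ((B - A * e) * (b * e + 1ℤ)) ≡ + 3 * (+ 2 * ((t + A * e) * (r - e)))
        + ((+ 3 * B - (+ 8 * A * b + + 8 * b * t + + 5 * A) * r) * (b * e + 1ℤ)
           + r * (+ 6 * t * (b - 1ℤ) + (+ 8 * b * (A + b * t * e) + + 2 * b * t) + A * e * (+ 6 * (b - 1ℤ) * (b + 1ℤ) + + 2 * b * b))
           + (+ 6 * (t + A * e) * e + (+ 5 * A * (r - e) + + 2 * A * e) * (b * e + 1ℤ)))
      lemma = solve-∀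

    parameters : Eigenspace.Parameters Γ t A B br
    parameters = record
      { 0<t = 0<t ; br-zero = refl ; br-one = br-one ; 0<br = 0<br
      ; 0<p = λ i → +-mono-<-≤ 0<t (0≤* 0≤A (0≤br i)) ; 0<q = 0<q
      ; t*intc = t*intc ; t*intb = t*intb ; 0<diameter = ℕ.<-trans (s≤s z≤n) 1<D }

    hasSPLS : HasSPLS Γ (+ s)
    hasSPLS = Lines.hasSPLS Γ s 2≤s (0<intc 1<D) a-large κ-small

    integral : ∃ λ φ → t * φ ≡ t + A × φ * φ ≤ c₂
    integral = integrality Γ t A B br parameters s 2≤s (0<intc 1<D) a-large κ-small lines-large halving 1<D

    φ²≤c₂⇒A≤t*b : ∀ φ → t * φ ≡ t + A → φ * φ ≤ c₂ → A ≤ t * b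
    φ²≤c₂⇒A≤t*b φ tφ≡ φ²≤c₂ = ≤-by _ (0≤- (*-cancelˡ-≤ (+-mono-<-≤ 0<t 0≤A) (begin
        (t + A) * (t + A) ≡⟨ cong₂ _*_ tφ≡ tφ≡ ⟨
        t * φ * (t * φ) ≡⟨ lemma₁ t φ ⟩
        t * t * (φ * φ) ≤⟨ *-monoˡ-≤-nonNeg (t * t) {{ℤ.nonNegative (0≤* 0≤t 0≤t)}} φ²≤c₂ ⟩
        t * t * c₂ ≡⟨ *-assoc t t c₂ ⟩
        t * (t * c₂) ≡⟨ cong (t *_) t*c₂ ⟩
        t * ((b + 1ℤ) * (t + A)) ≡⟨ lemma₂ t b A ⟩
        (t + A) * (t * b + t) ∎))) (lemma₃ t A b)
      where
      open ≤-Reasoning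
      lemma₁ : ∀ t φ → t * φ * (t * φ) ≡ t * t * (φ * φ)
      lemma₁ = solve-∀
      lemma₂ : ∀ t b A → t * ((b + 1ℤ) * (t + A)) ≡ (t + A) * (t * b + t)
      lemma₂ = solve-∀
      lemma₃ : ∀ t A b → t * b ≡ A + (t * b + t - (t + A))
      lemma₃ = solve-∀

-- Integers inside ℚ, brackets and floors.

module Rationals where

  open import Defs using (fromℤ; bracket; b-1-nonZero)
  open Sums using (*-cancelˡ-≤)
  open Parameters using (integerBracket)
  open import Data.Nat using (zero; suc; z≤n; s≤s)
  open import Data.Integer using (+_; 0ℤ; 1ℤ; +<+)
  import Data.Integer as ℤ
  import Data.Integer.Properties as ℤ
  import Data.Integer.DivMod as ℤ
  open import Data.Integer.Tactic.RingSolver using (solve-∀)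
  open import Data.Rational using (ℚ; 1ℚ; _+_; _*_; _-_; -_; 1/_; _≤_; ↥_; ↧_; toℚᵘ; floor; *≤*; *<*; Positive)
  import Data.Rational as ℚ
  open import Data.Rational.Properties
  open import Data.Rational.Unnormalised using (mkℚᵘ; *≡*; *≤*; *<*)
  import Data.Rational.Unnormalised as ℚᵘ
  import Data.Rational.Unnormalised.Properties as ℚᵘ
  open import Data.Rational.Solver using (module +-*-Solver)
  open +-*-Solver using (solve; _:*_; _:=_)
  open import Data.Product using (_×_; _,_)
  open import Relation.Binary.PropositionalEquality

  toℚᵘ-fromℤ : ∀ i → toℚᵘ (fromℤ i) ℚᵘ.≃ mkℚᵘ i 0
  toℚᵘ-fromℤ i = toℚᵘ-fromℚᵘ (mkℚᵘ i 0)

  fromℤ-+ : ∀ i j → fromℤ (i ℤ.+ j) ≡ fromℤ i + fromℤ j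
  fromℤ-+ i j = toℚᵘ-injective (begin
    toℚᵘ (fromℤ (i ℤ.+ j)) ≈⟨ toℚᵘ-fromℤ (i ℤ.+ j) ⟩
    mkℚᵘ (i ℤ.+ j) 0 ≈⟨ *≡* (lemma i j) ⟩
    mkℚᵘ i 0 ℚᵘ.+ mkℚᵘ j 0 ≈⟨ ℚᵘ.+-cong (toℚᵘ-fromℤ i) (toℚᵘ-fromℤ j) ⟨
    toℚᵘ (fromℤ i) ℚᵘ.+ toℚᵘ (fromℤ j) ≈⟨ toℚᵘ-homo-+ (fromℤ i) (fromℤ j) ⟨
    toℚᵘ (fromℤ i + fromℤ j) ∎)
    where
    open ℚᵘ.≃-Reasoning
    lemma : ∀ i j → (i ℤ.+ j) ℤ.* (+ 1) ≡ (i ℤ.* + 1 ℤ.+ j ℤ.* + 1) ℤ.* + 1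
    lemma = solve-∀

  fromℤ-* : ∀ i j → fromℤ (i ℤ.* j) ≡ fromℤ i * fromℤ j
  fromℤ-* i j = toℚᵘ-injective (begin
    toℚᵘ (fromℤ (i ℤ.* j)) ≈⟨ toℚᵘ-fromℤ (i ℤ.* j) ⟩
    mkℚᵘ (i ℤ.* j) 0 ≈⟨ ℚᵘ.*-cong (toℚᵘ-fromℤ i) (toℚᵘ-fromℤ j) ⟨
    toℚᵘ (fromℤ i) ℚᵘ.* toℚᵘ (fromℤ j) ≈⟨ toℚᵘ-homo-* (fromℤ i) (fromℤ j) ⟨
    toℚᵘ (fromℤ i * fromℤ j) ∎)
    where open ℚᵘ.≃-Reasoning

  fromℤ-neg : ∀ i → fromℤ (ℤ.- i) ≡ - fromℤ i
  fromℤ-neg i = toℚᵘ-injective (begin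
    toℚᵘ (fromℤ (ℤ.- i)) ≈⟨ toℚᵘ-fromℤ (ℤ.- i) ⟩
    ℚᵘ.- mkℚᵘ i 0 ≈⟨ ℚᵘ.-‿cong (toℚᵘ-fromℤ i) ⟨
    ℚᵘ.- toℚᵘ (fromℤ i) ≈⟨ toℚᵘ-homo‿- (fromℤ i) ⟨
    toℚᵘ (- fromℤ i) ∎)
    where open ℚᵘ.≃-Reasoning

  fromℤ-- : ∀ i j → fromℤ (i ℤ.- j) ≡ fromℤ i - fromℤ j
  fromℤ-- i j = trans (fromℤ-+ i (ℤ.- j)) (cong (λ q → fromℤ i + q) (fromℤ-neg j))

  fromℤ-injective : ∀ {i j} → fromℤ i ≡ fromℤ j → i ≡ j
  fromℤ-injective {i} {j} eq with ℚᵘ.≃-trans (ℚᵘ.≃-sym (toℚᵘ-fromℤ i)) (ℚᵘ.≃-trans (toℚᵘ-cong eq) (toℚᵘ-fromℤ j))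
  ... | *≡* e = ℤ.*-cancelʳ-≡ i j (+ 1) e

  fromℤ-mono-≤ : ∀ {i j} → i ℤ.≤ j → fromℤ i ≤ fromℤ j
  fromℤ-mono-≤ {i} {j} i≤j = toℚᵘ-cancel-≤ (ℚᵘ.≤-respʳ-≃ (ℚᵘ.≃-sym (toℚᵘ-fromℤ j)) (ℚᵘ.≤-respˡ-≃ (ℚᵘ.≃-sym (toℚᵘ-fromℤ i))
    (*≤* (ℤ.*-monoʳ-≤-nonNeg (+ 1) i≤j))))

  fromℤ-cancel-≤ : ∀ {i j} → fromℤ i ≤ fromℤ j → i ℤ.≤ j
  fromℤ-cancel-≤ {i} {j} i≤j with ℚᵘ.≤-respʳ-≃ (toℚᵘ-fromℤ j) (ℚᵘ.≤-respˡ-≃ (toℚᵘ-fromℤ i) (toℚᵘ-mono-≤ i≤j))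
  ... | *≤* e = ℤ.*-cancelʳ-≤-pos i j (+ 1) e

  fromℤ-positive : ∀ {i} → 0ℤ ℤ.< i → Positive (fromℤ i)
  fromℤ-positive {i} 0<i = ℚ.positive (toℚᵘ-cancel-< (ℚᵘ.<-respʳ-≃ (ℚᵘ.≃-sym (toℚᵘ-fromℤ i)) (*<* (ℤ.*-monoʳ-<-pos (+ 1) 0<i))))

  *-denominator : ∀ p → p * fromℤ (↧ p) ≡ fromℤ (↥ p)
  *-denominator p@record{} = toℚᵘ-injective (begin
    toℚᵘ (p * fromℤ (↧ p)) ≈⟨ toℚᵘ-homo-* p (fromℤ (↧ p)) ⟩
    toℚᵘ p ℚᵘ.* toℚᵘ (fromℤ (↧ p)) ≈⟨ ℚᵘ.*-congˡ {toℚᵘ p} (toℚᵘ-fromℤ (↧ p)) ⟩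
    toℚᵘ p ℚᵘ.* mkℚᵘ (↧ p) 0 ≈⟨ *≡* (lemma (↥ p) (↧ p)) ⟩
    mkℚᵘ (↥ p) 0 ≈⟨ toℚᵘ-fromℤ (↥ p) ⟨
    toℚᵘ (fromℤ (↥ p)) ∎)
    where
    open ℚᵘ.≃-Reasoning
    lemma : ∀ n d → n ℤ.* d ℤ.* + 1 ≡ n ℤ.* (d ℤ.* + 1)
    lemma = solve-∀

  *-cancelʳ : ∀ r .{{_ : Positive r}} {p q} → p * r ≡ q * r → p ≡ q
  *-cancelʳ r eq = ≤-antisym (*-cancelʳ-≤-pos r (≤-reflexive eq)) (*-cancelʳ-≤-pos r (≤-reflexive (sym eq)))

  power-1 : ∀ b j → b ℤ.^ j ℤ.- 1ℤ ≡ integerBracket b j ℤ.* (b ℤ.- 1ℤ)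
  power-1 b zero = refl
  power-1 b (suc j) = begin
    b ℤ.* b ℤ.^ j ℤ.- 1ℤ ≡⟨ lemma₁ b (b ℤ.^ j) ⟩
    b ℤ.* (b ℤ.^ j ℤ.- 1ℤ) ℤ.+ (b ℤ.- 1ℤ) ≡⟨ cong (λ u → b ℤ.* u ℤ.+ (b ℤ.- 1ℤ)) (power-1 b j) ⟩
    b ℤ.* (integerBracket b j ℤ.* (b ℤ.- 1ℤ)) ℤ.+ (b ℤ.- 1ℤ) ≡⟨ lemma₂ b (integerBracket b j) ⟩
    (b ℤ.* integerBracket b j ℤ.+ 1ℤ) ℤ.* (b ℤ.- 1ℤ) ∎
    where
    open ≡-Reasoning
    lemma₁ : ∀ b p → b ℤ.* p ℤ.- 1ℤ ≡ b ℤ.* (p ℤ.- 1ℤ) ℤ.+ (b ℤ.- 1ℤ)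
    lemma₁ = solve-∀
    lemma₂ : ∀ b e → b ℤ.* (e ℤ.* (b ℤ.- 1ℤ)) ℤ.+ (b ℤ.- 1ℤ) ≡ (b ℤ.* e ℤ.+ 1ℤ) ℤ.* (b ℤ.- 1ℤ)
    lemma₂ = solve-∀

  bracket≡ : ∀ b b≢1 j → bracket b b≢1 j ≡ fromℤ (integerBracket b j)
  bracket≡ b b≢1 j = begin
    fromℤ (b ℤ.^ j ℤ.- 1ℤ) * 1/ q ≡⟨ cong (λ i → fromℤ i * 1/ q) (power-1 b j) ⟩
    fromℤ (integerBracket b j ℤ.* (b ℤ.- 1ℤ)) * 1/ q ≡⟨ cong (_* 1/ q) (fromℤ-* (integerBracket b j) (b ℤ.- 1ℤ)) ⟩
    fromℤ (integerBracket b j) * q * 1/ q ≡⟨ *-assoc (fromℤ (integerBracket b j)) q (1/ q) ⟩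
    fromℤ (integerBracket b j) * (q * 1/ q) ≡⟨ cong (fromℤ (integerBracket b j) *_) (*-inverseʳ q) ⟩
    fromℤ (integerBracket b j) * 1ℚ ≡⟨ *-identityʳ (fromℤ (integerBracket b j)) ⟩
    fromℤ (integerBracket b j) ∎
    where
    open ≡-Reasoning
    q : ℚ
    q = fromℤ (b ℤ.- 1ℤ)
    instance _ = b-1-nonZero b b≢1

  floor-bounds : ∀ p → floor p ℤ.* ↧ p ℤ.≤ ↥ p × ↥ p ℤ.< (1ℤ ℤ.+ floor p) ℤ.* ↧ p
  floor-bounds p@(ℚ.mkℚ n d-1 _) = ℤ.[n/d]*d≤n n (+ suc d-1) ,
    subst (λ f → n ℤ.< (1ℤ ℤ.+ f) ℤ.* + suc d-1) (sym (ℤ.div-pos-is-/ℕ n (suc d-1))) (ℤ.n<s[n/ℕd]*d n (suc d-1))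

  0<denominator : ∀ p → 0ℤ ℤ.< ↧ p
  0<denominator (ℚ.mkℚ _ _ _) = +<+ (s≤s z≤n)

  -- The reduced denominator of 4R/3 is not computed but cancelled. The strict bound 4R < 3 (f + 1)
  -- between integers then yields the 2.
  floor-4/3 : ∀ R → let f = floor ((+ 4 ℚ./ 3) * fromℤ R) in
    (+ 3 ℤ.* f ℤ.≤ + 4 ℤ.* R) × (+ 4 ℤ.* R ℤ.≤ + 3 ℤ.* f ℤ.+ + 2)
  floor-4/3 R = bounds (floor p) (↥ p) (↧ p) (0<denominator p) numerator (floor-bounds p)
    where
    p = (+ 4 ℚ./ 3) * fromℤ R
    numerator : ↥ p ℤ.* + 3 ≡ + 4 ℤ.* R ℤ.* ↧ p
    numerator = fromℤ-injective (begin
      fromℤ (↥ p ℤ.* + 3) ≡⟨ fromℤ-* (↥ p) (+ 3) ⟩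
      fromℤ (↥ p) * fromℤ (+ 3) ≡⟨ cong (_* fromℤ (+ 3)) (*-denominator p) ⟨
      p * fromℤ (↧ p) * fromℤ (+ 3) ≡⟨ rearrange (+ 4 ℚ./ 3) (fromℤ R) (fromℤ (↧ p)) (fromℤ (+ 3)) ⟩
      (+ 4 ℚ./ 3) * fromℤ (+ 3) * fromℤ R * fromℤ (↧ p) ≡⟨⟩
      fromℤ (+ 4) * fromℤ R * fromℤ (↧ p) ≡⟨ cong (_* fromℤ (↧ p)) (fromℤ-* (+ 4) R) ⟨
      fromℤ (+ 4 ℤ.* R) * fromℤ (↧ p) ≡⟨ fromℤ-* (+ 4 ℤ.* R) (↧ p) ⟨
      fromℤ (+ 4 ℤ.* R ℤ.* ↧ p) ∎)
      where
      open ≡-Reasoning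
      rearrange : ∀ a b c d → a * b * c * d ≡ a * d * b * c
      rearrange = solve 4 (λ a b c d → a :* b :* c :* d := a :* d :* b :* c) refl
    bounds : ∀ f n d → 0ℤ ℤ.< d → n ℤ.* + 3 ≡ + 4 ℤ.* R ℤ.* d → f ℤ.* d ℤ.≤ n × n ℤ.< (1ℤ ℤ.+ f) ℤ.* d →
      (+ 3 ℤ.* f ℤ.≤ + 4 ℤ.* R) × (+ 4 ℤ.* R ℤ.≤ + 3 ℤ.* f ℤ.+ + 2)
    bounds f n d 0<d n≡ (below , above) =
      *-cancelˡ-≤ 0<d (begin
        d ℤ.* (+ 3 ℤ.* f) ≡⟨ lemma₁ d f ⟩
        f ℤ.* d ℤ.* + 3 ≤⟨ ℤ.*-monoʳ-≤-nonNeg (+ 3) below ⟩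
        n ℤ.* + 3 ≡⟨ n≡ ⟩
        + 4 ℤ.* R ℤ.* d ≡⟨ ℤ.*-comm (+ 4 ℤ.* R) d ⟩
        d ℤ.* (+ 4 ℤ.* R) ∎) ,
      subst₂ ℤ._≤_ (lemma₂ (+ 4 ℤ.* R)) (lemma₃ f) (ℤ.+-monoˡ-≤ (ℤ.- 1ℤ) (ℤ.i<j⇒suc[i]≤j (ℤ.*-cancelˡ-<-nonNeg d {{ℤ.nonNegative (ℤ.<⇒≤ 0<d)}} (begin-strict
        d ℤ.* (+ 4 ℤ.* R) ≡⟨ ℤ.*-comm d (+ 4 ℤ.* R) ⟩
        + 4 ℤ.* R ℤ.* d ≡⟨ n≡ ⟨
        n ℤ.* + 3 <⟨ ℤ.*-monoʳ-<-pos (+ 3) above ⟩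
        (1ℤ ℤ.+ f) ℤ.* d ℤ.* + 3 ≡⟨ lemma₄ f d ⟩
        d ℤ.* (+ 3 ℤ.* (1ℤ ℤ.+ f)) ∎))))
      where
      open ℤ.≤-Reasoning
      lemma₁ : ∀ d f → d ℤ.* (+ 3 ℤ.* f) ≡ f ℤ.* d ℤ.* + 3
      lemma₁ = solve-∀
      lemma₂ : ∀ u → 1ℤ ℤ.+ u ℤ.+ ℤ.- 1ℤ ≡ u
      lemma₂ = solve-∀
      lemma₃ : ∀ f → + 3 ℤ.* (1ℤ ℤ.+ f) ℤ.+ ℤ.- 1ℤ ≡ + 3 ℤ.* f ℤ.+ + 2
      lemma₃ = solve-∀
      lemma₄ : ∀ f d → (1ℤ ℤ.+ f) ℤ.* d ℤ.* + 3 ≡ d ℤ.* (+ 3 ℤ.* (1ℤ ℤ.+ f))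
      lemma₄ = solve-∀

-- Clearing denominators in the hypotheses and restoring them in the conclusion.

module Conversion where

  open import Defs
  open Sums using (≤-by; 0≤-; 0≤+; 0≤*; 0<*; *-cancelˡ-≤)
  open Parameters
  open Rationals
  open import Data.Nat using (ℕ; suc; z≤n; s≤s)
  import Data.Nat as ℕ
  import Data.Nat.Properties as ℕ
  open import Data.Integer using (ℤ; +_; 0ℤ; 1ℤ)
  import Data.Integer as ℤ
  import Data.Integer.Properties as ℤ
  open import Data.Integer.Tactic.RingSolver using (solve-∀)
  open import Data.Rational using (ℚ; 0ℚ; 1ℚ; _+_; _*_; _-_; _≤_; ↥_; ↧_; floor; Positive)
  import Data.Rational as ℚ
  open import Data.Rational.Properties
  open import Data.Rational.Solver using (module +-*-Solver)
  open +-*-Solver using (solve; con; _:*_; _:+_; _:-_; _:=_)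
  open import Data.Product using (_×_; _,_; ∃; proj₁; proj₂)
  open import Relation.Binary.PropositionalEquality

  module _ {n : ℕ} (Γ : DistanceRegularGraph n) (b : ℤ) (b≢1 : b ≢ 1ℤ) (α β : ℚ)
    (classical : HasClassicalParameters Γ (DistanceRegularGraph.diameter Γ) b b≢1 α β)
    (2≤b : + 2 ℤ.≤ b) (3≤D : 3 ℕ.≤ DistanceRegularGraph.diameter Γ)
    (β-large : (+ 1 ℚ./ 3) * ((+ 8 ℚ./ 1) * α * fromℤ b + (+ 8 ℚ./ 1) * fromℤ b + (+ 5 ℚ./ 1) * α)
                 * bracket b b≢1 (DistanceRegularGraph.diameter Γ) ≤ β)
    where
    open DistanceRegularGraph Γ
    open HasClassicalParameters classical using (intb≡; intc≡)

    br : ℕ → ℤ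
    br = integerBracket b

    -- The product of the two denominators puts α = A / t and β = B / t over one positive integer.
    t A B : ℤ
    t = ↧ α ℤ.* ↧ β
    A = ↥ α ℤ.* ↧ β
    B = ↥ β ℤ.* ↧ α

    0<t : 0ℤ ℤ.< t
    0<t = 0<* (0<denominator α) (0<denominator β)

    T : ℚ
    T = fromℤ t

    instance
      T-positive : Positive T
      T-positive = fromℤ-positive 0<t

    αT : α * T ≡ fromℤ A
    αT = begin
      α * fromℤ (↧ α ℤ.* ↧ β) ≡⟨ cong (α *_) (fromℤ-* (↧ α) (↧ β)) ⟩
      α * (fromℤ (↧ α) * fromℤ (↧ β)) ≡⟨ *-assoc α (fromℤ (↧ α)) (fromℤ (↧ β)) ⟨
      α * fromℤ (↧ α) * fromℤ (↧ β) ≡⟨ cong (_* fromℤ (↧ β)) (*-denominator α) ⟩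
      fromℤ (↥ α) * fromℤ (↧ β) ≡⟨ fromℤ-* (↥ α) (↧ β) ⟨
      fromℤ A ∎
      where open ≡-Reasoning

    βT : β * T ≡ fromℤ B
    βT = begin
      β * fromℤ (↧ α ℤ.* ↧ β) ≡⟨ cong (β *_) (trans (cong fromℤ (ℤ.*-comm (↧ α) (↧ β))) (fromℤ-* (↧ β) (↧ α))) ⟩
      β * (fromℤ (↧ β) * fromℤ (↧ α)) ≡⟨ *-assoc β (fromℤ (↧ β)) (fromℤ (↧ α)) ⟨
      β * fromℤ (↧ β) * fromℤ (↧ α) ≡⟨ cong (_* fromℤ (↧ α)) (*-denominator β) ⟩
      fromℤ (↥ β) * fromℤ (↧ α) ≡⟨ fromℤ-* (↥ β) (↧ α) ⟨
      fromℤ B ∎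
      where open ≡-Reasoning

    fromℤ-t* : ∀ m {p} → fromℕ m ≡ p → fromℤ (t ℤ.* + m) ≡ T * p
    fromℤ-t* m refl = fromℤ-* t (+ m)

    t*intc : ∀ i → i ℕ.< diameter → t ℤ.* + intc (suc i) ≡ br (suc i) ℤ.* (t ℤ.+ A ℤ.* br i)
    t*intc i i<D = fromℤ-injective (begin
      fromℤ (t ℤ.* + intc (suc i)) ≡⟨ fromℤ-t* (intc (suc i)) (intc≡ (suc i) (s≤s z≤n) i<D) ⟩
      T * (bracket b b≢1 (suc i) * (1ℚ + α * bracket b b≢1 i))
        ≡⟨ cong₂ (λ u v → T * (u * (1ℚ + α * v))) (bracket≡ b b≢1 (suc i)) (bracket≡ b b≢1 i) ⟩
      T * (fromℤ (br (suc i)) * (1ℚ + α * fromℤ (br i))) ≡⟨ rearrange T (fromℤ (br (suc i))) α (fromℤ (br i)) ⟩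
      fromℤ (br (suc i)) * (T + α * T * fromℤ (br i)) ≡⟨ cong (λ u → fromℤ (br (suc i)) * (T + u * fromℤ (br i))) αT ⟩
      fromℤ (br (suc i)) * (T + fromℤ A * fromℤ (br i))
        ≡⟨ cong (fromℤ (br (suc i)) *_) (trans (fromℤ-+ t (A ℤ.* br i)) (cong (λ u → T + u) (fromℤ-* A (br i)))) ⟨
      fromℤ (br (suc i)) * fromℤ (t ℤ.+ A ℤ.* br i) ≡⟨ fromℤ-* (br (suc i)) (t ℤ.+ A ℤ.* br i) ⟨
      fromℤ (br (suc i) ℤ.* (t ℤ.+ A ℤ.* br i)) ∎)
      where
      open ≡-Reasoning
      rearrange : ∀ t x a y → t * (x * (1ℚ + a * y)) ≡ x * (t + a * t * y)
      rearrange = solve 4 (λ t x a y → t :* (x :* (con 1ℚ :+ a :* y)) := x :* (t :+ a :* t :* y)) refl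

    t*intb : ∀ i → i ℕ.< diameter → t ℤ.* + intb i ≡ (br diameter ℤ.- br i) ℤ.* (B ℤ.- A ℤ.* br i)
    t*intb i i<D = fromℤ-injective (begin
      fromℤ (t ℤ.* + intb i) ≡⟨ fromℤ-t* (intb i) (intb≡ i i<D) ⟩
      T * ((bracket b b≢1 diameter - bracket b b≢1 i) * (β - α * bracket b b≢1 i))
        ≡⟨ cong₂ (λ u v → T * ((u - v) * (β - α * v))) (bracket≡ b b≢1 diameter) (bracket≡ b b≢1 i) ⟩
      T * ((r - e) * (β - α * e)) ≡⟨ rearrange T r e α β ⟩
      (r - e) * (β * T - α * T * e) ≡⟨ cong₂ (λ u v → (r - e) * (u - v * e)) βT αT ⟩
      (r - e) * (fromℤ B - fromℤ A * e)
        ≡⟨ cong₂ _*_ (fromℤ-- (br diameter) (br i)) (trans (fromℤ-- B (A ℤ.* br i)) (cong (λ u → fromℤ B - u) (fromℤ-* A (br i)))) ⟨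
      fromℤ (br diameter ℤ.- br i) * fromℤ (B ℤ.- A ℤ.* br i) ≡⟨ fromℤ-* (br diameter ℤ.- br i) (B ℤ.- A ℤ.* br i) ⟨
      fromℤ ((br diameter ℤ.- br i) ℤ.* (B ℤ.- A ℤ.* br i)) ∎)
      where
      open ≡-Reasoning
      r e : ℚ
      r = fromℤ (br diameter)
      e = fromℤ (br i)
      rearrange : ∀ t r e a b → t * ((r - e) * (b - a * e)) ≡ (r - e) * (b * t - a * t * e)
      rearrange = solve 5 (λ t r e a b → t :* ((r :- e) :* (b :- a :* e)) := (r :- e) :* (b :* t :- a :* t :* e)) refl

    B-large : (+ 8 ℤ.* A ℤ.* b ℤ.+ + 8 ℤ.* b ℤ.* t ℤ.+ + 5 ℤ.* A) ℤ.* br diameter ℤ.≤ + 3 ℤ.* B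
    B-large = fromℤ-cancel-≤ (begin
      fromℤ ((+ 8 ℤ.* A ℤ.* b ℤ.+ + 8 ℤ.* b ℤ.* t ℤ.+ + 5 ℤ.* A) ℤ.* br diameter) ≡⟨ expand ⟩
      (e8 * fromℤ A * fromℤ b + e8 * fromℤ b * T + e5 * fromℤ A) * r
        ≡⟨ cong (λ a → (e8 * a * fromℤ b + e8 * fromℤ b * T + e5 * a) * r) αT ⟨
      (e8 * (α * T) * fromℤ b + e8 * fromℤ b * T + e5 * (α * T)) * r ≡⟨ rearrange e8 e5 α (fromℤ b) T r ⟩
      1ℚ * (e8 * α * fromℤ b + e8 * fromℤ b + e5 * α) * r * T
        ≡⟨ rearrange′ (e8 * α * fromℤ b + e8 * fromℤ b + e5 * α) r T ⟩
      fromℤ (+ 3) * ((+ 1 ℚ./ 3) * (e8 * α * fromℤ b + e8 * fromℤ b + e5 * α) * r * T)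
        ≡⟨ cong (λ u → fromℤ (+ 3) * ((+ 1 ℚ./ 3) * (e8 * α * fromℤ b + e8 * fromℤ b + e5 * α) * u * T)) (bracket≡ b b≢1 diameter) ⟨
      fromℤ (+ 3) * ((+ 1 ℚ./ 3) * (e8 * α * fromℤ b + e8 * fromℤ b + e5 * α) * bracket b b≢1 diameter * T)
        ≤⟨ *-monoˡ-≤-nonNeg (fromℤ (+ 3)) (*-monoʳ-≤-nonNeg T {{pos⇒nonNeg T}} β-large) ⟩
      fromℤ (+ 3) * (β * T) ≡⟨ cong (fromℤ (+ 3) *_) βT ⟩
      fromℤ (+ 3) * fromℤ B ≡⟨ fromℤ-* (+ 3) B ⟨
      fromℤ (+ 3 ℤ.* B) ∎)
      where
      open ≤-Reasoning
      e8 e5 r : ℚ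
      e8 = fromℤ (+ 8)
      e5 = fromℤ (+ 5)
      r = fromℤ (br diameter)
      rearrange : ∀ x y a b t r → (x * (a * t) * b + x * b * t + y * (a * t)) * r ≡ 1ℚ * (x * a * b + x * b + y * a) * r * t
      rearrange = solve 6 (λ x y a b t r → (x :* (a :* t) :* b :+ x :* b :* t :+ y :* (a :* t)) :* r
        := con 1ℚ :* (x :* a :* b :+ x :* b :+ y :* a) :* r :* t) refl
      rearrange′ : ∀ h r t → 1ℚ * h * r * t ≡ fromℤ (+ 3) * ((+ 1 ℚ./ 3) * h * r * t)
      rearrange′ = solve 3 (λ h r t → con 1ℚ :* h :* r :* t := con (fromℤ (+ 3)) :* (con (+ 1 ℚ./ 3) :* h :* r :* t)) refl
      expand : fromℤ ((+ 8 ℤ.* A ℤ.* b ℤ.+ + 8 ℤ.* b ℤ.* t ℤ.+ + 5 ℤ.* A) ℤ.* br diameter)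
        ≡ (e8 * fromℤ A * fromℤ b + e8 * fromℤ b * T + e5 * fromℤ A) * r
      expand = trans (fromℤ-* (+ 8 ℤ.* A ℤ.* b ℤ.+ + 8 ℤ.* b ℤ.* t ℤ.+ + 5 ℤ.* A) (br diameter)) (cong (_* r)
        (trans (fromℤ-+ (+ 8 ℤ.* A ℤ.* b ℤ.+ + 8 ℤ.* b ℤ.* t) (+ 5 ℤ.* A)) (cong₂ _+_
          (trans (fromℤ-+ (+ 8 ℤ.* A ℤ.* b) (+ 8 ℤ.* b ℤ.* t)) (cong₂ _+_ (product (+ 8) A b) (product (+ 8) b t)))
          (fromℤ-* (+ 5) A))))
        where
        product : ∀ i j k → fromℤ (i ℤ.* j ℤ.* k) ≡ fromℤ i * fromℤ j * fromℤ k
        product i j k = trans (fromℤ-* (i ℤ.* j) k) (cong (_* fromℤ k) (fromℤ-* i j))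

    4r/3 : ℚ
    4r/3 = (+ 4 ℚ./ 3) * bracket b b≢1 diameter

    floor-4r/3 : (+ 3 ℤ.* floor 4r/3 ℤ.≤ + 4 ℤ.* br diameter) × (+ 4 ℤ.* br diameter ℤ.≤ + 3 ℤ.* floor 4r/3 ℤ.+ + 2)
    floor-4r/3 = subst (λ f → (+ 3 ℤ.* f ℤ.≤ + 4 ℤ.* br diameter) × (+ 4 ℤ.* br diameter ℤ.≤ + 3 ℤ.* f ℤ.+ + 2))
      (cong (λ u → floor ((+ 4 ℚ./ 3) * u)) (sym (bracket≡ b b≢1 diameter))) (floor-4/3 (br diameter))

    -- Claws are counted with a natural number s, whereas `floor` is an integer; r ≥ 3 bridges the
    -- gap.
    0≤floor : 0ℤ ℤ.≤ floor 4r/3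
    0≤floor = *-cancelˡ-≤ {c = + 3} (ℤ.+<+ (s≤s z≤n)) (≤-by _
      (0≤+ (0≤+ (0≤- (proj₂ floor-4r/3)) (0≤* (0≤ℕ 4) (0≤- (Bracket.3≤br b 2≤b {diameter} (ℕ.≤-trans (s≤s (s≤s z≤n)) 3≤D))))) (0≤ℕ 10))
      (lemma (floor 4r/3) (br diameter)))
      where
      lemma : ∀ f r → + 3 ℤ.* f ≡ + 3 ℤ.* 0ℤ ℤ.+ ((+ 3 ℤ.* f ℤ.+ + 2 ℤ.- + 4 ℤ.* r) ℤ.+ + 4 ℤ.* (r ℤ.- + 3) ℤ.+ + 10)
      lemma = solve-∀

    module _ (s : ℕ) (s≡ : + s ≡ floor 4r/3) where

      open IntegralParameters Γ t A B b s 2≤b 0<t 3≤D t*intc t*intb B-large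
        (subst (λ f → + 3 ℤ.* f ℤ.≤ + 4 ℤ.* br diameter) (sym s≡) (proj₁ floor-4r/3))
        (subst (λ f → + 4 ℤ.* br diameter ℤ.≤ + 3 ℤ.* f ℤ.+ + 2) (sym s≡) (proj₂ floor-4r/3))

      Conclusion : Set
      Conclusion = HasSPLS Γ (floor 4r/3) × (∃ λ a → α ≡ fromℤ a) × 0ℚ ≤ α × α ≤ fromℤ b

      conclude : (∃ λ φ → t ℤ.* φ ≡ t ℤ.+ A × φ ℤ.* φ ℤ.≤ + intc 2) → Conclusion
      conclude (φ , tφ≡ , φ²≤c₂) = subst (HasSPLS Γ) s≡ hasSPLS
        -- φ = 1 + α counts neighbours on a tight line, so φ - 1 is the integer α.
        , (φ ℤ.- 1ℤ , *-cancelʳ T (begin-equality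
            α * T ≡⟨ αT ⟩
            fromℤ A ≡⟨ cong fromℤ (trans (lemma₁ t A) (trans (cong (λ u → u ℤ.- t) (sym tφ≡)) (lemma₂ t φ))) ⟩
            fromℤ ((φ ℤ.- 1ℤ) ℤ.* t) ≡⟨ fromℤ-* (φ ℤ.- 1ℤ) t ⟩
            fromℤ (φ ℤ.- 1ℤ) * T ∎))
        , *-cancelʳ-≤-pos T (begin
            0ℚ * T ≡⟨ *-zeroˡ T ⟩
            fromℤ 0ℤ ≤⟨ fromℤ-mono-≤ 0≤A ⟩
            fromℤ A ≡⟨ αT ⟨
            α * T ∎)
        , *-cancelʳ-≤-pos T (begin
            α * T ≡⟨ αT ⟩
            fromℤ A ≤⟨ fromℤ-mono-≤ (φ²≤c₂⇒A≤t*b φ tφ≡ φ²≤c₂) ⟩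
            fromℤ (t ℤ.* b) ≡⟨ trans (cong fromℤ (ℤ.*-comm t b)) (fromℤ-* b t) ⟩
            fromℤ b * T ∎)
        where
        open ≤-Reasoning
        lemma₁ : ∀ t A → A ≡ t ℤ.+ A ℤ.- t
        lemma₁ = solve-∀
        lemma₂ : ∀ t φ → t ℤ.* φ ℤ.- t ≡ (φ ℤ.- 1ℤ) ℤ.* t
        lemma₂ = solve-∀

      conclusion : Conclusion
      conclusion = conclude integral

open Conversion using (conclusion; 0≤floor)
open import Defs
open import Data.Nat using (ℕ)
open import Data.Integer using (ℤ; +_; 1ℤ)
open import Data.Rational using (ℚ; 0ℚ; _/_; _+_; _*_; _≤_; _≥_; floor)
open import Data.Product using (_×_; ∃)
open import Relation.Binary.PropositionalEquality using (_≡_; _≢_; refl)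
import Data.Nat as Nat
import Data.Integer as Int
import Data.Integer.Properties as Intₚ

theorem14 : ∀ {n : ℕ} (Γ : DistanceRegularGraph n) (D : ℕ) (b : ℤ) (b≢1 : b ≢ 1ℤ) (α β : ℚ) →
  HasClassicalParameters Γ D b b≢1 α β →
  b Int.≥ + 2 → D Nat.≥ 3 →
  let r = bracket b b≢1 D
      B = fromℤ b
  in β ≥ (+ 1 / 3) * ((+ 8 / 1) * α * B + (+ 8 / 1) * B + (+ 5 / 1) * α) * r →
     HasSPLS Γ (floor ((+ 4 / 3) * r))
     × (∃ λ (a : ℤ) → α ≡ fromℤ a)
     × 0ℚ ≤ α
     × α ≤ B
theorem14 Γ D b b≢1 α β classical 2≤b 3≤D β-large with HasClassicalParameters.diameter≡ classical
... | refl = conclusion Γ b b≢1 α β classical 2≤b 3≤D β-large Int.∣ floor ((+ 4 / 3) * bracket b b≢1 D) ∣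
  (Intₚ.0≤i⇒+∣i∣≡i (0≤floor Γ b b≢1 α β classical 2≤b 3≤D β-large))
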